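{- For $n\ge 1$ and $k\ge 1$, the number of permutations of genus $1$ in $S_n$ with $k$ cycles is $$p_*(n,k)=\frac16\binom{n+1}{2}\binom{n-1}{k+1}\binom{n-1}{k-1}.$$ More precisely, for $j=0,1,2$, the number $p_j(n,k)$ of permutations of genus $1$ in $S_n$ with exactly $j$ back points and $k$ cycles is $$p_0(n,k)=\frac16\binom{n}{2}\binom{n-2}{k}\binom{n-2}{k-2},\qquad p_2(n,k)=\frac16\binom{n}{2}\binom{n-2}{k+1}\binom{n-2}{k-1},$$ $$p_1(n,k)=\frac13\binom{n}{2}\binom{n-2}{k}\binom{n-2}{k-1}.$$ In particular $p_0(n,k)$ is the number of partitions of $\{1,\dots,n\}$ of genus one with $k$ parts.
   Context: For $n\ge 1$ let $\zeta_n\in S_n$ be the cyclic permutation $\zeta_n(i)=i+1$ for $i<n$, $\zeta_n(n)=1$. Permutations are composed right to left, and $z(\pi)$ denotes the number of cycles of $\pi$ (fixed points included). The genus $g(\alpha)$ of $\alpha\in S_n$ is the non-negative integer defined by $n+1-2g(\alpha)=z(\alpha)+z(\alpha^{ -1}\zeta_n)$. An element $i$ is a back point of $\alpha$ if $\alpha(i)<i$ and $\alpha(i)$ is not the smallest element of its cycle. A partition of $\{1,\dots,n\}$ is identified with the permutation whose cycles are its blocks written in increasing order; these are exactly the permutations with no back points, and the genus of a partition is the genus of this permutation. Binomial coefficients $\binom{m}{r}$ are $0$ when $r<0$ or $r>m$. -}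

module Defs where

open import Data.Bool using (Bool; true; false; _∧_; not; if_then_else_; T)
open import Data.Nat using (ℕ; zero; suc; _+_; _≡ᵇ_; _<ᵇ_; _⊓_)
open import Data.Nat.DivMod using (_%_; m%n<n)
open import Data.Nat.Combinatorics using (_C_)
open import Data.Integer using (ℤ; +_; -[1+_])
open import Data.Fin using (Fin; toℕ; fromℕ<)
open import Data.Fin.Properties using (_≟_)
open import Data.List using (List; []; _∷_; allFin; foldr; length; filter; upTo)
open import Data.Vec using (Vec; lookup)
open import Data.Product using (Σ)
open import Relation.Nullary.Decidable using (⌊_⌋)

-- Binomial coefficient with integer arguments: 0 when r < 0 or r > m,
-- otherwise the usual binomial coefficient (stdlib's _C_ is 0 for r > m).
binom : ℤ → ℤ → ℕ
binom (+ m) (+ r) = m C r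
binom (+ m) -[1+ _ ] = 0
binom -[1+ _ ] _ = 0

-- Elements {1,…,n} are modelled by Fin n (0-based, order-preserving shift).
-- A candidate permutation is given by its table of values.
app : ∀ {n} → Vec (Fin n) n → Fin n → Fin n
app v i = lookup v i

count : ∀ {n} → (Fin n → Bool) → ℕ
count {n} p = length (filter (λ i → T? (p i)) (allFin n))
  where
  open import Data.Bool using (T?)

allB : ∀ {A : Set} → (A → Bool) → List A → Bool
allB p [] = true
allB p (x ∷ xs) = p x ∧ allB p xs

isPerm : ∀ {n} → Vec (Fin n) n → Bool
isPerm {n} v = allB (λ i → allB (λ j → not ⌊ lookup v i ≟ lookup v j ⌋ Data.Bool.∨ ⌊ i ≟ j ⌋) (allFin n)) (allFin n)
  where import Data.Bool

iter : ∀ {n} → (Fin n → Fin n) → ℕ → Fin n → Fin n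
iter f zero x = x
iter f (suc m) x = f (iter f m x)

-- smallest element of the cycle of i (the cycle of i is {f^m i | m < n})
cycleMin : ∀ {n} → (Fin n → Fin n) → Fin n → ℕ
cycleMin {n} f i = foldr (λ m acc → toℕ (iter f m i) ⊓ acc) (toℕ i) (upTo n)

isCycleMin : ∀ {n} → (Fin n → Fin n) → Fin n → Bool
isCycleMin f i = cycleMin f i ≡ᵇ toℕ i

-- z(f): number of cycles = number of cycles' smallest elements
z : ∀ {n} → (Fin n → Fin n) → ℕ
z f = count (isCycleMin f)

zeta : ∀ {n} → Fin n → Fin n
zeta {suc m} i = fromℕ< (m%n<n (suc (toℕ i)) (suc m))

-- inverse of a permutation table, by search (the fallback is never used
-- when v is a permutation)
inv : ∀ {n} → Vec (Fin n) n → Fin n → Fin n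
inv {n} v y = go (allFin n)
  where
  go : List (Fin n) → Fin n
  go [] = y
  go (i ∷ is) = if ⌊ lookup v i ≟ y ⌋ then i else go is

-- genus one:  n + 1 - 2·1 = z(α) + z(α⁻¹ ζ_n)
genusOne : ∀ {n} → Vec (Fin n) n → Bool
genusOne {n} v = (z (app v) + z (λ i → inv v (zeta i)) + 2) ≡ᵇ (n + 1)

isBackPoint : ∀ {n} → (Fin n → Fin n) → Fin n → Bool
isBackPoint f i = (toℕ (f i) <ᵇ toℕ i) ∧ not (isCycleMin f (f i))

backPoints : ∀ {n} → (Fin n → Fin n) → ℕ
backPoints f = count (isBackPoint f)

Genus1 : ℕ → ℕ → Set
Genus1 n k = Σ (Vec (Fin n) n) λ v → T (isPerm v ∧ genusOne v ∧ (z (app v) ≡ᵇ k))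

Genus1BP : ℕ → ℕ → ℕ → Set
Genus1BP n k j = Σ (Vec (Fin n) n) λ v →
  T (isPerm v ∧ genusOne v ∧ (z (app v) ≡ᵇ k) ∧ (backPoints (app v) ≡ᵇ j))

{-# OPTIONS --safe #-}
-- Every α in S_(n+1) is uniquely α′ ∘ (i n) with α′ in S_n and i ≤ n (entries are 0, …, n), that is, n is inserted
-- just after i. Follow the cycle of α⁻¹ζ through the largest entry, called the stack. If i = n, then α gains a cycle
-- and the stack an entry; if i is on the stack, the stack is cut and its upper part becomes a finished cycle of α⁻¹ζ;
-- otherwise the finished cycle containing i is merged into the stack, and only then does the genus grow, by one.
-- Call an entry x bad if α(x) > x. The number of back points grows, by one, exactly when i is bad. In genus 0
-- no entry of the stack is bad and each finished cycle has exactly one bad entry. Hence genus 1 permutations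
-- correspond to paths of stack heights with a single merge, and their completions are counted by linear recurrences in
-- the height. Marking new cycles by s and the other steps by t, the solutions are rational in the series q, v with
-- q = t(1+q)(1+v), v = s(1+q)(1+v), whose coefficients Lagrange inversion turns into products of binomial coefficients.
-- If P is the series of all genus 1 permutations, those without back points have series sP and those with two tP.
module Submission where

-- No power series occurs: every solution is an array of coefficients indexed by remaining steps,
-- remaining pushes and stack height, and is checked against its recurrence. Such a recurrence sums
-- over all lower heights; subtracting the equations at two neighbouring heights removes the sum, so
-- that the case of height one and one identity between neighbouring binomial coefficients suffice.
-- Because exactly one merge takes place, the count in genus 0 is additive: a term `V` for cycles
-- yet to be finished, plus a term `K` for each finished cycle, which depends only on its length and
-- on the stack height. `V` is the hard term, since its source sums `K` over all cuts of the stack.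
-- The factor 24 clears the denominators of binomial coefficients up to binom(l+3,4). The relations
-- with factors s and t are exact only at height one, where the permutations are read off; the
-- recurrence couples all heights, which forces the corrections `defect`.

module Recurrences where
  open import Data.Bool using (if_then_else_)
  open import Data.Nat as ℕ using (ℕ; zero; suc; _≡ᵇ_)
  open import Data.Nat.Properties using (+-suc; +-identityʳ; +-assoc)
  open import Data.Integer using (ℤ; +_; _+_; _*_; _-_; -_)
  open import Data.Integer.Properties using (*-zeroˡ; *-zeroʳ; *-distribˡ-+)
  open import Data.Integer.Solver using (module +-*-Solver)
  open import Data.Integer.Tactic.RingSolver using (solve-∀)
  open import Relation.Binary.PropositionalEquality
  open +-*-Solver using (Polynomial; solve; con; _:+_; _:*_; _:-_; :-_; _:=_)

  -- Binomial coefficients, and the coefficient arrays of the series in q and v.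

  bin : ℕ → ℕ → ℤ
  bin n zero = + 1
  bin zero (suc k) = + 0
  bin (suc n) (suc k) = bin n k + bin n (suc k)

  prev : (ℕ → ℤ) → ℕ → ℤ
  prev f zero = + 0
  prev f (suc j) = f j

  sumTo : (ℕ → ℤ) → ℕ → ℤ
  sumTo f zero = f 0
  sumTo f (suc l) = sumTo f l + f (suc l)

  prev-bin : ∀ n j → bin (suc n) j ≡ bin n j + prev (bin n) j
  prev-bin n zero = refl
  prev-bin n (suc j) = lem (bin n j) (bin n (suc j))
    where lem : ∀ x y → x + y ≡ y + x
          lem = solve-∀

  bin-zero : ∀ a k → bin a (suc (k ℕ.+ a)) ≡ + 0
  bin-zero zero k = refl
  bin-zero (suc a) k rewrite +-suc k a = cong₂ _+_ (bin-zero a k) (bin-zero a (suc k))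

  bin-diag : ∀ a → bin a a ≡ + 1
  bin-diag zero = refl
  bin-diag (suc a) rewrite bin-diag a | bin-zero a 0 = refl

  absorb : ∀ n k → (+ 1 + + k) * bin n (suc k) ≡ (+ n - + k) * bin n k
  absorb zero zero = refl
  absorb zero (suc k) = trans (*-zeroʳ (+ 1 + + suc k)) (sym (*-zeroʳ (+ 0 - + suc k)))
  absorb (suc n) zero = trans (lem (bin n 1)) (trans (cong (λ x → + 1 + x) (absorb n 0)) (lem₂ (+ n)))
    where lem : ∀ x → + 1 * (+ 1 + x) ≡ + 1 + + 1 * x
          lem = solve-∀
          lem₂ : ∀ m → + 1 + (m - + 0) * + 1 ≡ (+ 1 + m - + 0) * + 1
          lem₂ = solve-∀
  absorb (suc n) (suc k) = trans (lem (+ k) b₁ (bin n (2 ℕ.+ k)))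
    (trans (cong₂ (λ x y → x + b₁ + y) (absorb n k) (absorb n (suc k))) (lem₂ (+ n) (+ k) (bin n k) b₁))
    where b₁ = bin n (suc k)
          lem : ∀ k b c → (+ 1 + (+ 1 + k)) * (b + c) ≡ (+ 1 + k) * b + b + (+ 1 + (+ 1 + k)) * c
          lem = solve-∀
          lem₂ : ∀ n k a b → (n - k) * a + b + (n - (+ 1 + k)) * b ≡ (+ 1 + n - (+ 1 + k)) * (a + b)
          lem₂ = solve-∀

  -- This is `absorb` with the index lowered by one, so that j = 0 is included. It links the two
  -- coefficients into which Pascal's rule splits `bin (suc n) j`.
  absorb-prev : ∀ n j → + j * bin n j ≡ (+ n - + j + + 1) * prev (bin n) j
  absorb-prev n zero = sym (*-zeroʳ (+ n - + 0 + + 1))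
  absorb-prev n (suc j) = trans (absorb n j) (lem (+ n) (+ j) (bin n j))
    where lem : ∀ n k a → (n - k) * a ≡ (n - (+ 1 + k) + + 1) * a
          lem = solve-∀

  -- Coefficients of (1+q)^(1+a) q^m (1+v), where q = t(1+q)(1+v) and v = s(1+q)(1+v):
  -- n is the total degree and j the degree in s.
  r : ℕ → ℕ → ℕ → ℕ → ℤ
  r n j a m = bin n j * bin (n ℕ.+ a) (m ℕ.+ (j ℕ.+ a)) - prev (bin n) j * bin (n ℕ.+ a) (suc (m ℕ.+ (j ℕ.+ a)))

  -- Lowering j and raising a cancel in the lower index, so one formula in `prev` serves all j; at j
  -- = 0 both of its leading factors vanish.
  prev-r : ∀ n a m j → prev (λ j → r n j (suc a) m) j ≡
    prev (bin n) j * bin (suc (n ℕ.+ a)) (m ℕ.+ (j ℕ.+ a)) - prev (prev (bin n)) j * bin (suc (n ℕ.+ a)) (suc (m ℕ.+ (j ℕ.+ a)))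
  prev-r n a m zero = lem (bin (suc (n ℕ.+ a)) (m ℕ.+ a)) (bin (suc (n ℕ.+ a)) (suc (m ℕ.+ a)))
    where lem : ∀ x y → + 0 ≡ + 0 * x - + 0 * y
          lem = solve-∀
  prev-r n a m (suc j) rewrite +-suc n a | +-suc j a = refl

  prev-prev-bin : ∀ n j → prev (bin (suc n)) j ≡ prev (bin n) j + prev (prev (bin n)) j
  prev-prev-bin n zero = refl
  prev-prev-bin n (suc j) = prev-bin n j

  -- Multiplication by 1+q.
  r-pascal : ∀ n j a m → r n j (suc a) m ≡ r n j a m + r n j a (suc m)
  r-pascal n j a m rewrite +-suc n a | +-suc j a | +-suc m (j ℕ.+ a) =
    lem (bin n j) (prev (bin n) j) (bin (n ℕ.+ a) (m ℕ.+ (j ℕ.+ a))) (bin (n ℕ.+ a) (suc (m ℕ.+ (j ℕ.+ a)))) (bin (n ℕ.+ a) (suc (suc (m ℕ.+ (j ℕ.+ a)))))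
    where lem : ∀ p q x y z → p * (x + y) - q * (y + z) ≡ (p * x - q * y) + (p * y - q * z)
          lem = solve-∀

  -- One factor q is replaced by t(1+q)(1+v), and the surplus factor 1+v by 1 + s(1+q)(1+v). In the
  -- term with s the factor t(1+q)(1+v) is turned back into q.
  r-step : ∀ n j a m → r (suc n) j a (suc m) ≡ r n j (suc a) m + prev (λ j → r n j (suc a) (suc m)) j
  r-step n j a m rewrite prev-r n a (suc m) j | prev-bin n j | prev-prev-bin n j | +-suc n a | +-suc j a | +-suc m (j ℕ.+ a) =
    lem (bin n j) (prev (bin n) j) (prev (prev (bin n)) j) (bin (suc (n ℕ.+ a)) (suc (m ℕ.+ (j ℕ.+ a)))) (bin (suc (n ℕ.+ a)) (suc (suc (m ℕ.+ (j ℕ.+ a)))))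
    where lem : ∀ p q q' x y → (p + q) * x - (q + q') * y ≡ (p * x - q * y) + (q * x - q' * y)
          lem = solve-∀

  -- The coefficients of (1+q)(1+v) = 1 + t(1+q)(1+v) + s(1+q)^2(1+v) in positive degree: a stack of
  -- one entry either is cut, which leaves height one, or grows to height two.
  r-base : ∀ n j → r (suc n) j 0 0 ≡ r n j 0 0 + prev (λ j → r n j 1 0) j
  r-base n zero = refl' (bin (n ℕ.+ 0) 0) (bin (suc (n ℕ.+ 0)) 1) (bin (n ℕ.+ 0) 1)
    where refl' : ∀ x y z → + 1 * + 1 - + 0 * y ≡ (+ 1 * + 1 - + 0 * z) + + 0
          refl' = solve-∀
  r-base n (suc j) rewrite prev-bin n j | +-suc n 0 | +-suc j 0 | +-identityʳ n | +-identityʳ j =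
    lem (bin n (suc j)) (bin n j) (prev (bin n) j) (bin n (suc (suc j)))
    where lem : ∀ p q q' z → (q + p) * (q + p) - (q + q') * (p + z) ≡ (p * p - q * z) + (q * (q + p) - q' * (p + z))
          lem = solve-∀

  r-zero : ∀ j a m → r 0 j a (suc m) ≡ + 0
  r-zero zero a m rewrite bin-zero a m = refl
  r-zero (suc j) a m = lem (bin a (suc (m ℕ.+ (suc j ℕ.+ a)))) (prev (bin 0) (suc j)) (bin a (suc (suc (m ℕ.+ (suc j ℕ.+ a))))) (cong (λ x → bin a (suc (suc x))) (trans (cong (m ℕ.+_) refl) (trans (+-suc m (j ℕ.+ a)) (cong suc (sym (+-assoc m j a))))))
    where lem : ∀ x q y → y ≡ bin a (suc (suc (suc ((m ℕ.+ j) ℕ.+ a)))) → + 0 * x - q * y ≡ + 0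
          lem x q y e = trans (cong (λ y → + 0 * x - q * y) (trans e (bin-zero a (suc (suc (m ℕ.+ j)))))) (lem' x q)
            where lem' : ∀ x q → + 0 * x - q * + 0 ≡ + 0
                  lem' = solve-∀

  r-zero-zero : ∀ a → r 0 0 a 0 ≡ + 1
  r-zero-zero a rewrite bin-diag a = refl

  r-zero-suc : ∀ j a → r 0 (suc j) a 0 ≡ + 0
  r-zero-suc j a = trans (cong (λ y → + 0 * bin a (suc (j ℕ.+ a)) - prev (bin 0) (suc j) * y) (bin-zero a (suc j))) (lem (bin a (suc (j ℕ.+ a))) (prev (bin 0) (suc j)))
    where lem : ∀ x q → + 0 * x - q * + 0 ≡ + 0
          lem = solve-∀

  -- Coefficients of q^(m+1) (1+q)^(t+1) (1+xq) (1+v) / (1-qv): completions, from a stack of height x,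
  -- that merge later with one fixed finished cycle.
  k : ℕ → ℕ → ℕ → ℕ → ℤ → ℤ
  k n j t m x = bin n j * (bin (n ℕ.+ t) (suc (m ℕ.+ (j ℕ.+ t))) + x * bin (n ℕ.+ t) (suc (suc (m ℕ.+ (j ℕ.+ t)))))

  prev-k : ∀ n t m x j → prev (λ j → k n j (suc t) m x) j ≡
    prev (bin n) j * (bin (suc (n ℕ.+ t)) (suc (m ℕ.+ (j ℕ.+ t))) + x * bin (suc (n ℕ.+ t)) (suc (suc (m ℕ.+ (j ℕ.+ t)))))
  prev-k n t m x zero = sym (*-zeroˡ (bin (suc (n ℕ.+ t)) (suc (m ℕ.+ t)) + x * bin (suc (n ℕ.+ t)) (suc (suc (m ℕ.+ t)))))
  prev-k n t m x (suc j) rewrite +-suc n t | +-suc j t = refl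

  k-base : ∀ n j t m → k (suc n) j t m (+ 1) ≡ k n j t m (+ 1) + prev (λ j → k n j (suc t) m (+ 2)) j + r n j (suc t) m
  k-base n j t m rewrite prev-k n t m (+ 2) j | prev-bin n j | +-suc n t | +-suc j t | +-suc m (j ℕ.+ t) =
    lem (bin n j) (prev (bin n) j) (bin (n ℕ.+ t) s) (bin (n ℕ.+ t) (suc s)) (bin (n ℕ.+ t) (suc (suc s)))
    where s = m ℕ.+ (j ℕ.+ t)
          lem : ∀ p q x y z → (p + q) * ((x + y) + + 1 * (y + z)) ≡
            p * (y + + 1 * z) + q * ((x + y) + + 2 * (y + z)) + (p * (x + y) - q * (y + z))
          lem = solve-∀

  -- The difference of the equations `k-step` at two neighbouring heights, arranged without
  -- subtraction. There t = l + δ and x = l + 1, but the identity holds for independent t and x.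
  k-diff : ∀ n j t m x → k (suc n) j (suc t) m (+ 1 + x) + prev (λ j → k n j (suc t) m (+ 1 + x)) j + r n j (suc t) m ≡
    k (suc n) j t m x + k n j (suc t) m (+ 1 + x) + prev (λ j → k n j (suc (suc t)) m (+ 2 + x)) j + r n j (suc (suc t)) m
  k-diff n j t m x rewrite prev-k n t m (+ 1 + x) j | prev-k n (suc t) m (+ 2 + x) j | prev-bin n j | +-suc n (suc t) | +-suc n t | +-suc j (suc t) | +-suc j t | +-suc m (suc (j ℕ.+ t)) | +-suc m (j ℕ.+ t) =
    lem (bin n j) (prev (bin n) j) (bin (n ℕ.+ t) s) (bin (n ℕ.+ t) (suc s)) (bin (n ℕ.+ t) (suc (suc s))) (bin (n ℕ.+ t) (suc (suc (suc s)))) x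
    where s = m ℕ.+ (j ℕ.+ t)
          lem : ∀ p q b₀ b₁ b₂ b₃ x →
            (p + q) * (((b₀ + b₁) + (b₁ + b₂)) + (+ 1 + x) * ((b₁ + b₂) + (b₂ + b₃))) + q * ((b₀ + b₁) + (+ 1 + x) * (b₁ + b₂)) + (p * (b₀ + b₁) - q * (b₁ + b₂)) ≡
            (p + q) * ((b₀ + b₁) + x * (b₁ + b₂)) + p * ((b₁ + b₂) + (+ 1 + x) * (b₂ + b₃)) + q * (((b₀ + b₁) + (b₁ + b₂)) + (+ 2 + x) * ((b₁ + b₂) + (b₂ + b₃))) + (p * ((b₀ + b₁) + (b₁ + b₂)) - q * ((b₁ + b₂) + (b₂ + b₃)))
          lem = solve-∀

  -- A push raises the height, a cut leaves any height up to the present one, and merging at once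
  -- leaves a stack in genus 1, counted by `r`. The surplus δ of the exponent over the height comes
  -- from the length of the merged cycle.
  k-step : ∀ n j l δ m → k (suc n) j (l ℕ.+ δ) m (+ suc l) ≡
    prev (λ j → k n j (suc (l ℕ.+ δ)) m (+ suc (suc l))) j + sumTo (λ l → k n j (l ℕ.+ δ) m (+ suc l)) l + r n j (suc (l ℕ.+ δ)) m
  k-step n j zero δ m = trans (k-base n j δ m) (lem (k n j δ m (+ 1)) _ _)
    where lem : ∀ x y z → x + y + z ≡ y + x + z
          lem = solve-∀
  k-step n j (suc l) δ m = lem _ _ _ _ _ _ _ _ (k-diff n j (l ℕ.+ δ) m (+ suc l)) (k-step n j l δ m)
    where lem : ∀ a b c d e f g h → a + b + c ≡ d + e + f + g → d ≡ b + h + c → a ≡ f + (h + e) + g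
          lem a b c d e f g h p q = trans (sol a b c) (trans (cong (_- (b + c)) (trans p (cong (λ d → d + e + f + g) q))) (sol₂ b c e f g h))
            where sol : ∀ a b c → a ≡ (a + b + c) - (b + c)
                  sol = solve-∀
                  sol₂ : ∀ b c e f g h → (b + h + c + e + f + g) - (b + c) ≡ f + (h + e) + g
                  sol₂ = solve-∀

  k-zero : ∀ j t m x → k 0 j t m x ≡ + 0
  k-zero zero t m x rewrite bin-zero t m | bin-zero t (suc m) = lem x
    where lem : ∀ x → + 1 * (+ 0 + x * + 0) ≡ + 0
          lem = solve-∀
  k-zero (suc j) t m x = *-zeroˡ (bin t (suc (m ℕ.+ suc (j ℕ.+ t))) + x * bin t (suc (suc (m ℕ.+ suc (j ℕ.+ t)))))

  -- Linear recurrences in the stack height, and completions that merge with a given cycle.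

  sumTo-+ : ∀ f g l → sumTo (λ i → f i + g i) l ≡ sumTo f l + sumTo g l
  sumTo-+ f g zero = refl
  sumTo-+ f g (suc l) rewrite sumTo-+ f g l = lem (sumTo f l) (sumTo g l) (f (suc l)) (g (suc l))
    where lem : ∀ a b c d → a + b + (c + d) ≡ (a + c) + (b + d)
          lem = solve-∀

  sumTo-* : ∀ x f l → sumTo (λ i → x * f i) l ≡ x * sumTo f l
  sumTo-* x f zero = refl
  sumTo-* x f (suc l) rewrite sumTo-* x f l = sym (*-distribˡ-+ x (sumTo f l) (f (suc l)))

  Array : Set
  Array = ℕ → ℕ → ℕ → ℤ

  -- The recurrence of a count indexed by remaining steps, remaining pushes and l + 1 the stack height,
  -- in which G counts the steps that leave the regime.
  Step : Array → Array → Set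
  Step F G = ∀ n j l → F (suc n) j l ≡ prev (λ j → F n j (suc l)) j + sumTo (F n j) l + G n j l

  -- Linearity is what allows the contributions of different cycles, and of different numbers of
  -- back points, to be added.
  step-+ : ∀ {F G F' G'} → Step F G → Step F' G' → Step (λ n j l → F n j l + F' n j l) (λ n j l → G n j l + G' n j l)
  step-+ {F} {G} {F'} {G'} s s' n j l
    rewrite s n j l | s' n j l | sumTo-+ (F n j) (F' n j) l = lem j
    where sol : ∀ a b c d e f → (a + b + c) + (d + e + f) ≡ (a + d) + (b + e) + (c + f)
          sol = solve-∀
          lem : ∀ i → (prev (λ j → F n j (suc l)) i + sumTo (F n j) l + G n j l) + (prev (λ j → F' n j (suc l)) i + sumTo (F' n j) l + G' n j l)
            ≡ prev (λ j → F n j (suc l) + F' n j (suc l)) i + (sumTo (F n j) l + sumTo (F' n j) l) + (G n j l + G' n j l)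
          lem zero = sol (+ 0) (sumTo (F n j) l) (G n j l) (+ 0) (sumTo (F' n j) l) (G' n j l)
          lem (suc i) = sol (F n i (suc l)) (sumTo (F n j) l) (G n j l) (F' n i (suc l)) (sumTo (F' n j) l) (G' n j l)

  step-* : ∀ x {F G} → Step F G → Step (λ n j l → x * F n j l) (λ n j l → x * G n j l)
  step-* x {F} {G} s n j l rewrite s n j l | sumTo-* x (F n j) l = lem j
    where sol : ∀ x a b c → x * (a + b + c) ≡ x * a + x * b + x * c
          sol = solve-∀
          sol₀ : ∀ x b c → x * (+ 0 + b + c) ≡ + 0 + x * b + x * c
          sol₀ = solve-∀
          lem : ∀ i → x * (prev (λ j → F n j (suc l)) i + sumTo (F n j) l + G n j l)
            ≡ prev (λ j → x * F n j (suc l)) i + x * sumTo (F n j) l + x * G n j l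
          lem zero = sol₀ x _ _
          lem (suc i) = sol x _ (sumTo (F n j) l) _

  module Weighted (W : ℕ → ℤ) where

    -- W evaluated at the final number of back points; e bad entries and a + 1 good ones on the stack.
    ρ : ℕ → ℕ → ℕ → ℕ → ℕ → ℕ → ℤ
    ρ n j zero b a m = W b * r n j a m
    ρ n j (suc e) b a m = ρ n j e b a m + ρ n j e (suc b) a (suc m)

    -- A good entry contributes a factor 1+q and a bad one a factor 1+yq, where y marks back points.
    -- These factors commute, so only the numbers of good and bad entries matter.
    ρ-pascal : ∀ n j e b a m → ρ n j e b (suc a) m ≡ ρ n j e b a m + ρ n j e b a (suc m)
    ρ-pascal n j zero b a m rewrite r-pascal n j a m = *-distribˡ-+ (W b) _ _
    ρ-pascal n j (suc e) b a m rewrite ρ-pascal n j e b a m | ρ-pascal n j e (suc b) a (suc m) =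
      lem (ρ n j e b a m) _ _ _
      where lem : ∀ p q r s → (p + q) + (r + s) ≡ (p + r) + (q + s)
            lem = solve-∀

    ρ-step : ∀ n j e b a m → ρ (suc n) j e b a (suc m) ≡ ρ n j e b (suc a) m + prev (λ j → ρ n j e b (suc a) (suc m)) j
    ρ-step n j zero b a m rewrite r-step n j a m = lem j
      where lem : ∀ i → W b * (r n j (suc a) m + prev (λ j → r n j (suc a) (suc m)) i) ≡ W b * r n j (suc a) m + prev (λ j → W b * r n j (suc a) (suc m)) i
            lem zero = lem' (W b) (r n j (suc a) m)
              where lem' : ∀ w x → w * (x + + 0) ≡ w * x + + 0
                    lem' = solve-∀
            lem (suc i) = *-distribˡ-+ (W b) _ _
    ρ-step n j (suc e) b a m rewrite ρ-step n j e b a m | ρ-step n j e (suc b) a (suc m) = lem j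
      where sol : ∀ p q r s → (p + q) + (r + s) ≡ (p + r) + (q + s)
            sol = solve-∀
            lem : ∀ i → (ρ n j e b (suc a) m + prev (λ j → ρ n j e b (suc a) (suc m)) i) + (ρ n j e (suc b) (suc a) (suc m) + prev (λ j → ρ n j e (suc b) (suc a) (suc (suc m))) i)
              ≡ ρ n j e b (suc a) m + ρ n j e (suc b) (suc a) (suc m) + prev (λ j → ρ n j e b (suc a) (suc m) + ρ n j e (suc b) (suc a) (suc (suc m))) i
            lem zero = sol (ρ n j e b (suc a) m) (+ 0) (ρ n j e (suc b) (suc a) (suc m)) (+ 0)
            lem (suc i) = sol (ρ n j e b (suc a) m) _ (ρ n j e (suc b) (suc a) (suc m)) _

    ρ-zero : ∀ j e b a m → ρ 0 j e b a (suc m) ≡ + 0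
    ρ-zero j zero b a m rewrite r-zero j a m = *-zeroʳ (W b)
    ρ-zero j (suc e) b a m rewrite ρ-zero j e b a m | ρ-zero j e (suc b) a (suc m) = refl

    ρ-zero-zero : ∀ e b a → ρ 0 0 e b a 0 ≡ W b
    ρ-zero-zero zero b a rewrite r-zero-zero a = lem (W b)
      where lem : ∀ w → w * + 1 ≡ w
            lem = solve-∀
    ρ-zero-zero (suc e) b a rewrite ρ-zero-zero e b a | ρ-zero 0 e (suc b) a 0 = lem (W b)
      where lem : ∀ w → w + + 0 ≡ w
            lem = solve-∀

    ρ-zero-suc : ∀ j e b a → ρ 0 (suc j) e b a 0 ≡ + 0
    ρ-zero-suc j zero b a rewrite r-zero-suc j a = *-zeroʳ (W b)
    ρ-zero-suc j (suc e) b a rewrite ρ-zero-suc j e b a | ρ-zero (suc j) e (suc b) a 0 = refl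

    -- Merging at one of the c good entries, or at the bad one, of a finished cycle of length c + 1.
    merging : ℕ → Array
    merging c n j l = + c * ρ n j 2 0 (l ℕ.+ c) 0 + ρ n j 1 1 (suc (l ℕ.+ c)) 0

    κ : ℕ → ℕ → Array
    κ δ m n j l = k n j (l ℕ.+ δ) m (+ suc l)

    κ-step : ∀ δ m → Step (κ δ m) (λ n j l → r n j (suc (l ℕ.+ δ)) m)
    κ-step δ m n j l = k-step n j l δ m

    -- The solution of the recurrence with source `merging c`: merging at a good entry contributes
    -- (1+yq)^2 and merging at the bad one y(1+yq), where the i-th power of y is read as `W i`. The
    -- good entries need δ = c - 1, hence the separate clause for c = 0, where there are none.
    K : ℕ → Array
    K zero n j l = W 1 * κ 0 0 n j l + W 2 * κ 0 1 n j l
    K (suc c) n j l = (+ suc c) * (W 0 * κ c 0 n j l + (+ 2 * W 1) * κ c 1 n j l + W 2 * κ c 2 n j l)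
      + (W 1 * κ (suc c) 0 n j l + W 2 * κ (suc c) 1 n j l)

    K-step : ∀ c → Step (K c) (merging c)
    K-step zero n j l = trans (step-+ {G = λ n j l → W 1 * r n j (suc (l ℕ.+ 0)) 0} (step-* (W 1) (κ-step 0 0)) (step-* (W 2) (κ-step 0 1)) n j l)
      (cong (λ x → prev (λ j → K zero n j (suc l)) j + sumTo (K zero n j) l + x) (lem (ρ n j 2 0 (l ℕ.+ 0) 0) (ρ n j 1 1 (suc (l ℕ.+ 0)) 0)))
      where lem : ∀ x y → y ≡ + 0 * x + y
            lem = solve-∀
    K-step (suc c) n j l = trans (step-+ {G = λ n j l → (+ suc c) * (W 0 * r n j (suc (l ℕ.+ c)) 0 + (+ 2 * W 1) * r n j (suc (l ℕ.+ c)) 1 + W 2 * r n j (suc (l ℕ.+ c)) 2)}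
        (step-* (+ suc c) (step-+ {G = λ n j l → W 0 * r n j (suc (l ℕ.+ c)) 0 + (+ 2 * W 1) * r n j (suc (l ℕ.+ c)) 1}
           (step-+ {G = λ n j l → W 0 * r n j (suc (l ℕ.+ c)) 0} (step-* (W 0) (κ-step c 0)) (step-* (+ 2 * W 1) (κ-step c 1))) (step-* (W 2) (κ-step c 2))))
        (step-+ {G = λ n j l → W 1 * r n j (suc (l ℕ.+ suc c)) 0} (step-* (W 1) (κ-step (suc c) 0)) (step-* (W 2) (κ-step (suc c) 1))) n j l)
      (cong (λ x → prev (λ j → K (suc c) n j (suc l)) j + sumTo (K (suc c) n j) l + x) lem)
      where
      ring : ∀ w₀ w₁ w₂ c x y z u v → c * (w₀ * x + + 2 * w₁ * y + w₂ * z) + (u + v) ≡ c * ((w₀ * x + w₁ * y) + (w₁ * y + w₂ * z)) + (u + v)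
      ring = solve-∀
      lem : (+ suc c) * (W 0 * r n j (suc (l ℕ.+ c)) 0 + (+ 2 * W 1) * r n j (suc (l ℕ.+ c)) 1 + W 2 * r n j (suc (l ℕ.+ c)) 2)
        + (W 1 * r n j (suc (l ℕ.+ suc c)) 0 + W 2 * r n j (suc (l ℕ.+ suc c)) 1) ≡ merging (suc c) n j l
      lem rewrite +-suc l c = ring (W 0) (W 1) (W 2) (+ suc c) (r n j a 0) (r n j a 1) (r n j a 2) (W 1 * r n j (suc a) 0) (W 2 * r n j (suc a) 1)
        where a = suc (l ℕ.+ c)

    κ-zero : ∀ δ m j l → κ δ m 0 j l ≡ + 0
    κ-zero δ m j l = k-zero j (l ℕ.+ δ) m (+ suc l)

    K-zero : ∀ c j l → K c 0 j l ≡ + 0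
    K-zero zero j l rewrite κ-zero 0 0 j l | κ-zero 0 1 j l = lem (W 1) (W 2)
      where lem : ∀ x y → x * + 0 + y * + 0 ≡ + 0
            lem = solve-∀
    K-zero (suc c) j l rewrite κ-zero c 0 j l | κ-zero c 1 j l | κ-zero c 2 j l | κ-zero (suc c) 0 j l | κ-zero (suc c) 1 j l = lem (W 0) (W 1) (W 2) (+ suc c)
      where lem : ∀ x y z c → c * (x * + 0 + + 2 * y * + 0 + z * + 0) + (y * + 0 + z * + 0) ≡ + 0
            lem = solve-∀

  open Weighted using (K) public

  -- Closed forms of the sources, by summation over the cuts of a stack.

  sumAnti : (ℕ → ℕ → ℤ) → ℕ → ℤ
  sumAnti f zero = f 0 0
  sumAnti f (suc l) = sumAnti (λ c i → f (suc c) i) l + f 0 (suc l)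

  sumAnti-cong : ∀ {f g} l → (∀ c i → i ℕ.+ c ≡ l → f c i ≡ g c i) → sumAnti f l ≡ sumAnti g l
  sumAnti-cong zero e = e 0 0 refl
  sumAnti-cong (suc l) e = cong₂ _+_ (sumAnti-cong l (λ c i p → e (suc c) i (trans (+-suc i c) (cong suc p)))) (e 0 (suc l) (+-identityʳ (suc l)))

  sumAnti-+ : ∀ f g l → sumAnti (λ i c → f i c + g i c) l ≡ sumAnti f l + sumAnti g l
  sumAnti-+ f g zero = refl
  sumAnti-+ f g (suc l) rewrite sumAnti-+ (λ c → f (suc c)) (λ c → g (suc c)) l = lem (sumAnti (λ c → f (suc c)) l) _ _ _
    where lem : ∀ a b c d → a + b + (c + d) ≡ (a + c) + (b + d)
          lem = solve-∀

  -- Sum over the ways to split a stack of height l + 1 into a finished cycle of length c + 1 and a stack of height i + 1.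
  source : (ℕ → ℤ) → Array
  source W n j l = sumAnti (λ c i → K W c n j i) l

  -- Over c + i = l, the sums of 1, c, i + 1 and c(i + 1) are l + 1, binom(l+1,2), binom(l+2,2) and
  -- binom(l+2,3). Both A and D have to be general, as peeling off c = 0 replaces A by A + D.
  sumAnti-24 : ∀ (A D X Y : ℤ) l → sumAnti (λ c i → (+ 24 * (A + D * + c)) * (X + + suc i * Y)) l ≡
    (+ 24 * A + + 12 * D * + l) * (+ 1 + + l) * X + (+ 12 * A + + 4 * D * + l) * (+ 1 + + l) * (+ 2 + + l) * Y
  sumAnti-24 A D X Y zero = lem A D X Y
    where lem : ∀ A D X Y → (+ 24 * (A + D * + 0)) * (X + + 1 * Y) ≡ (+ 24 * A + + 12 * D * + 0) * (+ 1 + + 0) * X + (+ 12 * A + + 4 * D * + 0) * (+ 1 + + 0) * (+ 2 + + 0) * Y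
          lem = solve-∀
  sumAnti-24 A D X Y (suc l) = trans (cong (_+ last) (trans (sumAnti-cong l λ c i _ → lem₁ A D X Y (+ c) (+ suc i)) (sumAnti-24 (A + D) D X Y l))) (lem₂ A D X Y (+ l))
    where last = (+ 24 * (A + D * + 0)) * (X + + suc (suc l) * Y)
          lem₁ : ∀ A D X Y c i → (+ 24 * (A + D * (+ 1 + c))) * (X + i * Y) ≡ (+ 24 * ((A + D) + D * c)) * (X + i * Y)
          lem₁ = solve-∀
          lem₂ : ∀ A D X Y l → ((+ 24 * (A + D) + + 12 * D * l) * (+ 1 + l) * X + (+ 12 * (A + D) + + 4 * D * l) * (+ 1 + l) * (+ 2 + l) * Y) + (+ 24 * (A + D * + 0)) * (X + (+ 2 + l) * Y)
            ≡ (+ 24 * A + + 12 * D * (+ 1 + l)) * (+ 2 + l) * X + (+ 12 * A + + 4 * D * (+ 1 + l)) * (+ 2 + l) * (+ 3 + l) * Y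
          lem₂ = solve-∀

  -- Multiplication by 1+q.
  k-pascal : ∀ n j t m x → k n j (suc t) m x ≡ k n j t m x + k n j t (suc m) x
  k-pascal n j t m x rewrite +-suc n t | +-suc j t | +-suc m (j ℕ.+ t) =
    lem (bin n j) (b 1) (b 2) (b 3) x
    where b : ℕ → ℤ
          b i = bin (n ℕ.+ t) (i ℕ.+ (m ℕ.+ (j ℕ.+ t)))
          lem : ∀ p u v w x → p * ((u + v) + x * (v + w)) ≡ p * (u + x * v) + p * (v + x * w)
          lem = solve-∀

  every : ℕ → ℤ
  every _ = + 24

  only : ℕ → ℕ → ℤ
  only i b = if b ≡ᵇ i then + 24 else + 0

  -- 24 P (binom(l+2,2) X + binom(l+3,3) Y)
  tri : ℤ → ℤ → ℤ → ℤ → ℤ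
  tri P l X Y = P * (+ 12 * (+ 1 + l) * (+ 2 + l) * X + + 4 * (+ 1 + l) * (+ 2 + l) * (+ 3 + l) * Y)

  -- 24 P ((l+1) X + 2 binom(l+2,2) Y + binom(l+3,3) Z)
  cub : ℤ → ℤ → ℤ → ℤ → ℤ → ℤ
  cub P l X Y Z = P * (+ 24 * (+ 1 + l) * X + + 24 * (+ 1 + l) * (+ 2 + l) * Y + + 4 * (+ 1 + l) * (+ 2 + l) * (+ 3 + l) * Z)

  -- 24 P (binom(l+1,2) X + 2 binom(l+2,3) Y + binom(l+3,4) Z)
  quart : ℤ → ℤ → ℤ → ℤ → ℤ → ℤ
  quart P l X Y Z = P * (+ 12 * (+ 1 + l) * l * X + + 8 * (+ 2 + l) * (+ 1 + l) * l * Y + (+ 3 + l) * (+ 2 + l) * (+ 1 + l) * l * Z)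

  tri-zero : ∀ l X Y → tri (+ 0) l X Y ≡ + 0
  tri-zero l X Y = *-zeroˡ (+ 12 * (+ 1 + l) * (+ 2 + l) * X + + 4 * (+ 1 + l) * (+ 2 + l) * (+ 3 + l) * Y)

  quart-zero : ∀ l X Y Z → quart (+ 0) l X Y Z ≡ + 0
  quart-zero l X Y Z = *-zeroˡ (+ 12 * (+ 1 + l) * l * X + + 8 * (+ 2 + l) * (+ 1 + l) * l * Y + (+ 3 + l) * (+ 2 + l) * (+ 1 + l) * l * Z)

  private
    tri-sum : ∀ P X Y l → sumAnti (λ c i → (+ 24 * (P + P * + c)) * (X + + suc i * Y)) l ≡ tri P (+ l) X Y
    tri-sum P X Y l = trans (sumAnti-24 P P X Y l) (lem P X Y (+ l))
      where lem : ∀ P X Y l → (+ 24 * P + + 12 * P * l) * (+ 1 + l) * X + (+ 12 * P + + 4 * P * l) * (+ 1 + l) * (+ 2 + l) * Y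
              ≡ P * (+ 12 * (+ 1 + l) * (+ 2 + l) * X + + 4 * (+ 1 + l) * (+ 2 + l) * (+ 3 + l) * Y)
            lem = solve-∀

  -- If back points are ignored, then y = 1, and all c + 1 entries of a finished cycle contribute
  -- the same power of 1+q. Its exponent depends only on i + c = l, so the sum over the cuts merely
  -- weighs two fixed binomial coefficients.
  source-every : ∀ n j l → source every n j l ≡ tri (bin n j) (+ l) (bin (suc (n ℕ.+ l)) (2 ℕ.+ (j ℕ.+ l))) (bin (suc (n ℕ.+ l)) (3 ℕ.+ (j ℕ.+ l)))
  source-every n j l = trans (sumAnti-cong l term) (tri-sum (bin n j) (bin (suc (n ℕ.+ l)) (2 ℕ.+ (j ℕ.+ l))) (bin (suc (n ℕ.+ l)) (3 ℕ.+ (j ℕ.+ l))) l)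
    where
    X Y : ℤ
    X = bin (suc (n ℕ.+ l)) (2 ℕ.+ (j ℕ.+ l))
    Y = bin (suc (n ℕ.+ l)) (3 ℕ.+ (j ℕ.+ l))
    merged : ∀ c i → K every c n j i ≡ (+ 24 * (+ 1 + + c)) * k n j (suc (i ℕ.+ c)) 0 (+ suc i)
    merged zero i rewrite k-pascal n j (i ℕ.+ 0) 0 (+ suc i) = lem (k n j (i ℕ.+ 0) 0 (+ suc i)) (k n j (i ℕ.+ 0) 1 (+ suc i))
      where lem : ∀ x y → + 24 * x + + 24 * y ≡ (+ 24 * (+ 1 + + 0)) * (x + y)
            lem = solve-∀
    merged (suc c) i rewrite +-suc i c | k-pascal n j (suc (i ℕ.+ c)) 0 (+ suc i) | k-pascal n j (i ℕ.+ c) 0 (+ suc i) | k-pascal n j (i ℕ.+ c) 1 (+ suc i)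
      = lem (+ c) (k n j (i ℕ.+ c) 0 (+ suc i)) (k n j (i ℕ.+ c) 1 (+ suc i)) (k n j (i ℕ.+ c) 2 (+ suc i))
      where lem : ∀ c x y z → (+ 1 + c) * (+ 24 * x + + 48 * y + + 24 * z) + (+ 24 * (x + y) + + 24 * (y + z)) ≡ (+ 24 * (+ 1 + (+ 1 + c))) * ((x + y) + (y + z))
            lem = solve-∀
    term : ∀ c i → i ℕ.+ c ≡ l → K every c n j i ≡ (+ 24 * (bin n j + bin n j * + c)) * (X + + suc i * Y)
    term c i refl rewrite merged c i | +-suc n (i ℕ.+ c) | +-suc j (i ℕ.+ c) = lem (bin n j) (+ c) (+ suc i) X Y
      where lem : ∀ p c i x y → (+ 24 * (+ 1 + c)) * (p * (x + i * y)) ≡ (+ 24 * (p + p * c)) * (x + i * y)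
            lem = solve-∀

  -- Merging at the bad entry creates a back point, so only the c good entries count, and neither
  -- bad entry of the new stack may be cut later. The term c = 0 therefore vanishes, which accounts
  -- for `suc l`.
  source-only0 : ∀ n j l → source (only 0) n j (suc l) ≡ tri (bin n j) (+ l) (bin (n ℕ.+ l) (1 ℕ.+ (j ℕ.+ l))) (bin (n ℕ.+ l) (2 ℕ.+ (j ℕ.+ l)))
  source-only0 n j l = trans (cong₂ _+_ (trans (sumAnti-cong l term) (tri-sum (bin n j) X Y l)) (lem₀ (k n j (suc l ℕ.+ 0) 0 (+ suc (suc l))) (k n j (suc l ℕ.+ 0) 1 (+ suc (suc l)))))
    (lem₁ (tri (bin n j) (+ l) X Y))
    where
    X Y : ℤ
    X = bin (n ℕ.+ l) (1 ℕ.+ (j ℕ.+ l))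
    Y = bin (n ℕ.+ l) (2 ℕ.+ (j ℕ.+ l))
    lem₀ : ∀ x y → + 0 * x + + 0 * y ≡ + 0
    lem₀ = solve-∀
    lem₁ : ∀ x → x + + 0 ≡ x
    lem₁ = solve-∀
    term : ∀ c i → i ℕ.+ c ≡ l → K (only 0) (suc c) n j i ≡ (+ 24 * (bin n j + bin n j * + c)) * (X + + suc i * Y)
    term c i refl = lem (bin n j) (+ c) (+ suc i) X Y (k n j (i ℕ.+ c) 1 (+ suc i)) (k n j (i ℕ.+ c) 2 (+ suc i)) (k n j (i ℕ.+ suc c) 0 (+ suc i)) (k n j (i ℕ.+ suc c) 1 (+ suc i))
      where lem : ∀ p c i x y a b d e → (+ 1 + c) * (+ 24 * (p * (x + i * y)) + + 0 * a + + 0 * b) + (+ 0 * d + + 0 * e) ≡ (+ 24 * (p + p * c)) * (x + i * y)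
            lem = solve-∀

  -- After a merge at a good entry both bad entries of the stack must be cut later; after a merge at
  -- the bad entry, the one that is left. `k-pascal` brings both cases to a common exponent; the cut
  -- with c = 0, where there is no good entry, is treated apart as `last`.
  source-only2-suc : ∀ n j l → source (only 2) n j (suc l) ≡ cub (bin n j) (+ suc l) (bin (n ℕ.+ l) (2 ℕ.+ (j ℕ.+ l))) (bin (n ℕ.+ l) (3 ℕ.+ (j ℕ.+ l))) (bin (n ℕ.+ l) (4 ℕ.+ (j ℕ.+ l)))
  source-only2-suc n j l = trans (cong₂ _+_ (trans (sumAnti-cong l term) (trans (sumAnti-+ f g l) (cong₂ _+_ (sumAnti-24 P (+ 0) X Y l) (sumAnti-24 (+ 2 * P) P Y Z l)))) last)
    (lem₁ P (+ l) X Y Z)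
    where
    P X Y Z : ℤ
    P = bin n j
    X = bin (n ℕ.+ l) (2 ℕ.+ (j ℕ.+ l))
    Y = bin (n ℕ.+ l) (3 ℕ.+ (j ℕ.+ l))
    Z = bin (n ℕ.+ l) (4 ℕ.+ (j ℕ.+ l))
    f g : ℕ → ℕ → ℤ
    f c i = (+ 24 * (P + + 0 * + c)) * (X + + suc i * Y)
    g c i = (+ 24 * (+ 2 * P + P * + c)) * (Y + + suc i * Z)
    lem₁ : ∀ P l X Y Z → (((+ 24 * P + + 12 * + 0 * l) * (+ 1 + l) * X + (+ 12 * P + + 4 * + 0 * l) * (+ 1 + l) * (+ 2 + l) * Y)
        + ((+ 24 * (+ 2 * P) + + 12 * P * l) * (+ 1 + l) * Y + (+ 12 * (+ 2 * P) + + 4 * P * l) * (+ 1 + l) * (+ 2 + l) * Z))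
        + + 24 * (P * ((X + Y) + (+ 2 + l) * (Y + Z)))
      ≡ P * (+ 24 * (+ 1 + (+ 1 + l)) * X + + 24 * (+ 1 + (+ 1 + l)) * (+ 2 + (+ 1 + l)) * Y + + 4 * (+ 1 + (+ 1 + l)) * (+ 2 + (+ 1 + l)) * (+ 3 + (+ 1 + l)) * Z)
    lem₁ = solve-∀
    last : K (only 2) 0 n j (suc l) ≡ + 24 * (P * ((X + Y) + (+ 2 + + l) * (Y + Z)))
    last rewrite +-identityʳ l | +-suc n l | +-suc j l = lem (k n j (suc l) 0 (+ suc (suc l))) _
      where lem : ∀ a b → + 0 * a + b ≡ b
            lem = solve-∀
    term : ∀ c i → i ℕ.+ c ≡ l → K (only 2) (suc c) n j i ≡ f c i + g c i
    term c i refl rewrite +-suc i c | k-pascal n j (i ℕ.+ c) 1 (+ suc i) =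
      lem P (+ c) (+ suc i) X Y Z (k n j (i ℕ.+ c) 0 (+ suc i)) (k n j (i ℕ.+ c) 1 (+ suc i)) (k n j (suc (i ℕ.+ c)) 0 (+ suc i))
      where lem : ∀ p c i x y z a b d → (+ 1 + c) * (+ 0 * a + + 0 * b + + 24 * (p * (y + i * z))) + (+ 0 * d + + 24 * (p * (x + i * y) + p * (y + i * z)))
              ≡ (+ 24 * (p + + 0 * c)) * (x + i * y) + (+ 24 * (+ 2 * p + p * c)) * (y + i * z)
            lem = solve-∀

  source-only2 : ∀ n j l → source (only 2) (suc n) j l ≡ cub (bin (suc n) j) (+ l) (bin (n ℕ.+ l) (1 ℕ.+ (j ℕ.+ l))) (bin (n ℕ.+ l) (2 ℕ.+ (j ℕ.+ l))) (bin (n ℕ.+ l) (3 ℕ.+ (j ℕ.+ l)))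
  source-only2 n j zero = lem (k (suc n) j 0 0 (+ 1)) (bin (suc n) j) (bin (n ℕ.+ 0) (1 ℕ.+ (j ℕ.+ 0))) (bin (n ℕ.+ 0) (2 ℕ.+ (j ℕ.+ 0))) (bin (n ℕ.+ 0) (3 ℕ.+ (j ℕ.+ 0)))
    where lem : ∀ a p x y z → + 0 * a + + 24 * (p * ((x + y) + + 1 * (y + z))) ≡ p * (+ 24 * + 1 * x + + 24 * + 1 * + 2 * y + + 4 * + 1 * + 2 * + 3 * z)
          lem = solve-∀
  source-only2 n j (suc l) = trans (source-only2-suc (suc n) j l) (cong₂ (λ N J → cub (bin (suc n) j) (+ suc l) (bin N (suc J)) (bin N (2 ℕ.+ J)) (bin N (3 ℕ.+ J))) (sym (+-suc n l)) (sym (+-suc j l)))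

  -- The corrections that separate the numbers of back points.

  prev-source : ∀ n j l → prev (λ j → source every n j l) j ≡ tri (prev (bin n) j) (+ l) (bin (suc (n ℕ.+ l)) (1 ℕ.+ (j ℕ.+ l))) (bin (suc (n ℕ.+ l)) (2 ℕ.+ (j ℕ.+ l)))
  prev-source n zero l = sym (tri-zero (+ l) (bin (suc (n ℕ.+ l)) (1 ℕ.+ l)) (bin (suc (n ℕ.+ l)) (2 ℕ.+ l)))
  prev-source n (suc j) l = source-every n j l

  -- The amount by which `V₀` exceeds sV (m = 1), or tV exceeds `V₂` (m = 2). It is zero at height
  -- one, which is why the final counts are exactly sP and tP.
  defect : ℕ → Array
  defect m zero j l = + 0
  defect m (suc n) j zero = + 0
  defect m (suc n) j (suc l) = quart (bin n j) (+ suc l) (bin (n ℕ.+ l) (m ℕ.+ (j ℕ.+ l))) (bin (n ℕ.+ l) (suc m ℕ.+ (j ℕ.+ l))) (bin (n ℕ.+ l) (suc (suc m) ℕ.+ (j ℕ.+ l)))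

  -- The factor l in `quart` makes one formula valid at all heights, and it moves all binomial
  -- coefficients to the row n + l used in the induction.
  defect-low : ∀ m n j l → defect (suc m) (suc (suc n)) j l ≡
    quart (bin (suc n) j) (+ l) (bin (n ℕ.+ l) (m ℕ.+ (j ℕ.+ l))) (bin (n ℕ.+ l) (suc m ℕ.+ (j ℕ.+ l))) (bin (n ℕ.+ l) (suc (suc m) ℕ.+ (j ℕ.+ l)))
  defect-low m n j zero = lem (bin (suc n) j) (bin (n ℕ.+ 0) (m ℕ.+ (j ℕ.+ 0))) (bin (n ℕ.+ 0) (suc m ℕ.+ (j ℕ.+ 0))) (bin (n ℕ.+ 0) (suc (suc m) ℕ.+ (j ℕ.+ 0)))
    where lem : ∀ p x y z → + 0 ≡ p * (+ 12 * (+ 1 + + 0) * + 0 * x + + 8 * (+ 2 + + 0) * (+ 1 + + 0) * + 0 * y + (+ 3 + + 0) * (+ 2 + + 0) * (+ 1 + + 0) * + 0 * z)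
          lem = solve-∀
  defect-low m n j (suc l) rewrite +-suc n l | +-suc j l | +-suc m (j ℕ.+ l) = refl

  prev-defect : ∀ m n j l → prev (λ j → defect (suc m) (suc n) j (suc l)) j ≡
    quart (prev (bin n) j) (+ suc l) (bin (n ℕ.+ l) (m ℕ.+ (j ℕ.+ l))) (bin (n ℕ.+ l) (suc m ℕ.+ (j ℕ.+ l))) (bin (n ℕ.+ l) (suc (suc m) ℕ.+ (j ℕ.+ l)))
  prev-defect m n zero l = sym (quart-zero (+ suc l) (bin (n ℕ.+ l) (m ℕ.+ l)) (bin (n ℕ.+ l) (suc m ℕ.+ l)) (bin (n ℕ.+ l) (suc (suc m) ℕ.+ l)))
  prev-defect m n (suc j) l rewrite +-suc m (j ℕ.+ l) = refl

  private
    infix 100 #_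
    #_ : ∀ {n} → ℕ → Polynomial n
    # n = con (+ n)

    triᵖ : ∀ {n} (P l X Y : Polynomial n) → Polynomial n
    triᵖ P l X Y = P :* (# 12 :* (# 1 :+ l) :* (# 2 :+ l) :* X :+ # 4 :* (# 1 :+ l) :* (# 2 :+ l) :* (# 3 :+ l) :* Y)

    cubᵖ : ∀ {n} (P l X Y Z : Polynomial n) → Polynomial n
    cubᵖ P l X Y Z = P :* (# 24 :* (# 1 :+ l) :* X :+ # 24 :* (# 1 :+ l) :* (# 2 :+ l) :* Y :+ # 4 :* (# 1 :+ l) :* (# 2 :+ l) :* (# 3 :+ l) :* Z)

    quartᵖ : ∀ {n} (P l X Y Z : Polynomial n) → Polynomial n
    quartᵖ P l X Y Z = P :* (# 12 :* (# 1 :+ l) :* l :* X :+ # 8 :* (# 2 :+ l) :* (# 1 :+ l) :* l :* Y :+ (# 3 :+ l) :* (# 2 :+ l) :* (# 1 :+ l) :* l :* Z)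

  -- 24 P (binom(l+1,2) X + binom(l+2,3) Y)
  tri₀ : ℤ → ℤ → ℤ → ℤ → ℤ
  tri₀ P l X Y = P * (+ 12 * (+ 1 + l) * l * X + + 4 * (+ 2 + l) * (+ 1 + l) * l * Y)

  private
    tri₀ᵖ : ∀ {n} (P l X Y : Polynomial n) → Polynomial n
    tri₀ᵖ P l X Y = P :* (# 12 :* (# 1 :+ l) :* l :* X :+ # 4 :* (# 2 :+ l) :* (# 1 :+ l) :* l :* Y)

    -- The difference of the equations `defect₁` at `suc l` and at l, after Pascal's rule: a, b, c,
    -- d are consecutive coefficients in row n + l, and P + Q is `bin (suc n) j`. No relation
    -- between the coefficients is used. `ring₂` does the same for `defect₂`.
    ring₁ : ∀ P Q l a b c d →
      tri Q (+ 1 + l) ((a + b) + (b + c)) ((b + c) + (c + d)) + quart (P + Q) (+ 1 + l) (a + b) (b + c) (c + d) - tri Q l (a + b) (b + c) - quart (P + Q) l a b c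
      ≡ quart Q (+ 2 + l) (a + b) (b + c) (c + d) + quart P (+ 1 + l) b c d + tri (P + Q) l (a + b) (b + c) - quart Q (+ 1 + l) a b c - tri₀ (P + Q) l a b
    ring₁ = solve 7 (λ P Q l a b c d →
      triᵖ Q (# 1 :+ l) ((a :+ b) :+ (b :+ c)) ((b :+ c) :+ (c :+ d)) :+ quartᵖ (P :+ Q) (# 1 :+ l) (a :+ b) (b :+ c) (c :+ d) :- triᵖ Q l (a :+ b) (b :+ c) :- quartᵖ (P :+ Q) l a b c
      := quartᵖ Q (# 2 :+ l) (a :+ b) (b :+ c) (c :+ d) :+ quartᵖ P (# 1 :+ l) b c d :+ triᵖ (P :+ Q) l (a :+ b) (b :+ c) :- quartᵖ Q (# 1 :+ l) a b c :- tri₀ᵖ (P :+ Q) l a b) refl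

    ring₂ : ∀ P Q l a b c d →
      tri P (+ 1 + l) ((a + b) + (b + c)) ((b + c) + (c + d)) + quart Q (+ 2 + l) (a + b) (b + c) (c + d) + quart P (+ 1 + l) b c d - tri P l (a + b) (b + c) - quart Q (+ 1 + l) a b c
      ≡ quart (P + Q) (+ 1 + l) (a + b) (b + c) (c + d) + cub (P + Q) (+ 1 + l) (a + b) (b + c) (c + d) - quart (P + Q) l a b c - cub (P + Q) l a b c
    ring₂ = solve 7 (λ P Q l a b c d →
      triᵖ P (# 1 :+ l) ((a :+ b) :+ (b :+ c)) ((b :+ c) :+ (c :+ d)) :+ quartᵖ Q (# 2 :+ l) (a :+ b) (b :+ c) (c :+ d) :+ quartᵖ P (# 1 :+ l) b c d :- triᵖ P l (a :+ b) (b :+ c) :- quartᵖ Q (# 1 :+ l) a b c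
      := quartᵖ (P :+ Q) (# 1 :+ l) (a :+ b) (b :+ c) (c :+ d) :+ cubᵖ (P :+ Q) (# 1 :+ l) (a :+ b) (b :+ c) (c :+ d) :- quartᵖ (P :+ Q) l a b c :- cubᵖ (P :+ Q) l a b c) refl

    ring₁-base : ∀ Q a b c → tri Q (+ 0) (a + b) (b + c) + + 0 ≡ (quart Q (+ 1) a b c + + 0) + + 0
    ring₁-base = solve 4 (λ Q a b c → triᵖ Q (# 0) (a :+ b) (b :+ c) :+ # 0 := (quartᵖ Q (# 1) a b c :+ # 0) :+ # 0) refl

    ring₂-base : ∀ P Q a b c → tri P (+ 0) (a + b) (b + c) + quart Q (+ 1) a b c + + 0 ≡ + 0 + cub (P + Q) (+ 0) a b c
    ring₂-base = solve 5 (λ P Q a b c → triᵖ P (# 0) (a :+ b) (b :+ c) :+ quartᵖ Q (# 1) a b c :+ # 0 := # 0 :+ cubᵖ (P :+ Q) (# 0) a b c) refl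

  source-only0-low : ∀ n j l → source (only 0) (suc n) j l ≡ tri₀ (bin (suc n) j) (+ l) (bin (n ℕ.+ l) (j ℕ.+ l)) (bin (n ℕ.+ l) (1 ℕ.+ (j ℕ.+ l)))
  source-only0-low n j zero = lem (k (suc n) j 0 0 (+ 1)) (k (suc n) j 0 1 (+ 1)) (bin (suc n) j) (bin (n ℕ.+ 0) (j ℕ.+ 0)) (bin (n ℕ.+ 0) (1 ℕ.+ (j ℕ.+ 0)))
    where lem : ∀ a b p x y → + 0 * a + + 0 * b ≡ p * (+ 12 * + 1 * + 0 * x + + 4 * + 2 * + 1 * + 0 * y)
          lem = solve-∀
  source-only0-low n j (suc l) = trans (source-only0 (suc n) j l) (trans (lem (bin (suc n) j) (+ l) (bin (suc (n ℕ.+ l)) (1 ℕ.+ (j ℕ.+ l))) (bin (suc (n ℕ.+ l)) (2 ℕ.+ (j ℕ.+ l))))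
      (cong₂ (λ N J → tri₀ (bin (suc n) j) (+ suc l) (bin N J) (bin N (suc J))) (sym (+-suc n l)) (sym (+-suc j l))))
    where lem : ∀ p l x y → p * (+ 12 * (+ 1 + l) * (+ 2 + l) * x + + 4 * (+ 1 + l) * (+ 2 + l) * (+ 3 + l) * y)
            ≡ p * (+ 12 * (+ 1 + (+ 1 + l)) * (+ 1 + l) * x + + 4 * (+ 2 + (+ 1 + l)) * (+ 1 + (+ 1 + l)) * (+ 1 + l) * y)
          lem = solve-∀

  -- Together with V-step, these identities say that V₀ = s V + defect 1 and V₂ = t V - defect 2 satisfy their recurrences.
  defect₁ : ∀ n j l → prev (λ j → source every n j l) j + defect 1 (2 ℕ.+ n) j l ≡
    prev (λ j → defect 1 (suc n) j (suc l)) j + sumTo (defect 1 (suc n) j) l + source (only 0) (suc n) j l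
  defect₁ n j zero = trans (cong (_+ + 0) (prev-source n j 0))
    (trans (ring₁-base (prev (bin n) j) (bin (n ℕ.+ 0) (j ℕ.+ 0)) (bin (n ℕ.+ 0) (1 ℕ.+ (j ℕ.+ 0))) (bin (n ℕ.+ 0) (2 ℕ.+ (j ℕ.+ 0))))
      (cong₂ (λ x y → (x + + 0) + y) (sym (prev-defect 0 n j 0)) (sym (lem (k (suc n) j 0 0 (+ 1)) (k (suc n) j 0 1 (+ 1))))))
    where lem : ∀ a b → + 0 * a + + 0 * b ≡ + 0
          lem = solve-∀
  defect₁ n j (suc l) = assemble (sumTo (defect 1 (suc n) j) l) (prev-source n j l)
      (trans (prev-source n j (suc l)) (cong₂ (λ N J → tri Q (+ suc l) (bin (suc N) (1 ℕ.+ J)) (bin (suc N) (2 ℕ.+ J))) (+-suc n l) (+-suc j l)))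
      (trans (defect-low 0 n j l) (cong (λ x → quart x (+ l) (b 0) (b 1) (b 2)) (prev-bin n j)))
      (cong (λ x → quart x (+ suc l) (bin (suc (n ℕ.+ l)) (1 ℕ.+ (j ℕ.+ l))) (bin (suc (n ℕ.+ l)) (2 ℕ.+ (j ℕ.+ l))) (bin (suc (n ℕ.+ l)) (3 ℕ.+ (j ℕ.+ l)))) (prev-bin n j))
      (prev-defect 0 n j l)
      refl
      (trans (prev-defect 0 n j (suc l)) (cong₂ (λ N J → quart Q (+ suc (suc l)) (bin N J) (bin N (1 ℕ.+ J)) (bin N (2 ℕ.+ J))) (+-suc n l) (+-suc j l)))
      (trans (source-only0-low n j l) (cong (λ x → tri₀ x (+ l) (b 0) (b 1)) (prev-bin n j)))
      (trans (source-only0 (suc n) j l) (cong (λ x → tri x (+ l) (bin (suc (n ℕ.+ l)) (1 ℕ.+ (j ℕ.+ l))) (bin (suc (n ℕ.+ l)) (2 ℕ.+ (j ℕ.+ l)))) (prev-bin n j)))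
      (ring₁ (bin n j) Q (+ l) (b 0) (b 1) (b 2) (b 3))
      (defect₁ n j l)
    where
    Q = prev (bin n) j
    b : ℕ → ℤ
    b i = bin (n ℕ.+ l) (i ℕ.+ (j ℕ.+ l))
    assemble : ∀ {p p' d d' q x q' o o' P P' D D' R X R' O O'} s → p ≡ P → p' ≡ P' → d ≡ D → d' ≡ D' → q ≡ R → x ≡ X → q' ≡ R' → o ≡ O → o' ≡ O' →
      P' + D' - P - D ≡ R' + X + O' - R - O → p + d ≡ q + s + o → p' + d' ≡ q' + (s + x) + o'
    assemble {p} {p'} {d} {d'} {q} {x} {q'} {o} {o'} s refl refl refl refl refl refl refl refl refl h₂ h₁ = trans (e₁ p p' d d') (trans (cong₂ _+_ h₂ h₁) (e₂ q s x q' o o'))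
      where e₁ : ∀ p p' d d' → p' + d' ≡ (p' + d' - p - d) + (p + d)
            e₁ = solve-∀
            e₂ : ∀ q s x q' o o' → (q' + x + o' - q - o) + (q + s + o) ≡ q' + (s + x) + o'
            e₂ = solve-∀

  defect₂ : ∀ n j l → source every n j l + prev (λ j → defect 2 (suc n) j (suc l)) j + sumTo (defect 2 (suc n) j) l ≡
    defect 2 (2 ℕ.+ n) j l + source (only 2) (suc n) j l
  defect₂ n j zero = trans (cong₂ (λ x y → x + y + + 0) (source-every n j 0) (prev-defect 1 n j 0))
    (trans (ring₂-base (bin n j) (prev (bin n) j) (bin (n ℕ.+ 0) (1 ℕ.+ (j ℕ.+ 0))) (bin (n ℕ.+ 0) (2 ℕ.+ (j ℕ.+ 0))) (bin (n ℕ.+ 0) (3 ℕ.+ (j ℕ.+ 0))))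
      (cong (λ y → + 0 + y) (sym (trans (source-only2 n j 0) (cong (λ x → cub x (+ 0) (bin (n ℕ.+ 0) (1 ℕ.+ (j ℕ.+ 0))) (bin (n ℕ.+ 0) (2 ℕ.+ (j ℕ.+ 0))) (bin (n ℕ.+ 0) (3 ℕ.+ (j ℕ.+ 0)))) (prev-bin n j))))))
  defect₂ n j (suc l) = assemble (sumTo (defect 2 (suc n) j) l) (source-every n j l)
      (trans (source-every n j (suc l)) (cong₂ (λ N J → tri (bin n j) (+ suc l) (bin (suc N) (2 ℕ.+ J)) (bin (suc N) (3 ℕ.+ J))) (+-suc n l) (+-suc j l)))
      (trans (defect-low 1 n j l) (cong (λ x → quart x (+ l) (b 0) (b 1) (b 2)) (prev-bin n j)))
      (cong (λ x → quart x (+ suc l) (bin (suc (n ℕ.+ l)) (2 ℕ.+ (j ℕ.+ l))) (bin (suc (n ℕ.+ l)) (3 ℕ.+ (j ℕ.+ l))) (bin (suc (n ℕ.+ l)) (4 ℕ.+ (j ℕ.+ l)))) (prev-bin n j))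
      (prev-defect 1 n j l)
      refl
      (trans (prev-defect 1 n j (suc l)) (cong₂ (λ N J → quart Q (+ suc (suc l)) (bin N (1 ℕ.+ J)) (bin N (2 ℕ.+ J)) (bin N (3 ℕ.+ J))) (+-suc n l) (+-suc j l)))
      (trans (source-only2 n j l) (cong (λ x → cub x (+ l) (b 0) (b 1) (b 2)) (prev-bin n j)))
      (trans (source-only2-suc (suc n) j l) (cong (λ x → cub x (+ suc l) (bin (suc (n ℕ.+ l)) (2 ℕ.+ (j ℕ.+ l))) (bin (suc (n ℕ.+ l)) (3 ℕ.+ (j ℕ.+ l))) (bin (suc (n ℕ.+ l)) (4 ℕ.+ (j ℕ.+ l)))) (prev-bin n j)))
      (ring₂ (bin n j) Q (+ l) (b 0) (b 1) (b 2) (b 3))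
      (defect₂ n j l)
    where
    Q = prev (bin n) j
    b : ℕ → ℤ
    b i = bin (n ℕ.+ l) (suc i ℕ.+ (j ℕ.+ l))
    assemble : ∀ {p p' d d' q x q' o o' P P' D D' R X R' O O'} s → p ≡ P → p' ≡ P' → d ≡ D → d' ≡ D' → q ≡ R → x ≡ X → q' ≡ R' → o ≡ O → o' ≡ O' →
      P' + R' + X - P - R ≡ D' + O' - D - O → p + q + s ≡ d + o → p' + q' + (s + x) ≡ d' + o'
    assemble {p} {p'} {d} {d'} {q} {x} {q'} {o} {o'} s refl refl refl refl refl refl refl refl refl h₂ h₁ = trans (e₁ p p' q q' s x) (trans (cong₂ _+_ h₂ h₁) (e₂ d d' o o'))
      where e₁ : ∀ p p' q q' s x → p' + q' + (s + x) ≡ (p' + q' + x - p - q) + (p + q + s)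
            e₁ = solve-∀
            e₂ : ∀ d d' o o' → (d' + o' - d - o) + (d + o) ≡ d' + o'
            e₂ = solve-∀

  -- The closed form of `V`.

  -- In `V`, l is the stack height itself, N the number of remaining steps, c the coefficient
  -- `bin N j`, and b₀, b₁, b₂ are three consecutive coefficients in row N + l - 2.
  poly : ℤ → ℤ → ℤ → ℤ → ℤ → ℤ → ℤ
  poly l N c b₀ b₁ b₂ = c * ((+ 2 * N * N + + 2 * (+ 4 * l - + 1) * N + + 12 * l * l - + 4 * l - + 4) * b₀
    + (+ 2 * l * N * N + (+ 7 * l * l + l - + 2) * N + (+ 8 * l * l * l + + 7 * l * l - + 9 * l - + 2)) * b₁
    + l * (l - + 1) * (l + + 2) * (N + l + + 2) * b₂)

  poly-zero : ∀ l N b₀ b₁ b₂ → poly l N (+ 0) b₀ b₁ b₂ ≡ + 0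
  poly-zero l N b₀ b₁ b₂ = *-zeroˡ ((+ 2 * N * N + + 2 * (+ 4 * l - + 1) * N + + 12 * l * l - + 4 * l - + 4) * b₀
    + (+ 2 * l * N * N + (+ 7 * l * l + l - + 2) * N + (+ 8 * l * l * l + + 7 * l * l - + 9 * l - + 2)) * b₁
    + l * (l - + 1) * (l + + 2) * (N + l + + 2) * b₂)

  private
    polyᵖ : ∀ {n} (l N c b₀ b₁ b₂ : Polynomial n) → Polynomial n
    polyᵖ l N c b₀ b₁ b₂ = c :* ((# 2 :* N :* N :+ # 2 :* (# 4 :* l :- # 1) :* N :+ # 12 :* l :* l :- # 4 :* l :- # 4) :* b₀
      :+ (# 2 :* l :* N :* N :+ (# 7 :* l :* l :+ l :- # 2) :* N :+ (# 8 :* l :* l :* l :+ # 7 :* l :* l :- # 9 :* l :- # 2)) :* b₁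
      :+ l :* (l :- # 1) :* (l :+ # 2) :* (N :+ l :+ # 2) :* b₂)

    m1 : ℤ → ℤ → ℤ → ℤ → ℤ → ℤ
    m1 l N J P Q = (- + 3 * N * N * Q + + 3 * N * J * P + + 6 * N * J * Q - + 11 * N * Q - + 3 * J * J * P - + 3 * J * J * Q + + 8 * J * P + + 11 * J * Q - + 8 * P - + 16 * Q)

    m1ᵖ : ∀ {n} (l N J P Q : Polynomial n) → Polynomial n
    m1ᵖ l N J P Q = (:- # 3 :* N :* N :* Q :+ # 3 :* N :* J :* P :+ # 6 :* N :* J :* Q :- # 11 :* N :* Q :- # 3 :* J :* J :* P :- # 3 :* J :* J :* Q :+ # 8 :* J :* P :+ # 11 :* J :* Q :- # 8 :* P :- # 16 :* Q)

    m2 : ℤ → ℤ → ℤ → ℤ → ℤ → ℤ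
    m2 l N J P Q = (- + 3 * (+ 1 + l) * N * Q + + 3 * (+ 1 + l) * J * P + + 3 * (+ 1 + l) * J * Q - + 14 * (+ 1 + l) * P - + 17 * (+ 1 + l) * Q - + 3 * N * N * Q + + 3 * N * J * P + + 9 * N * J * Q - + 2 * N * P - + 15 * N * Q - + 6 * J * J * P - + 6 * J * J * Q + + 10 * J * P + + 16 * J * Q - + 20 * P - + 30 * Q)

    m2ᵖ : ∀ {n} (l N J P Q : Polynomial n) → Polynomial n
    m2ᵖ l N J P Q = (:- # 3 :* (# 1 :+ l) :* N :* Q :+ # 3 :* (# 1 :+ l) :* J :* P :+ # 3 :* (# 1 :+ l) :* J :* Q :- # 14 :* (# 1 :+ l) :* P :- # 17 :* (# 1 :+ l) :* Q :- # 3 :* N :* N :* Q :+ # 3 :* N :* J :* P :+ # 9 :* N :* J :* Q :- # 2 :* N :* P :- # 15 :* N :* Q :- # 6 :* J :* J :* P :- # 6 :* J :* J :* Q :+ # 10 :* J :* P :+ # 16 :* J :* Q :- # 20 :* P :- # 30 :* Q)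

    m3 : ℤ → ℤ → ℤ → ℤ → ℤ → ℤ
    m3 l N J P Q = (- + 3 * (+ 1 + l) * (+ 1 + l) * P - + 3 * (+ 1 + l) * (+ 1 + l) * Q - + 3 * (+ 1 + l) * N * Q + + 3 * (+ 1 + l) * J * P + + 3 * (+ 1 + l) * J * Q - + 11 * (+ 1 + l) * P - + 14 * (+ 1 + l) * Q + + 3 * N * J * Q - + 2 * N * Q - + 3 * J * J * P - + 3 * J * J * Q + + 2 * J * P + + 5 * J * Q - + 8 * P - + 10 * Q)

    m3ᵖ : ∀ {n} (l N J P Q : Polynomial n) → Polynomial n
    m3ᵖ l N J P Q = (:- # 3 :* (# 1 :+ l) :* (# 1 :+ l) :* P :- # 3 :* (# 1 :+ l) :* (# 1 :+ l) :* Q :- # 3 :* (# 1 :+ l) :* N :* Q :+ # 3 :* (# 1 :+ l) :* J :* P :+ # 3 :* (# 1 :+ l) :* J :* Q :- # 11 :* (# 1 :+ l) :* P :- # 14 :* (# 1 :+ l) :* Q :+ # 3 :* N :* J :* Q :- # 2 :* N :* Q :- # 3 :* J :* J :* P :- # 3 :* J :* J :* Q :+ # 2 :* J :* P :+ # 5 :* J :* Q :- # 8 :* P :- # 10 :* Q)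

    m4 : ℤ → ℤ → ℤ → ℤ → ℤ → ℤ → ℤ
    m4 N J e0 e1 e2 e3 = (+ 3 * N * N * e0 + + 3 * N * N * e1 - + 6 * N * J * e0 - + 12 * N * J * e1 - + 6 * N * J * e2 + + 5 * N * e0 + + 3 * N * e1 - + 2 * N * e2 + + 3 * J * J * e0 + + 9 * J * J * e1 + + 9 * J * J * e2 + + 3 * J * J * e3 - + 5 * J * e0 - + 3 * J * e1 + + 9 * J * e2 + + 7 * J * e3 + + 2 * e2 + + 2 * e3)

    m4ᵖ : ∀ {n} (N J e0 e1 e2 e3 : Polynomial n) → Polynomial n
    m4ᵖ N J e0 e1 e2 e3 = (# 3 :* N :* N :* e0 :+ # 3 :* N :* N :* e1 :- # 6 :* N :* J :* e0 :- # 12 :* N :* J :* e1 :- # 6 :* N :* J :* e2 :+ # 5 :* N :* e0 :+ # 3 :* N :* e1 :- # 2 :* N :* e2 :+ # 3 :* J :* J :* e0 :+ # 9 :* J :* J :* e1 :+ # 9 :* J :* J :* e2 :+ # 3 :* J :* J :* e3 :- # 5 :* J :* e0 :- # 3 :* J :* e1 :+ # 9 :* J :* e2 :+ # 7 :* J :* e3 :+ # 2 :* e2 :+ # 2 :* e3)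

    -- The multipliers express the identity as a combination of the absorption identities for the binomial coefficients involved.
    ring : ∀ l N J P Q e0 e1 e2 e3 →
      poly (+ 2 + l) (+ 1 + N) (P + Q) (e0 + e1) (e1 + e2) (e2 + e3)
      ≡ (poly (+ 1 + l) (+ 1 + N) (P + Q) e0 e1 e2
        + (tri P (+ 1 + l) ((e0 + e1) + (e1 + e2)) ((e1 + e2) + (e2 + e3)) - tri P l (e0 + e1) (e1 + e2))
        + poly (+ 2 + l) N P e1 e2 e3 + poly (+ 3 + l) N Q (e0 + e1) (e1 + e2) (e2 + e3) - poly (+ 2 + l) N Q e0 e1 e2)
        + ((+ 1 + (+ 1 + (J + l))) * e1 - ((N + l) - (+ 1 + (J + l))) * e0) * m1 l N J P Q
        + ((+ 1 + (+ 2 + (J + l))) * e2 - ((N + l) - (+ 2 + (J + l))) * e1) * m2 l N J P Q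
        + ((+ 1 + (+ 3 + (J + l))) * e3 - ((N + l) - (+ 3 + (J + l))) * e2) * m3 l N J P Q
        + (J * P - (N - J + + 1) * Q) * m4 N J e0 e1 e2 e3
    ring = solve 9 (λ l N J P Q e0 e1 e2 e3 →
      polyᵖ (# 2 :+ l) (# 1 :+ N) (P :+ Q) (e0 :+ e1) (e1 :+ e2) (e2 :+ e3)
      := (polyᵖ (# 1 :+ l) (# 1 :+ N) (P :+ Q) e0 e1 e2
        :+ (triᵖ P (# 1 :+ l) ((e0 :+ e1) :+ (e1 :+ e2)) ((e1 :+ e2) :+ (e2 :+ e3)) :- triᵖ P l (e0 :+ e1) (e1 :+ e2))
        :+ polyᵖ (# 2 :+ l) N P e1 e2 e3 :+ polyᵖ (# 3 :+ l) N Q (e0 :+ e1) (e1 :+ e2) (e2 :+ e3) :- polyᵖ (# 2 :+ l) N Q e0 e1 e2)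
        :+ ((# 1 :+ (# 1 :+ (J :+ l))) :* e1 :- ((N :+ l) :- (# 1 :+ (J :+ l))) :* e0) :* m1ᵖ l N J P Q
        :+ ((# 1 :+ (# 2 :+ (J :+ l))) :* e2 :- ((N :+ l) :- (# 2 :+ (J :+ l))) :* e1) :* m2ᵖ l N J P Q
        :+ ((# 1 :+ (# 3 :+ (J :+ l))) :* e3 :- ((N :+ l) :- (# 3 :+ (J :+ l))) :* e2) :* m3ᵖ l N J P Q
        :+ (J :* P :- (N :- J :+ # 1) :* Q) :* m4ᵖ N J e0 e1 e2 e3) refl

    ring-base : ∀ N J P Q a b c →
      + 2 * (+ 2 + N) * (+ 3 + N) * (a + b) * (P + Q) ≡
        (poly (+ 2) N Q a b c + + 2 * (+ 1 + N) * (+ 2 + N) * b * P + tri P (+ 0) (a + b) (b + c))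
        + ((+ 1 + (+ 1 + J)) * b - (N - (+ 1 + J)) * a) * (- + 2 * N * P - + 2 * J * P - + 2 * J * Q - + 12 * P - + 10 * Q)
        + ((+ 1 + (+ 2 + J)) * c - (N - (+ 2 + J)) * b) * (+ 2 * N * Q - + 2 * J * P - + 2 * J * Q - + 8 * P - + 6 * Q)
        + (J * P - (N - J + + 1) * Q) * (+ 2 * J * a + + 4 * J * b + + 2 * J * c + + 14 * a + + 28 * b + + 14 * c)
    ring-base = solve 7 (λ N J P Q a b c → # 2 :* (# 2 :+ N) :* (# 3 :+ N) :* (a :+ b) :* (P :+ Q) := (polyᵖ (# 2) N Q a b c :+ # 2 :* (# 1 :+ N) :* (# 2 :+ N) :* b :* P :+ triᵖ P (# 0) (a :+ b) (b :+ c))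
        :+ ((# 1 :+ (# 1 :+ J)) :* b :- (N :- (# 1 :+ J)) :* a) :* (:- # 2 :* N :* P :- # 2 :* J :* P :- # 2 :* J :* Q :- # 12 :* P :- # 10 :* Q)
        :+ ((# 1 :+ (# 2 :+ J)) :* c :- (N :- (# 2 :+ J)) :* b) :* (# 2 :* N :* Q :- # 2 :* J :* P :- # 2 :* J :* Q :- # 8 :* P :- # 6 :* Q)
        :+ (J :* P :- (N :- J :+ # 1) :* Q) :* (# 2 :* J :* a :+ # 4 :* J :* b :+ # 2 :* J :* c :+ # 14 :* a :+ # 28 :* b :+ # 14 :* c)) refl

    -- At height one the factor l - 1 removes b₂, and the other two coefficients coincide. Pascal's
    -- rule then joins b₀ and b₁, and `V` becomes a product.
    ring-low : ∀ N C a b c → + 2 * (+ 2 + N) * (+ 3 + N) * (a + b) * C ≡ poly (+ 1) (+ 1 + N) C a b c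
    ring-low = solve 5 (λ N C a b c → # 2 :* (# 2 :+ N) :* (# 3 :+ N) :* (a :+ b) :* C := polyᵖ (# 1) (# 1 :+ N) C a b c) refl

    drop : ∀ {y x u v} m → y ≡ x + (u - v) * m → u ≡ v → y ≡ x
    drop {y} {x} {u} m h refl = trans h (lem x u m)
      where lem : ∀ x u m → x + (u - u) * m ≡ x
            lem = solve-∀

  -- 24 times the number of ways to complete a genus 0 permutation using only cycles not yet finished.
  V : Array
  V n j zero = + 2 * (+ 1 + + n) * (+ 2 + + n) * bin n (2 ℕ.+ j) * bin n j
  V n j (suc l) = poly (+ 2 + + l) (+ n) (bin n j) (bin (n ℕ.+ l) (2 ℕ.+ (j ℕ.+ l))) (bin (n ℕ.+ l) (3 ℕ.+ (j ℕ.+ l))) (bin (n ℕ.+ l) (4 ℕ.+ (j ℕ.+ l)))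

  -- With at least one step left, `poly` also covers height one. With none left the row N + l - 2
  -- would be -1 there, hence the separate clause of `V`.
  V-low : ∀ n j l → V (suc n) j l ≡ poly (+ 1 + + l) (+ suc n) (bin (suc n) j) (bin (n ℕ.+ l) (1 ℕ.+ (j ℕ.+ l))) (bin (n ℕ.+ l) (2 ℕ.+ (j ℕ.+ l))) (bin (n ℕ.+ l) (3 ℕ.+ (j ℕ.+ l)))
  V-low n j zero = trans (ring-low (+ n) (bin (suc n) j) (bin n (1 ℕ.+ j)) (bin n (2 ℕ.+ j)) (bin n (3 ℕ.+ j)))
    (cong₂ (λ N J → poly (+ 1) (+ suc n) (bin (suc n) j) (bin N (1 ℕ.+ J)) (bin N (2 ℕ.+ J)) (bin N (3 ℕ.+ J))) (sym (+-identityʳ n)) (sym (+-identityʳ j)))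
  V-low n j (suc l) = cong₂ (λ N J → poly (+ 2 + + l) (+ suc n) (bin (suc n) j) (bin N (1 ℕ.+ J)) (bin N (2 ℕ.+ J)) (bin N (3 ℕ.+ J))) (sym (+-suc n l)) (sym (+-suc j l))

  prev-V : ∀ n j l → prev (λ j → V n j (suc l)) j ≡ poly (+ 2 + + l) (+ n) (prev (bin n) j) (bin (n ℕ.+ l) (1 ℕ.+ (j ℕ.+ l))) (bin (n ℕ.+ l) (2 ℕ.+ (j ℕ.+ l))) (bin (n ℕ.+ l) (3 ℕ.+ (j ℕ.+ l)))
  prev-V n zero l = sym (poly-zero (+ 2 + + l) (+ n) (bin (n ℕ.+ l) (1 ℕ.+ l)) (bin (n ℕ.+ l) (2 ℕ.+ l)) (bin (n ℕ.+ l) (3 ℕ.+ l)))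
  prev-V n (suc j) l = refl

  -- In contrast to the identities for `defect`, the difference between neighbouring heights is not
  -- formal: it holds only modulo absorption identities, and `drop` discards their multiples one by
  -- one.
  V-step : Step V (source every)
  V-step n j zero = trans (cong (λ x → + 2 * (+ 2 + + n) * (+ 3 + + n) * (bin n (1 ℕ.+ j) + bin n (2 ℕ.+ j)) * x) (prev-bin n j))
    (trans (drop _ (drop _ (drop _ (ring-base (+ n) (+ j) (bin n j) Q (bin n (1 ℕ.+ j)) (bin n (2 ℕ.+ j)) (bin n (3 ℕ.+ j))) (absorb-prev n j)) (absorb n (2 ℕ.+ j))) (absorb n (1 ℕ.+ j)))
      (cong₂ (λ x y → x + V n j 0 + y)
        (trans (cong₂ (λ N J → poly (+ 2) (+ n) Q (bin N (1 ℕ.+ J)) (bin N (2 ℕ.+ J)) (bin N (3 ℕ.+ J))) (sym (+-identityʳ n)) (sym (+-identityʳ j))) (sym (prev-V n j 0)))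
        (trans (cong₂ (λ N J → tri (bin n j) (+ 0) (bin (suc N) (2 ℕ.+ J)) (bin (suc N) (3 ℕ.+ J))) (sym (+-identityʳ n)) (sym (+-identityʳ j))) (sym (source-every n j 0)))))
    where Q = prev (bin n) j
  V-step n j (suc l) = assemble (sumTo (V n j) l)
      (trans (V-low n j l) (cong (λ x → poly (+ 1 + + l) (+ suc n) x (e 0) (e 1) (e 2)) (prev-bin n j)))
      (cong (λ x → poly (+ 2 + + l) (+ suc n) x (e 0 + e 1) (e 1 + e 2) (e 2 + e 3)) (prev-bin n j))
      (prev-V n j l)
      (trans (prev-V n j (suc l)) (cong₂ (λ N J → poly (+ 3 + + l) (+ n) Q (bin N (1 ℕ.+ J)) (bin N (2 ℕ.+ J)) (bin N (3 ℕ.+ J))) (+-suc n l) (+-suc j l)))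
      refl
      (source-every n j l)
      (trans (source-every n j (suc l)) (cong₂ (λ N J → tri (bin n j) (+ suc l) (bin (suc N) (2 ℕ.+ J)) (bin (suc N) (3 ℕ.+ J))) (+-suc n l) (+-suc j l)))
      (V-step n j l)
      (drop (m1 (+ l) (+ n) (+ j) (bin n j) Q) (drop (m2 (+ l) (+ n) (+ j) (bin n j) Q) (drop (m3 (+ l) (+ n) (+ j) (bin n j) Q) (drop (m4 (+ n) (+ j) (e 0) (e 1) (e 2) (e 3))
        (ring (+ l) (+ n) (+ j) (bin n j) Q (e 0) (e 1) (e 2) (e 3))
        (absorb-prev n j)) (absorb (n ℕ.+ l) (3 ℕ.+ (j ℕ.+ l)))) (absorb (n ℕ.+ l) (2 ℕ.+ (j ℕ.+ l)))) (absorb (n ℕ.+ l) (1 ℕ.+ (j ℕ.+ l))))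
    where
    Q = prev (bin n) j
    e : ℕ → ℤ
    e i = bin (n ℕ.+ l) (suc i ℕ.+ (j ℕ.+ l))
    assemble : ∀ {v v' p p' x o o' U U' P P' X O O'} s → v ≡ U → v' ≡ U' → p ≡ P → p' ≡ P' → x ≡ X → o ≡ O → o' ≡ O' →
      v ≡ p + s + o → U' ≡ U + (O' - O) + X + P' - P → v' ≡ p' + (s + x) + o'
    assemble {p = p} {p'} {x} {o} {o'} s refl refl refl refl refl refl refl refl h = trans h (lem p p' s x o o')
      where lem : ∀ p p' s x o o' → (p + s + o) + (o' - o) + x + p' - p ≡ p' + (s + x) + o'
            lem = solve-∀

  sumTo-zero : ∀ {f} l → (∀ i → f i ≡ + 0) → sumTo f l ≡ + 0
  sumTo-zero zero h = h 0
  sumTo-zero (suc l) h = cong₂ _+_ (sumTo-zero l h) (h (suc l))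

  prev-zero : ∀ {f} j → (∀ i → f i ≡ + 0) → prev f j ≡ + 0
  prev-zero zero h = refl
  prev-zero (suc j) h = h j

  source-zero : ∀ W j l → source W 0 j l ≡ + 0
  source-zero W j l = go (λ c i → K W c 0 j i) l (λ c i → Weighted.K-zero W c j i)
    where go : ∀ f l → (∀ c i → f c i ≡ + 0) → sumAnti f l ≡ + 0
          go f zero h = h 0 0
          go f (suc l) h = cong₂ _+_ (go (λ c → f (suc c)) l (λ c → h (suc c))) (h 0 (suc l))

  V-zero : ∀ j l → V 0 j l ≡ + 0
  V-zero j zero = lem (bin 0 j)
    where lem : ∀ x → + 2 * + 1 * + 2 * + 0 * x ≡ + 0
          lem = solve-∀
  V-zero zero (suc l) = trans (cong₂ (λ x y → poly (+ 2 + + l) (+ 0) (+ 1) x y (bin l (4 ℕ.+ l))) (bin-zero l 1) (bin-zero l 2))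
    (trans (cong (poly (+ 2 + + l) (+ 0) (+ 1) (+ 0) (+ 0)) (bin-zero l 3)) (lem (+ l)))
    where lem : ∀ l → + 1 * ((+ 2 * + 0 * + 0 + + 2 * (+ 4 * (+ 2 + l) - + 1) * + 0 + + 12 * (+ 2 + l) * (+ 2 + l) - + 4 * (+ 2 + l) - + 4) * + 0
            + (+ 2 * (+ 2 + l) * + 0 * + 0 + (+ 7 * (+ 2 + l) * (+ 2 + l) + (+ 2 + l) - + 2) * + 0 + (+ 8 * (+ 2 + l) * (+ 2 + l) * (+ 2 + l) + + 7 * (+ 2 + l) * (+ 2 + l) - + 9 * (+ 2 + l) - + 2)) * + 0
            + (+ 2 + l) * ((+ 2 + l) - + 1) * ((+ 2 + l) + + 2) * (+ 0 + (+ 2 + l) + + 2) * + 0) ≡ + 0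
          lem = solve-∀
  V-zero (suc j) (suc l) = poly-zero (+ 2 + + l) (+ 0) (bin l (3 ℕ.+ (j ℕ.+ l))) (bin l (4 ℕ.+ (j ℕ.+ l))) (bin l (5 ℕ.+ (j ℕ.+ l)))

  -- The factors s and t each use up one step, so `V` enters with one step less, and under s also
  -- with one push less. `V₁` is the remainder, as a permutation of genus 1 has at most two back
  -- points.
  V₀ V₁ V₂ : Array
  V₀ zero j l = + 0
  V₀ (suc n) j l = prev (λ j → V n j l) j + defect 1 (suc n) j l
  V₂ zero j l = + 0
  V₂ (suc n) j l = V n j l - defect 2 (suc n) j l
  V₁ n j l = V n j l + - + 1 * (V₀ n j l + V₂ n j l)

  defect-one : ∀ m j l → defect (suc m) 1 j l ≡ + 0
  defect-one m j zero = refl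
  defect-one m zero (suc l) = trans (cong₂ (λ x y → quart (+ 1) (+ suc l) x y (bin l (3 ℕ.+ (m ℕ.+ l)))) (bin-zero l m) (bin-zero l (suc m)))
    (trans (cong (quart (+ 1) (+ suc l) (+ 0) (+ 0)) (bin-zero l (2 ℕ.+ m))) (lem (+ suc l)))
    where lem : ∀ l → + 1 * (+ 12 * (+ 1 + l) * l * + 0 + + 8 * (+ 2 + l) * (+ 1 + l) * l * + 0 + (+ 3 + l) * (+ 2 + l) * (+ 1 + l) * l * + 0) ≡ + 0
          lem = solve-∀
  defect-one m (suc j) (suc l) = quart-zero (+ suc l) (bin l (suc m ℕ.+ (suc j ℕ.+ l))) (bin l (2 ℕ.+ m ℕ.+ (suc j ℕ.+ l))) (bin l (3 ℕ.+ m ℕ.+ (suc j ℕ.+ l)))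

  V₀-step : Step V₀ (source (only 0))
  V₀-step zero j l = trans (cong₂ _+_ (prev-zero j (λ i → V-zero i l)) (defect-one 0 j l))
    (sym (cong₂ _+_ (cong₂ _+_ (prev-zero j (λ _ → refl)) (sumTo-zero l (λ _ → refl))) (source-zero (only 0) j l)))
  V₀-step (suc n) j l = trans (lem j) (cong (λ y → prev (λ j → V₀ (suc n) j (suc l)) j + y + source (only 0) (suc n) j l) (sym (sumTo-+ (λ l → prev (λ j → V n j l) j) (defect 1 (suc n) j) l)))
    where
    sol : ∀ a b c p d q s x → a ≡ b + c + p → p + d ≡ q + s + x → a + d ≡ (b + q) + (c + s) + x
    sol a b c p d q s x refl h = trans (e₁ b c p d) (trans (cong (λ y → (b + c) + y) h) (e₂ b c q s x))
      where e₁ : ∀ b c p d → b + c + p + d ≡ (b + c) + (p + d)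
            e₁ = solve-∀
            e₂ : ∀ b c q s x → (b + c) + (q + s + x) ≡ (b + q) + (c + s) + x
            e₂ = solve-∀
    lem : ∀ j → V₀ (suc (suc n)) j l ≡ prev (λ j → V₀ (suc n) j (suc l)) j + (sumTo (λ l → prev (λ j → V n j l) j) l + sumTo (defect 1 (suc n) j) l) + source (only 0) (suc n) j l
    lem zero = trans (sol (+ 0) (+ 0) (sumTo (λ l → + 0) l) (+ 0) (defect 1 (suc (suc n)) 0 l) (+ 0) (sumTo (defect 1 (suc n) 0) l) (source (only 0) (suc n) 0 l) (cong (λ x → + 0 + x + + 0) (sym (sumTo-zero l (λ _ → refl)))) (defect₁ n 0 l)) refl
    lem (suc j) = sol (V (suc n) j l) (prev (λ j → V n j (suc l)) j) (sumTo (V n j) l) (source every n j l) (defect 1 (suc (suc n)) (suc j) l) (defect 1 (suc n) j (suc l)) (sumTo (defect 1 (suc n) (suc j)) l) (source (only 0) (suc n) (suc j) l)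
       (V-step n j l) (defect₁ n (suc j) l)

  V₂-step : Step V₂ (source (only 2))
  V₂-step zero j l = trans (cong₂ _-_ (V-zero j l) (defect-one 1 j l))
    (sym (cong₂ _+_ (cong₂ _+_ (prev-zero j (λ _ → refl)) (sumTo-zero l (λ _ → refl))) (source-zero (only 2) j l)))
  V₂-step (suc n) j l = trans (sol (V (suc n) j l) (prev (λ j → V n j (suc l)) j) (sumTo (V n j) l) (source every n j l) (prev (λ j → defect 2 (suc n) j (suc l)) j) (sumTo (defect 2 (suc n) j) l) (defect 2 (suc (suc n)) j l) (source (only 2) (suc n) j l) (V-step n j l) (defect₂ n j l))
      (cong₂ (λ x y → x + y + source (only 2) (suc n) j l) (prev-minus j) (sumTo-minus l))
    where
    sol : ∀ a b c p q s d x → a ≡ b + c + p → p + q + s ≡ d + x → a - d ≡ (b - q) + (c - s) + x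
    sol a b c p q s d x refl h = trans (e₁ b c p q s d) (trans (cong (λ y → y + (b + c) - q - s - d) h) (e₂ b c q s d x))
      where e₁ : ∀ b c p q s d → b + c + p - d ≡ (p + q + s) + (b + c) - q - s - d
            e₁ = solve-∀
            e₂ : ∀ b c q s d x → (d + x) + (b + c) - q - s - d ≡ (b - q) + (c - s) + x
            e₂ = solve-∀
    prev-minus : ∀ i → prev (λ j → V n j (suc l)) i - prev (λ j → defect 2 (suc n) j (suc l)) i ≡ prev (λ j → V₂ (suc n) j (suc l)) i
    prev-minus zero = refl
    prev-minus (suc i) = refl
    sumTo-minus : ∀ l → sumTo (V n j) l - sumTo (defect 2 (suc n) j) l ≡ sumTo (V₂ (suc n) j) l
    sumTo-minus zero = refl
    sumTo-minus (suc l) = trans (lem (sumTo (V n j) l) (V n j (suc l)) (sumTo (defect 2 (suc n) j) l) (defect 2 (suc n) j (suc l))) (cong (_+ (V n j (suc l) - defect 2 (suc n) j (suc l))) (sumTo-minus l))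
      where lem : ∀ a b c d → (a + b) - (c + d) ≡ (a - c) + (b - d)
            lem = solve-∀

  -- `K` evaluates its weight only at 0, 1 and 2, where `every` is the sum of `only 0`, `only 1` and
  -- `only 2`; the rest is linearity.
  V₁-step : Step V₁ (source (only 1))
  V₁-step n j l = trans (step-+ V-step (step-* (- + 1) (step-+ V₀-step V₂-step)) n j l) (cong (λ x → prev (λ j → V₁ n j (suc l)) j + sumTo (V₁ n j) l + x) weights)
    where
    K-weights : ∀ c i → K every c n j i ≡ K (only 0) c n j i + (K (only 1) c n j i + K (only 2) c n j i)
    K-weights zero i = lem (k n j (i ℕ.+ 0) 0 (+ suc i)) (k n j (i ℕ.+ 0) 1 (+ suc i))
      where lem : ∀ x y → + 24 * x + + 24 * y ≡ (+ 0 * x + + 0 * y) + ((+ 24 * x + + 0 * y) + (+ 0 * x + + 24 * y))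
            lem = solve-∀
    K-weights (suc c) i = lem (+ suc c) (k n j (i ℕ.+ c) 0 (+ suc i)) (k n j (i ℕ.+ c) 1 (+ suc i)) (k n j (i ℕ.+ c) 2 (+ suc i)) (k n j (i ℕ.+ suc c) 0 (+ suc i)) (k n j (i ℕ.+ suc c) 1 (+ suc i))
      where lem : ∀ c x y z u v → c * (+ 24 * x + + 48 * y + + 24 * z) + (+ 24 * u + + 24 * v) ≡
              (c * (+ 24 * x + + 0 * y + + 0 * z) + (+ 0 * u + + 0 * v)) + ((c * (+ 0 * x + + 48 * y + + 0 * z) + (+ 24 * u + + 0 * v)) + (c * (+ 0 * x + + 0 * y + + 24 * z) + (+ 0 * u + + 24 * v)))
            lem = solve-∀
    weights : source every n j l + - + 1 * (source (only 0) n j l + source (only 2) n j l) ≡ source (only 1) n j l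
    weights = trans (cong (_+ - + 1 * (source (only 0) n j l + source (only 2) n j l))
        (trans (sumAnti-cong l (λ c i _ → K-weights c i)) (trans (sumAnti-+ (λ c i → K (only 0) c n j i) (λ c i → K (only 1) c n j i + K (only 2) c n j i) l)
          (cong (λ y → source (only 0) n j l + y) (sumAnti-+ (λ c i → K (only 1) c n j i) (λ c i → K (only 2) c n j i) l)))))
      (lem (source (only 0) n j l) (source (only 1) n j l) (source (only 2) n j l))
      where lem : ∀ a b c → a + (b + c) + - + 1 * (a + c) ≡ b
            lem = solve-∀

  V₁-zero : ∀ j l → V₁ 0 j l ≡ + 0
  V₁-zero j l = cong (_+ + 0) (V-zero j l)

-- Partitions of the entries into lists, and paths of a function along a list.

module Lists where
  open import Data.Bool using (Bool; true; false; if_then_else_)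
  open import Data.Nat as ℕ using (ℕ; zero; suc; _≤_; _<_; _≟_; _≡ᵇ_)
  open import Data.Nat.Properties as ℕₚ using ()
  open import Data.Integer using (ℤ; +_; _+_)
  open import Data.Integer.Properties using (+-injective; +-assoc; +-identityˡ)
  open import Data.List using (List; []; _∷_; _++_)
  open import Data.List.Relation.Unary.All using (All; []; _∷_)
  open import Data.Product using (_×_; _,_; proj₁; proj₂)
  open import Data.Unit using (⊤; tt)
  open import Data.Empty using (⊥; ⊥-elim)
  open import Relation.Nullary using (yes; no)
  open import Relation.Binary.PropositionalEquality

  sumL : (ℕ → ℤ) → List ℕ → ℤ
  sumL g [] = + 0
  sumL g (x ∷ xs) = g x + sumL g xs

  sumLL : (ℕ → ℤ) → List (List ℕ) → ℤ
  sumLL g [] = + 0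
  sumLL g (c ∷ cs) = sumL g c + sumLL g cs

  sumN : (ℕ → ℤ) → ℕ → ℤ
  sumN g zero = + 0
  sumN g (suc n) = sumN g n + g n

  sumL-++ : ∀ g xs ys → sumL g (xs ++ ys) ≡ sumL g xs + sumL g ys
  sumL-++ g [] ys = sym (+-identityˡ _)
  sumL-++ g (x ∷ xs) ys = trans (cong₂ _+_ (refl {x = g x}) (sumL-++ g xs ys)) (sym (+-assoc (g x) _ _))

  sumLL-++ : ∀ g xs ys → sumLL g (xs ++ ys) ≡ sumLL g xs + sumLL g ys
  sumLL-++ g [] ys = sym (+-identityˡ _)
  sumLL-++ g (c ∷ xs) ys = trans (cong₂ _+_ (refl {x = sumL g c}) (sumLL-++ g xs ys)) (sym (+-assoc (sumL g c) _ _))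

  cnt : (ℕ → Bool) → List ℕ → ℕ
  cnt p [] = 0
  cnt p (x ∷ xs) = (if p x then 1 else 0) ℕ.+ cnt p xs

  cntL : (ℕ → Bool) → List (List ℕ) → ℕ
  cntL p [] = 0
  cntL p (c ∷ cs) = cnt p c ℕ.+ cntL p cs

  cntN : (ℕ → Bool) → ℕ → ℕ
  cntN p zero = 0
  cntN p (suc n) = cntN p n ℕ.+ (if p n then 1 else 0)

  private
    ind : (ℕ → Bool) → ℕ → ℤ
    ind p x = + (if p x then 1 else 0)

    sumL-ind : ∀ p xs → sumL (ind p) xs ≡ + cnt p xs
    sumL-ind p [] = refl
    sumL-ind p (x ∷ xs) = cong₂ _+_ (refl {x = ind p x}) (sumL-ind p xs)

    sumLL-ind : ∀ p xs → sumLL (ind p) xs ≡ + cntL p xs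
    sumLL-ind p [] = refl
    sumLL-ind p (x ∷ xs) = cong₂ _+_ (sumL-ind p x) (sumLL-ind p xs)

    sumN-ind : ∀ p n → sumN (ind p) n ≡ + cntN p n
    sumN-ind p zero = refl
    sumN-ind p (suc n) = cong (_+ ind p n) (sumN-ind p n)

  -- Equality of all weighted sums says that the lists partition {0, …, n-1}.
  record Partition (n : ℕ) (cs : List (List ℕ)) : Set where
    constructor partition
    field sums : ∀ g → sumLL g cs ≡ sumN g n
  open Partition public

  -- Indicator functions as weights turn equality of sums into equality of counts.
  Partition-cnt : ∀ {n cs} → Partition n cs → ∀ p → cntL p cs ≡ cntN p n
  Partition-cnt {n} {cs} part p = +-injective (trans (sym (sumLL-ind p cs)) (trans (sums part (ind p)) (sumN-ind p n)))

  cnt-++ : ∀ p xs ys → cnt p (xs ++ ys) ≡ cnt p xs ℕ.+ cnt p ys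
  cnt-++ p [] ys = refl
  cnt-++ p (x ∷ xs) ys rewrite cnt-++ p xs ys = sym (ℕₚ.+-assoc (if p x then 1 else 0) (cnt p xs) (cnt p ys))

  cntL-++ : ∀ p xs ys → cntL p (xs ++ ys) ≡ cntL p xs ℕ.+ cntL p ys
  cntL-++ p [] ys = refl
  cntL-++ p (x ∷ xs) ys rewrite cntL-++ p xs ys = sym (ℕₚ.+-assoc (cnt p x) (cntL p xs) (cntL p ys))

  infix 4 _∉_
  _∉_ : ℕ → List ℕ → Set
  x ∉ ys = All (_≢ x) ys

  is : ℕ → ℕ → Bool
  is x y = y ≡ᵇ x

  is-refl : ∀ x → is x x ≡ true
  is-refl zero = refl
  is-refl (suc x) = is-refl x

  is-≢ : ∀ {x y} → y ≢ x → is x y ≡ false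
  is-≢ {zero} {zero} h = ⊥-elim (h refl)
  is-≢ {zero} {suc y} h = refl
  is-≢ {suc x} {zero} h = refl
  is-≢ {suc x} {suc y} h = is-≢ {x} {y} (λ e → h (cong suc e))

  cnt-∉ : ∀ x ys → cnt (is x) ys ≡ 0 → x ∉ ys
  cnt-∉ x [] e = []
  cnt-∉ x (y ∷ ys) e with y ≟ x
  ... | yes refl rewrite is-refl y with () ← e
  ... | no h rewrite is-≢ h = h ∷ cnt-∉ x ys e

  cntL-∉ : ∀ x cs → cntL (is x) cs ≡ 0 → All (x ∉_) cs
  cntL-∉ x [] e = []
  cntL-∉ x (c ∷ cs) e = cnt-∉ x c (ℕₚ.m+n≡0⇒m≡0 (cnt (is x) c) e) ∷ cntL-∉ x cs (ℕₚ.m+n≡0⇒n≡0 (cnt (is x) c) e)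

  cntN-is : ∀ x n → n ≤ x → cntN (is x) n ≡ 0
  cntN-is x zero h = refl
  cntN-is x (suc n) h rewrite cntN-is x n (ℕₚ.<⇒≤ h) | is-≢ {x} {n} (ℕₚ.<⇒≢ h) = refl

  cntN-is-< : ∀ x n → x < n → cntN (is x) n ≡ 1
  cntN-is-< x (suc n) h with n ≟ x
  ... | yes refl rewrite cntN-is n n ℕₚ.≤-refl | is-refl n = refl
  ... | no ne rewrite is-≢ ne | cntN-is-< x n (ℕₚ.≤∧≢⇒< (ℕₚ.≤-pred h) (λ e → ne (sym e))) = refl

  cntN-is-≤1 : ∀ x n → cntN (is x) n ≤ 1
  cntN-is-≤1 x n with n ℕ.≤? x
  ... | yes h rewrite cntN-is x n h = ℕ.z≤n
  ... | no h rewrite cntN-is-< x n (ℕₚ.≰⇒> h) = ℕₚ.≤-refl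

  data At (x : ℕ) : List ℕ → Set where
    at : ∀ xs ys → At x (xs ++ x ∷ ys)

  cnt-at : ∀ x ys → 1 ≤ cnt (is x) ys → At x ys
  cnt-at x (y ∷ ys) h with y ≟ x
  ... | yes refl = at [] ys
  ... | no ne rewrite is-≢ ne with cnt-at x ys h
  ...   | at xs zs = at (y ∷ xs) zs

  data AtL (x : ℕ) : List (List ℕ) → Set where
    atL : ∀ cs xs ys ds → AtL x (cs ++ (xs ++ x ∷ ys) ∷ ds)

  cntL-at : ∀ x cs → 1 ≤ cntL (is x) cs → AtL x cs
  cntL-at x (c ∷ cs) h with cnt (is x) c in e
  ... | suc m with cnt-at x c (ℕₚ.≤-trans (ℕ.s≤s ℕ.z≤n) (ℕₚ.≤-reflexive (sym e)))
  ...   | at xs ys = atL [] xs ys cs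
  cntL-at x (c ∷ cs) h | zero with cntL-at x cs h
  ... | atL cs₁ xs ys ds = atL (c ∷ cs₁) xs ys ds

  ∉-++ : ∀ {x} xs {ys} → x ∉ (xs ++ ys) → x ∉ xs × x ∉ ys
  ∉-++ [] h = [] , h
  ∉-++ (y ∷ xs) (h ∷ hs) with ∉-++ xs hs
  ... | p , q = h ∷ p , q

  Partition-< : ∀ {n cs} → Partition n cs → ∀ {x} → n ≤ x → All (x ∉_) cs
  Partition-< {n} {cs} part {x} h = cntL-∉ x cs (trans (Partition-cnt part (is x)) (cntN-is x n h))

  Partition-at : ∀ {n cs} → Partition n cs → ∀ {x} → x < n → AtL x cs
  Partition-at {n} {cs} part {x} h = cntL-at x cs (ℕₚ.≤-reflexive (sym (trans (Partition-cnt part (is x)) (cntN-is-< x n h))))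

  -- The total count of x is at most 1, and the displayed occurrence uses it up.
  Partition-unique : ∀ {n} cs xs x ys ds → Partition n (cs ++ (xs ++ x ∷ ys) ∷ ds) →
    All (x ∉_) cs × x ∉ xs × x ∉ ys × All (x ∉_) ds
  Partition-unique {n} cs xs x ys ds part =
    cntL-∉ x cs (proj₁ zeros) , cnt-∉ x xs (proj₁ (proj₂ zeros)) , cnt-∉ x ys (proj₁ (proj₂ (proj₂ zeros))) , cntL-∉ x ds (proj₂ (proj₂ (proj₂ zeros)))
    where
    total : cntL (is x) cs ℕ.+ ((cnt (is x) xs ℕ.+ suc (cnt (is x) ys)) ℕ.+ cntL (is x) ds) ≤ 1
    total = subst (_≤ 1) (trans (sym (Partition-cnt part (is x))) lem) (cntN-is-≤1 x n)
      where lem : cntL (is x) (cs ++ (xs ++ x ∷ ys) ∷ ds) ≡ cntL (is x) cs ℕ.+ ((cnt (is x) xs ℕ.+ suc (cnt (is x) ys)) ℕ.+ cntL (is x) ds)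
            lem rewrite cntL-++ (is x) cs ((xs ++ x ∷ ys) ∷ ds) | cnt-++ (is x) xs (x ∷ ys) | is-refl x = refl
    arith : ∀ a b c d → a ℕ.+ ((b ℕ.+ suc c) ℕ.+ d) ≤ 1 → a ≡ 0 × b ≡ 0 × c ≡ 0 × d ≡ 0
    arith zero zero zero zero h = refl , refl , refl , refl
    arith zero zero zero (suc d) (ℕ.s≤s ())
    arith zero zero (suc c) d (ℕ.s≤s ())
    arith zero (suc b) c d (ℕ.s≤s h) rewrite ℕₚ.+-suc b c with () ← h
    arith (suc a) b c d (ℕ.s≤s h) rewrite ℕₚ.+-suc b c | ℕₚ.+-suc a ((b ℕ.+ c) ℕ.+ d) with () ← h
    zeros = arith (cntL (is x) cs) (cnt (is x) xs) (cnt (is x) ys) (cntL (is x) ds) total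

  -- With σ = id a path follows α; with σ = suc it follows ζ⁻¹α, away from the last element of ζ.
  hd : (ℕ → ℕ) → List ℕ → ℕ → ℕ
  hd σ [] e = e
  hd σ (y ∷ _) e = σ y

  Path : (ℕ → ℕ) → (ℕ → ℕ) → List ℕ → ℕ → Set
  Path α σ [] e = ⊤
  Path α σ (x ∷ xs) e = α x ≡ hd σ xs e × Path α σ xs e

  Loop : (ℕ → ℕ) → (ℕ → ℕ) → List ℕ → Set
  Loop α σ [] = ⊥
  Loop α σ (x ∷ xs) = Path α σ (x ∷ xs) (σ x)

  hd-++ : ∀ σ xs ys e → hd σ (xs ++ ys) e ≡ hd σ xs (hd σ ys e)
  hd-++ σ [] ys e = refl
  hd-++ σ (x ∷ xs) ys e = refl

  Path-++ : ∀ {α σ} xs {ys e} → Path α σ xs (hd σ ys e) → Path α σ ys e → Path α σ (xs ++ ys) e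
  Path-++ [] p q = q
  Path-++ {σ = σ} (x ∷ xs) {ys} {e} (a , p) q = trans a (sym (hd-++ σ xs ys e)) , Path-++ xs p q

  Path-++⁻ : ∀ {α σ} xs {ys e} → Path α σ (xs ++ ys) e → Path α σ xs (hd σ ys e) × Path α σ ys e
  Path-++⁻ [] q = tt , q
  Path-++⁻ {σ = σ} (x ∷ xs) {ys} {e} (a , p) with Path-++⁻ xs p
  ... | p₁ , p₂ = (trans a (hd-++ σ xs ys e) , p₁) , p₂

  Path-cong : ∀ {α α' σ e} xs → All (λ x → α' x ≡ α x) xs → Path α σ xs e → Path α' σ xs e
  Path-cong [] h p = tt
  Path-cong (x ∷ xs) (e ∷ h) (a , p) = trans e a , Path-cong xs h p

  Loop-cong : ∀ {α α' σ} xs → All (λ x → α' x ≡ α x) xs → Loop α σ xs → Loop α' σ xs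
  Loop-cong (x ∷ xs) h p = Path-cong (x ∷ xs) h p

  -- A loop can be opened at any of its entries, as a merge requires.
  Loop-rotate : ∀ {α σ} xs x ys → Loop α σ (xs ++ x ∷ ys) → Path α σ (x ∷ ys ++ xs) (σ x)
  Loop-rotate {α} {σ} [] x ys p = subst (λ zs → Path α σ (x ∷ zs) (σ x)) (sym (++-[] ys)) p
    where ++-[] : ∀ (zs : List ℕ) → zs ++ [] ≡ zs
          ++-[] [] = refl
          ++-[] (z ∷ zs) = cong (z ∷_) (++-[] zs)
  Loop-rotate {α} {σ} (y ∷ xs) x ys p with Path-++⁻ (y ∷ xs) p
  ... | p₁ , p₂ = Path-++ (x ∷ ys) p₂ p₁

-- Insertion of the largest entry, and its effect on the cycles of α and of α⁻¹ζ.

module Insertion where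
  open import Data.Bool using (Bool; true; false; if_then_else_; not)
  open import Data.Nat as ℕ using (ℕ; zero; suc; _≤_; _<_; _≟_; _<ᵇ_)
  open import Data.Nat.Properties as ℕₚ using ()
  open import Data.Integer using (+_; _+_)
  open import Data.Integer.Tactic.RingSolver using (solve-∀)
  open import Data.List using (List; []; _∷_; _++_; length)
  open import Data.List.Properties using (length-++)
  open import Data.List.Relation.Unary.All using (All; []; _∷_)
  open import Data.List.Relation.Unary.All.Properties as Allₚ using ()
  open import Data.Product using (_,_)
  open import Data.Unit using (tt)
  open import Data.Empty using (⊥-elim)
  open import Function using (_∘_; id)
  open import Relation.Nullary using (yes; no)
  open import Relation.Binary.PropositionalEquality
  open Lists

  swap : ℕ → ℕ → ℕ → ℕ
  swap n i x with x ≟ n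
  ... | yes _ = i
  ... | no _ with x ≟ i
  ...   | yes _ = n
  ...   | no _ = x

  swap-fst : ∀ n i → swap n i n ≡ i
  swap-fst n i with n ≟ n
  ... | yes _ = refl
  ... | no h = ⊥-elim (h refl)

  swap-snd : ∀ n i → swap n i i ≡ n
  swap-snd n i with i ≟ n
  ... | yes e = e
  ... | no _ with i ≟ i
  ...   | yes _ = refl
  ...   | no h = ⊥-elim (h refl)

  swap-other : ∀ {n i x} → x ≢ n → x ≢ i → swap n i x ≡ x
  swap-other {n} {i} {x} h h' with x ≟ n
  ... | yes e = ⊥-elim (h e)
  ... | no _ with x ≟ i
  ...   | yes e = ⊥-elim (h' e)
  ...   | no _ = refl

  swap-swap : ∀ n i x → swap n i (swap n i x) ≡ x
  swap-swap n i x with x ≟ n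
  ... | yes refl = swap-snd n i
  ... | no h with x ≟ i
  ...   | yes refl = swap-fst n x
  ...   | no h' = swap-other h h'

  swap-< : ∀ {n i x} → i ≤ n → x < suc n → swap n i x < suc n
  swap-< {n} {i} {x} i≤n x< with x ≟ n
  ... | yes _ = ℕ.s≤s i≤n
  ... | no _ with x ≟ i
  ...   | yes _ = ℕₚ.≤-refl
  ...   | no _ = x<

  swap-≥ : ∀ {n i x} → i ≤ n → suc n ≤ x → swap n i x ≡ x
  swap-≥ i≤n h = swap-other (λ e → ℕₚ.<⇒≢ h (sym e)) (λ e → ℕₚ.<⇒≱ h (ℕₚ.≤-trans (ℕₚ.≤-reflexive e) i≤n))

  -- Inserts n just after i in its cycle; i ≡ n gives a new fixed point.
  insert : ℕ → ℕ → (ℕ → ℕ) → ℕ → ℕ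
  insert n i α = α ∘ swap n i

  -- All permutations act on the whole of ℕ and fix everything from n on. Insertion is then plain
  -- composition, and since `swap n n` is the identity, a new fixed point is no special case.
  record Permutes (n : ℕ) (α : ℕ → ℕ) : Set where
    field
      inverse : ℕ → ℕ
      left : ∀ x → inverse (α x) ≡ x
      right : ∀ x → α (inverse x) ≡ x
      below : ∀ {x} → x < n → α x < n
      inverse-below : ∀ {x} → x < n → inverse x < n
      fixed : ∀ {x} → n ≤ x → α x ≡ x

    injective : ∀ {x y} → α x ≡ α y → x ≡ y
    injective {x} {y} e = trans (sym (left x)) (trans (cong inverse e) (left y))

  open Permutes

  permutes-id : Permutes 0 id
  permutes-id = record { inverse = id ; left = λ _ → refl ; right = λ _ → refl ; below = id ; inverse-below = id ; fixed = λ _ → refl }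

  permutes-insert : ∀ {n α i} → i ≤ n → Permutes n α → Permutes (suc n) (insert n i α)
  permutes-insert {n} {α} {i} i≤n p = record
    { inverse = swap n i ∘ inverse p
    ; left = λ x → trans (cong (swap n i) (left p (swap n i x))) (swap-swap n i x)
    ; right = λ x → trans (cong α (swap-swap n i (inverse p x))) (right p x)
    ; below = λ h → wider (below p) (fixed p) (swap-< i≤n h)
    ; inverse-below = λ h → swap-< i≤n (wider (inverse-below p) (λ {x} h → trans (sym (cong (inverse p) (fixed p h))) (left p x)) h)
    ; fixed = λ {x} h → trans (cong α (swap-≥ i≤n h)) (fixed p (ℕₚ.<⇒≤ h))
    }
    where
    wider : ∀ {f : ℕ → ℕ} → (∀ {x} → x < n → f x < n) → (∀ {x} → n ≤ x → f x ≡ x) → ∀ {x} → x < suc n → f x < suc n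
    wider {f} b fx {x} h with x ≟ n
    ... | yes refl rewrite fx {x} ℕₚ.≤-refl = ℕₚ.≤-refl
    ... | no ne = ℕₚ.m<n⇒m<1+n (b (ℕₚ.≤∧≢⇒< (ℕₚ.≤-pred h) ne))

  weak : (ℕ → ℕ) → ℕ → Bool
  weak α x = not (x <ᵇ α x)

  bad : (ℕ → ℕ) → ℕ → Bool
  bad α x = x <ᵇ α x

  -- b stands for the number of back points, recorded as the surplus of the entries with α(x) ≤ x
  -- over the cycles. Under an insertion this surplus changes by a local rule, without reference to
  -- smallest elements of cycles.
  record Orbits (n : ℕ) (α : ℕ → ℕ) (k b : ℕ) : Set where
    field
      permutes : Permutes n α
      orbits : List (List ℕ)
      orbit-loops : All (Loop α id) orbits
      orbit-part : Partition n orbits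
      orbit-count : length orbits ≡ k
      weak-count : cntN (weak α) n ≡ k ℕ.+ b

  -- The cycles of α⁻¹ζ: the one through n - 1 is the stack, read backwards from n - 1.
  -- The label suc encodes ζ, since n - 1 is the image of no entry other than the last one of the stack.
  record State (n : ℕ) (α : ℕ → ℕ) (k b : ℕ) (stack : List ℕ) (cycles : List (List ℕ)) : Set where
    field
      orb : Orbits n α k b
      top : hd suc stack 0 ≡ n
      path : Path α suc stack 0
      loops : All (Loop α suc) cycles
      part : Partition n (stack ∷ cycles)
    open Orbits orb public

  open State

  State-id : State 0 id 0 0 [] []
  State-id = record
    { orb = record { permutes = permutes-id ; orbits = [] ; orbit-loops = [] ; orbit-part = partition λ _ → refl ; orbit-count = refl ; weak-count = refl }
    ; top = refl ; path = tt ; loops = [] ; part = partition λ _ → refl }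

  agree : ∀ {n i} (α : ℕ → ℕ) {xs} → n ∉ xs → i ∉ xs → All (λ x → insert n i α x ≡ α x) xs
  agree α [] [] = []
  agree α (p ∷ ps) (q ∷ qs) = cong α (swap-other p q) ∷ agree α ps qs

  agree-loops : ∀ {n i σ} (α : ℕ → ℕ) {cs} → All (n ∉_) cs → All (i ∉_) cs → All (Loop α σ) cs → All (Loop (insert n i α) σ) cs
  agree-loops α [] [] [] = []
  agree-loops α (p ∷ ps) (q ∷ qs) (l ∷ ls) = Loop-cong _ (agree α p q) l ∷ agree-loops α ps qs ls

  module _ {n α} (perm : Permutes n α) where

    insert-new : ∀ i → insert n i α n ≡ α i
    insert-new i = cong α (swap-fst n i)

    insert-at : ∀ i → insert n i α i ≡ n
    insert-at i = trans (cong α (swap-snd n i)) (fixed perm ℕₚ.≤-refl)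

  <ᵇ-true : ∀ {x y} → x < y → (x <ᵇ y) ≡ true
  <ᵇ-true {zero} (ℕ.s≤s h) = refl
  <ᵇ-true {suc x} (ℕ.s≤s h) = <ᵇ-true h

  <ᵇ-false : ∀ {x y} → y ≤ x → (x <ᵇ y) ≡ false
  <ᵇ-false {x} ℕ.z≤n = refl
  <ᵇ-false (ℕ.s≤s h) = <ᵇ-false h

  one : Bool → ℕ
  one b = if b then 1 else 0

  cntN-cong : ∀ p q n → (∀ x → x < n → p x ≡ q x) → cntN p n ≡ cntN q n
  cntN-cong p q zero h = refl
  cntN-cong p q (suc n) h = cong₂ (λ a b → a ℕ.+ one b) (cntN-cong p q n (λ x l → h x (ℕₚ.m<n⇒m<1+n l))) (h n ℕₚ.≤-refl)

  cntN-update : ∀ p q i n → i < n → (∀ x → x < n → x ≢ i → q x ≡ p x) → cntN q n ℕ.+ one (p i) ≡ cntN p n ℕ.+ one (q i)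
  cntN-update p q i (suc n) i< h with i ≟ n
  ... | yes refl rewrite cntN-cong q p n (λ x l → h x (ℕₚ.m<n⇒m<1+n l) (ℕₚ.<⇒≢ l)) = lem (cntN p n) (one (q i)) (one (p i))
    where lem : ∀ a b c → a ℕ.+ b ℕ.+ c ≡ a ℕ.+ c ℕ.+ b
          lem a b c = trans (ℕₚ.+-assoc a b c) (trans (cong (a ℕ.+_) (ℕₚ.+-comm b c)) (sym (ℕₚ.+-assoc a c b)))
  ... | no ne rewrite h n ℕₚ.≤-refl (λ e → ne (sym e)) =
    trans (lem (cntN q n) (one (p n)) (one (p i))) (trans (cong (ℕ._+ one (p n)) (cntN-update p q i n (ℕₚ.≤∧≢⇒< (ℕₚ.≤-pred i<) ne) (λ x l → h x (ℕₚ.m<n⇒m<1+n l)))) (lem (cntN p n) (one (q i)) (one (p n))))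
    where lem : ∀ a b c → a ℕ.+ b ℕ.+ c ≡ a ℕ.+ c ℕ.+ b
          lem a b c = trans (ℕₚ.+-assoc a b c) (trans (cong (a ℕ.+_) (ℕₚ.+-comm b c)) (sym (ℕₚ.+-assoc a c b)))

  module _ {n α k b} (s : Orbits n α k b) where
    open Orbits

    private p = permutes s

    orbits-new : Orbits (suc n) (insert n n α) (suc k) b
    orbits-new = record
      { permutes = permutes-insert ℕₚ.≤-refl p
      ; orbits = (n ∷ []) ∷ orbits s
      ; orbit-loops = (insert-at p n , tt) ∷ agree-loops α n∉ n∉ (orbit-loops s)
      ; orbit-part = partition λ g → trans (cong₂ _+_ (refl {x = g n + + 0}) (sums (orbit-part s) g)) (lem (g n) (sumN g n))
      ; orbit-count = cong suc (orbit-count s)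
      ; weak-count = trans (cong₂ (λ x y → x ℕ.+ one y) (cntN-cong _ _ n (λ x l → cong (λ y → not (x <ᵇ α y)) (swap-other (ℕₚ.<⇒≢ l) (ℕₚ.<⇒≢ l))))
          (cong not (trans (cong (n <ᵇ_) (insert-at p n)) (<ᵇ-false (ℕₚ.≤-refl {n}))))) (trans (ℕₚ.+-comm _ 1) (cong suc (weak-count s)))
      }
      where n∉ = Partition-< (orbit-part s) ℕₚ.≤-refl
            lem : ∀ x y → (x + + 0) + y ≡ y + x
            lem = solve-∀

    -- Since i is now sent to n, it is not weak any more, while the new entry n is weak. The weak
    -- entries thus increase by one exactly if i was bad before, and the number of cycles stays.
    orbits-old : ∀ {i} → i < n → Orbits (suc n) (insert n i α) k (one (bad α i) ℕ.+ b)
    orbits-old {i} i<n = go (orbits s) (orbit-loops s) (orbit-part s) (orbit-count s) (Partition-at (orbit-part s) i<n)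
      where
      α′ : ℕ → ℕ
      α′ = insert n i α
      weak-i : weak α′ i ≡ false
      weak-i = cong not (trans (cong (i <ᵇ_) (insert-at p i)) (<ᵇ-true i<n))
      weak-n : weak α′ n ≡ true
      weak-n = cong not (trans (cong (n <ᵇ_) (insert-new p i)) (<ᵇ-false (ℕₚ.<⇒≤ (below p i<n))))
      count : cntN (weak α′) (suc n) ≡ k ℕ.+ (one (bad α i) ℕ.+ b)
      count = lem (bad α i) (cntN (weak α′) n) (cntN (weak α) n) weak-n
          (trans (cntN-update (weak α) (weak α′) i n i<n (λ x l h → cong (λ y → not (x <ᵇ α y)) (swap-other (ℕₚ.<⇒≢ l) h))) (trans (cong (λ y → cntN (weak α) n ℕ.+ one y) weak-i) (ℕₚ.+-identityʳ _)))
          (weak-count s)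
        where lem : ∀ z c c' {w} → w ≡ true → c ℕ.+ one (not z) ≡ c' → c' ≡ k ℕ.+ b → c ℕ.+ one w ≡ k ℕ.+ (one z ℕ.+ b)
              lem false c c' refl h h' = trans h h'
              lem true c c' refl h h' = trans (ℕₚ.+-comm c 1) (trans (cong suc (trans (sym (ℕₚ.+-identityʳ c)) (trans h h'))) (sym (ℕₚ.+-suc k b)))
      go : ∀ os → All (Loop α id) os → Partition n os → length os ≡ k → AtL i os → Orbits (suc n) α′ k (one (bad α i) ℕ.+ b)
      go _ loops part len (atL cs xs ys ds) with Partition-unique cs xs i ys ds part | Allₚ.++⁻ cs (Partition-< part ℕₚ.≤-refl) | Allₚ.++⁻ cs loops
      ... | i∉cs , i∉xs , i∉ys , i∉ds | n∉cs , n∉c ∷ n∉ds | lcs , l ∷ lds with ∉-++ xs n∉c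
      ...   | n∉xs , _ ∷ n∉ys = record
        { permutes = permutes-insert (ℕₚ.<⇒≤ i<n) p
        ; orbits = cs ++ (xs ++ i ∷ n ∷ ys) ∷ ds
        ; orbit-loops = Allₚ.++⁺ (agree-loops α n∉cs i∉cs lcs) (loop xs n∉xs i∉xs l ∷ agree-loops α n∉ds i∉ds lds)
        ; orbit-part = partition λ g → trans (sumLL-++ g cs _) (trans (cong (λ x → sumLL g cs + (x + sumLL g ds)) (sumL-++ g xs _))
            (trans (lem (sumLL g cs) (sumL g xs) (g i) (g n) (sumL g ys) (sumLL g ds))
              (cong (_+ g n) (trans (sym (trans (sumLL-++ g cs _) (cong (λ x → sumLL g cs + (x + sumLL g ds)) (sumL-++ g xs _)))) (sums part g)))))
        ; orbit-count = trans (trans (length-++ cs) (sym (length-++ cs))) len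
        ; weak-count = count
        }
        where
        lem : ∀ a b c d e f → a + ((b + (c + (d + e))) + f) ≡ (a + ((b + (c + e)) + f)) + d
        lem = solve-∀
        loop : ∀ xs → n ∉ xs → i ∉ xs → Loop α id (xs ++ i ∷ ys) → Loop α′ id (xs ++ i ∷ n ∷ ys)
        loop [] _ _ (e , q) = insert-at p i , trans (insert-new p i) e , Path-cong ys (agree α n∉ys i∉ys) q
        loop (x ∷ xs) h h' q with Path-++⁻ (x ∷ xs) q
        ... | q₁ , e , q₂ = Path-++ (x ∷ xs) (Path-cong (x ∷ xs) (agree α h h') q₁) (insert-at p i , trans (insert-new p i) e , Path-cong ys (agree α n∉ys i∉ys) q₂)

  Partition-below : ∀ {n} cs xs x ys ds → Partition n (cs ++ (xs ++ x ∷ ys) ∷ ds) → x < n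
  Partition-below {n} cs xs x ys ds part with x ℕ.<? n
  ... | yes h = h
  ... | no h with Allₚ.++⁻ʳ cs (Partition-< part (ℕₚ.≮⇒≥ h))
  ...   | x∉ ∷ _ with ∉-++ xs x∉
  ...     | _ , x≢x ∷ _ = ⊥-elim (x≢x refl)

  module _ {n α k b stack cycles} (s : State n α k b stack cycles) where

    push : State (suc n) (insert n n α) (suc k) b (n ∷ stack) cycles
    push with Partition-< (part s) ℕₚ.≤-refl
    ... | n∉stack ∷ n∉cycles = record
      { orb = orbits-new (orb s)
      ; top = refl
      ; path = trans (insert-at (permutes s) n) (sym (top s)) , Path-cong stack (agree α n∉stack n∉stack) (path s)
      ; loops = agree-loops α n∉cycles n∉cycles (loops s)
      ; part = partition λ g → trans (lem (g n) (sumL g stack) (sumLL g cycles)) (cong (_+ g n) (sums (part s) g))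
      }
      where lem : ∀ a b c → (a + b) + c ≡ (b + c) + a
            lem = solve-∀

  -- The new entry n takes over the image of a, so `pre` follows n. As a is now sent to n, the
  -- successor of the old top, `post` and a close up to a loop.
  split : ∀ {n α k b} post a pre {cycles} → State n α k b (post ++ a ∷ pre) cycles →
    State (suc n) (insert n a α) k (one (bad α a) ℕ.+ b) (n ∷ pre) ((post ++ a ∷ []) ∷ cycles)
  split {n} {α} post a pre {cycles} s with Partition-unique [] post a pre cycles (part s) | Partition-< (part s) ℕₚ.≤-refl
  ... | _ , a∉post , a∉pre , a∉cycles | n∉stack ∷ n∉cycles with ∉-++ post n∉stack | Path-++⁻ post (path s)
  ... | n∉post , _ ∷ n∉pre | p₁ , e , p₂ = record
    { orb = orbits-old (orb s) a<n
    ; top = refl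
    ; path = trans (insert-new p a) e , Path-cong pre (agree α n∉pre a∉pre) p₂
    ; loops = loop post n∉post a∉post p₁ (top s) ∷ agree-loops α n∉cycles a∉cycles (loops s)
    ; part = partition λ g → trans (cong (λ x → (g n + sumL g pre) + (x + sumLL g cycles)) (sumL-++ g post (a ∷ [])))
        (trans (lem (g n) (sumL g pre) (sumL g post) (g a) (sumLL g cycles)) (cong (_+ g n) (trans (cong (_+ sumLL g cycles) (sym (sumL-++ g post (a ∷ pre)))) (sums (part s) g))))
    }
    where
    p = permutes s
    a<n = Partition-below [] post a pre cycles (part s)
    lem : ∀ n pre post a c → (n + pre) + ((post + (a + + 0)) + c) ≡ ((post + (a + pre)) + c) + n
    lem = solve-∀
    loop : ∀ post → n ∉ post → a ∉ post → Path α suc post (suc a) → hd suc (post ++ a ∷ pre) 0 ≡ n → Loop (insert n a α) suc (post ++ a ∷ [])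
    loop [] _ _ _ t = trans (insert-at p a) (sym t) , tt
    loop (x ∷ post) h h' q t = Path-++ (x ∷ post) (Path-cong (x ∷ post) (agree α h h') q) (trans (insert-at p a) (sym t) , tt)

  -- The new entry n takes over the image of i, so the rest of the cycle follows n, ending with i.
  -- As i is now sent to n, the successor of the old top, the old stack follows i.
  merge : ∀ {n α k b stack} cs xs i ys ds → State n α k b stack (cs ++ (xs ++ i ∷ ys) ∷ ds) →
    State (suc n) (insert n i α) k (one (bad α i) ℕ.+ b) (n ∷ (ys ++ xs) ++ i ∷ stack) (cs ++ ds)
  merge {n} {α} {stack = stack} cs xs i ys ds s with Partition-unique (stack ∷ cs) xs i ys ds (part s) | Partition-< (part s) ℕₚ.≤-refl
  ... | i∉stack ∷ i∉cs , i∉xs , i∉ys , i∉ds | n∉stack ∷ n∉cycles with Allₚ.++⁻ cs n∉cycles | Allₚ.++⁻ cs (loops s)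
  ... | n∉cs , n∉c ∷ n∉ds | lcs , l ∷ lds with ∉-++ xs n∉c | Loop-rotate xs i ys l
  ... | n∉xs , _ ∷ n∉ys | e , q = record
    { orb = orbits-old (orb s) (Partition-below (stack ∷ cs) xs i ys ds (part s))
    ; top = refl
    ; path = trans (insert-new p i) (trans e (sym (hd-++ suc (ys ++ xs) (i ∷ stack) 0)))
        , Path-++ (ys ++ xs) (Path-cong (ys ++ xs) (agree α (Allₚ.++⁺ n∉ys n∉xs) (Allₚ.++⁺ i∉ys i∉xs)) q)
            (trans (insert-at p i) (sym (top s)) , Path-cong stack (agree α n∉stack i∉stack) (path s))
    ; loops = Allₚ.++⁺ (agree-loops α n∉cs i∉cs lcs) (agree-loops α n∉ds i∉ds lds)
    ; part = partition λ g → trans (cong₂ (λ x y → (g n + x) + y) (trans (sumL-++ g (ys ++ xs) (i ∷ stack)) (cong (_+ (g i + sumL g stack)) (sumL-++ g ys xs))) (sumLL-++ g cs ds))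
        (trans (lem (g n) (sumL g ys) (sumL g xs) (g i) (sumL g stack) (sumLL g cs) (sumLL g ds))
          (cong (_+ g n) (trans (cong₂ _+_ (refl {x = sumL g stack}) (sym (trans (sumLL-++ g cs _) (cong (λ x → sumLL g cs + (x + sumLL g ds)) (sumL-++ g xs (i ∷ ys)))))) (sums (part s) g))))
    }
    where
    p = permutes s
    lem : ∀ n ys xs i st cs ds → (n + ((ys + xs) + (i + st))) + (cs + ds) ≡ (st + (cs + ((xs + (i + ys)) + ds))) + n
    lem = solve-∀

  cnt-agree : ∀ {n i} (f : Bool → Bool) (α : ℕ → ℕ) {xs} → n ∉ xs → i ∉ xs → cnt (f ∘ bad (insert n i α)) xs ≡ cnt (f ∘ bad α) xs
  cnt-agree f α [] [] = refl
  cnt-agree f α {x ∷ xs} (p ∷ ps) (q ∷ qs) = cong₂ ℕ._+_ (cong (λ y → one (f (x <ᵇ α y))) (swap-other p q)) (cnt-agree f α ps qs)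

  -- The top is n - 1, and no value of α on the entries is larger.
  top-good : ∀ {n α k b x xs cycles} → State n α k b (x ∷ xs) cycles → bad α x ≡ false
  top-good {x = x} s with State.top s
  ... | refl = <ᵇ-false (ℕₚ.≤-pred (Permutes.below (State.permutes s) {x} ℕₚ.≤-refl))

-- Sums over all completions of a permutation, by genus.

module Completions where
  open import Data.Bool using (Bool; true; false; if_then_else_; not; _∧_)
  open import Data.Bool.Properties using (∧-zeroʳ)
  open import Data.Nat as ℕ using (ℕ; zero; suc; _≤_; _<_; _≡ᵇ_; _<ᵇ_; pred)
  open import Data.Nat.Properties as ℕₚ using (+-suc)
  open import Data.Integer using (ℤ; +_; _+_; _*_)
  open import Data.Integer.Tactic.RingSolver using (solve-∀)
  open import Data.List using (List; []; _∷_; _++_; length)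
  open import Data.List.Properties using (length-++)
  open import Data.List.Relation.Unary.All using (All; []; _∷_)
  open import Data.List.Relation.Unary.All.Properties as Allₚ using ()
  open import Data.Product using (_,_)
  open import Data.Empty using (⊥-elim)
  open import Function using (_∘_)
  open import Relation.Binary.PropositionalEquality
  open Recurrences
  open Lists
  open Insertion

  sumS : (ℕ → List ℕ → ℤ) → List ℕ → ℤ
  sumS g [] = + 0
  sumS g (x ∷ xs) = g x xs + sumS g xs

  sumL-suffix : ∀ F g l → (∀ post a pre → l ≡ post ++ a ∷ pre → F a ≡ g a pre) → sumL F l ≡ sumS g l
  sumL-suffix F g [] h = refl
  sumL-suffix F g (x ∷ l) h = cong₂ _+_ (h [] x l refl) (sumL-suffix F g l (λ post a pre e → h (x ∷ post) a pre (cong (x ∷_) e)))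

  -- The recursion of `sumAnti` peels off c = 0, which is the cut at the top, and so runs parallel
  -- to the recursion on the stack.
  sumL-lengths : ∀ F (H : ℕ → ℕ → ℤ) l m → length l ≡ suc m → (∀ post a pre → l ≡ post ++ a ∷ pre → F a ≡ H (length post) (length pre)) → sumL F l ≡ sumAnti H m
  sumL-lengths F H (x ∷ []) zero e h = lem (h [] x [] refl)
    where lem : ∀ {a b} → a ≡ b → a + + 0 ≡ b
          lem {a} refl = lem' a
            where lem' : ∀ a → a + + 0 ≡ a
                  lem' = solve-∀
  sumL-lengths F H (x ∷ y ∷ l) (suc m) e h = trans (lem (F x) (sumL F (y ∷ l)))
    (cong₂ _+_ (sumL-lengths F (λ c → H (suc c)) (y ∷ l) m (ℕₚ.suc-injective e) (λ post a pre q → h (x ∷ post) a pre (cong (x ∷_) q)))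
      (trans (h [] x (y ∷ l) refl) (cong (H 0) (ℕₚ.suc-injective e))))
    where lem : ∀ a b → a + b ≡ b + a
          lem = solve-∀

  sumL-all : ∀ F G l → (∀ xs x ys → l ≡ xs ++ x ∷ ys → F x ≡ G x) → sumL F l ≡ sumL G l
  sumL-all F G [] h = refl
  sumL-all F G (x ∷ l) h = cong₂ _+_ (h [] x l refl) (sumL-all F G l (λ xs y ys e → h (x ∷ xs) y ys (cong (x ∷_) e)))

  sumCycles : (List ℕ → ℤ) → List (List ℕ) → ℤ
  sumCycles f [] = + 0
  sumCycles f (c ∷ cs) = f c + sumCycles f cs

  sumLL-cycles : ∀ F f css → (∀ cs c ds → css ≡ cs ++ c ∷ ds → sumL F c ≡ f c) → sumLL F css ≡ sumCycles f css
  sumLL-cycles F f [] h = refl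
  sumLL-cycles F f (c ∷ css) h = cong₂ _+_ (h [] c css refl) (sumLL-cycles F f css (λ cs d ds e → h (c ∷ cs) d ds (cong (c ∷_) e)))

  sumL-zero : ∀ l → sumL (λ _ → + 0) l ≡ + 0
  sumL-zero [] = refl
  sumL-zero (x ∷ l) = cong₂ _+_ (refl {x = + 0}) (sumL-zero l)

  sumLL-none : ∀ F css → (∀ cs xs x ys ds → css ≡ cs ++ (xs ++ x ∷ ys) ∷ ds → F x ≡ + 0) → sumLL F css ≡ + 0
  sumLL-none F [] h = refl
  sumLL-none F (c ∷ css) h = cong₂ _+_ (trans (sumL-all F (λ _ → + 0) c (λ xs x ys e → h [] xs x ys css (cong (_∷ css) e))) (sumL-zero c))
    (sumLL-none F css (λ cs xs x ys ds e → h (c ∷ cs) xs x ys ds (cong (c ∷_) e)))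

  sumAnti-const : ∀ f l → sumAnti (λ c i → f i) l ≡ sumTo f l
  sumAnti-const f zero = refl
  sumAnti-const f (suc l) = cong (_+ f (suc l)) (sumAnti-const f l)

  if-false : ∀ {a} {A : Set a} {b : Bool} {x y : A} → b ≡ false → (if b then x else y) ≡ y
  if-false refl = refl

  -- The last summand, i = n, is the push. The others run over the entries below n, and the field
  -- `sums` of the partition redistributes them over the stack and the finished cycles.
  completions : (ℕ → (ℕ → ℕ) → ℤ) → ℕ → ℕ → (ℕ → ℕ) → ℤ
  completions E zero n α = E n α
  completions E (suc N) n α = sumN (λ i → completions E N (suc n) (insert n i α)) (suc n)

  module Counting (W : ℕ → ℤ) (kf : ℕ) (E : ℕ → (ℕ → ℕ) → ℤ)
    (E-value : ∀ {n α k b x xs cycles} → State n α k b (x ∷ xs) cycles →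
      E n α ≡ (if (k ℕ.+ suc (length cycles) ℕ.+ 2 ≡ᵇ n ℕ.+ 1) ∧ (k ≡ᵇ kf) then W b else + 0)) where

    open Weighted W hiding (K)

    private
      total = completions E

    -- No insertion lowers the number of cycles of α.
    too-many-cycles : ∀ N {n α k b x xs cycles} → State n α k b (x ∷ xs) cycles → kf < k → total N n α ≡ + 0
    too-many-cycles zero {n} {k = k} {cycles = cycles} s h = trans (E-value s) (if-false (trans (cong (genus-one? ∧_) (is-≢ {y = k} (ℕₚ.>⇒≢ h))) (∧-zeroʳ genus-one?)))
      where genus-one? = k ℕ.+ suc (length cycles) ℕ.+ 2 ≡ᵇ n ℕ.+ 1
    too-many-cycles (suc N) {n} {α} {k} {b} {x} {xs} {cycles} s h = cong₂ _+_
      (trans (sym (sums (State.part s) F))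
        (cong₂ _+_ (trans (sumL-all F (λ _ → + 0) (x ∷ xs) (λ post a pre e → atStack post a pre e s)) (sumL-zero (x ∷ xs)))
          (sumLL-none F cycles (λ cs us y vs ds e → atCycle cs us y vs ds e s))))
      (too-many-cycles N (push s) (ℕₚ.m<n⇒m<1+n h))
      where
      F = λ i → total N (suc n) (insert n i α)
      atStack : ∀ post a pre {l} → l ≡ post ++ a ∷ pre → State n α k b l cycles → F a ≡ + 0
      atStack post a pre refl s = too-many-cycles N (split post a pre s) h
      atCycle : ∀ cs us y vs ds {l} → l ≡ cs ++ (us ++ y ∷ vs) ∷ ds → State n α k b (x ∷ xs) l → F y ≡ + 0
      atCycle cs us y vs ds refl s = too-many-cycles N (merge cs us y vs ds s) h

    private
      length-remove : ∀ (cs : List (List ℕ)) {c ds} → length (cs ++ c ∷ ds) ≡ suc (length (cs ++ ds))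
      length-remove [] = refl
      length-remove (c ∷ cs) = cong suc (length-remove cs)

    -- As k + length cycles + 2g = n for genus g, the hypothesis means g ≥ 2, and no insertion
    -- lowers the genus.
    genus≥2 : ∀ N {n α k b x xs cycles} → State n α k b (x ∷ xs) cycles → k ℕ.+ length cycles ℕ.+ 4 ≤ n → total N n α ≡ + 0
    genus≥2 zero {n} {α} {k} {cycles = cycles} s h = trans (E-value s) (if-false (cong (_∧ (k ≡ᵇ kf)) (is-≢ {y = k ℕ.+ suc (length cycles) ℕ.+ 2} (ℕₚ.<⇒≢ bound))))
      where bound : k ℕ.+ suc (length cycles) ℕ.+ 2 < n ℕ.+ 1
            bound = subst₂ _≤_ (trans (ℕₚ.+-suc (k ℕ.+ length cycles) 3) (trans (cong suc (ℕₚ.+-suc (k ℕ.+ length cycles) 2)) (cong (λ y → suc (y ℕ.+ 2)) (sym (ℕₚ.+-suc k (length cycles)))))) (ℕₚ.+-comm 1 n) (ℕₚ.m≤n⇒m≤1+n h)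
    genus≥2 (suc N) {n} {α} {k} {b} {x} {xs} {cycles} s h = cong₂ _+_
      (trans (sym (sums (State.part s) F))
        (cong₂ _+_ (trans (sumL-all F (λ _ → + 0) (x ∷ xs) (λ post a pre e → atStack post a pre e s)) (sumL-zero (x ∷ xs)))
          (sumLL-none F cycles (λ cs us y vs ds e → atCycle cs us y vs ds e s h))))
      (genus≥2 N (push s) (ℕ.s≤s h))
      where
      F = λ i → total N (suc n) (insert n i α)
      atStack : ∀ post a pre {l} → l ≡ post ++ a ∷ pre → State n α k b l cycles → F a ≡ + 0
      atStack post a pre refl s = genus≥2 N (split post a pre s) (subst (_≤ suc n) (cong (ℕ._+ 4) (sym (ℕₚ.+-suc k (length cycles)))) (ℕ.s≤s h))
      atCycle : ∀ cs us y vs ds {l} → l ≡ cs ++ (us ++ y ∷ vs) ∷ ds → State n α k b (x ∷ xs) l → k ℕ.+ length l ℕ.+ 4 ≤ n → F y ≡ + 0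
      atCycle cs us y vs ds refl s h = genus≥2 N (merge cs us y vs ds s)
        (ℕₚ.≤-trans (ℕₚ.+-monoˡ-≤ 4 (ℕₚ.+-monoʳ-≤ k (ℕₚ.≤-trans (ℕₚ.n≤1+n _) (ℕₚ.≤-reflexive (sym (length-remove cs)))))) (ℕₚ.m≤n⇒m≤1+n h))

    -- The sum runs over the entries down to which the stack w, topped by a good entry, can be popped.
    ρ-pop : ∀ N j b (p : ℕ → Bool) w → ρ (suc N) j (cnt p w) b (cnt (not ∘ p) w) 0 ≡
      prev (λ j → ρ N j (cnt p w) b (suc (cnt (not ∘ p) w)) 0) j + (ρ N j (cnt p w) b (cnt (not ∘ p) w) 0
        + sumS (λ x xs → ρ N j (cnt p xs) (one (p x) ℕ.+ b) (cnt (not ∘ p) xs) 0) w)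
    ρ-pop N j b p [] rewrite r-base N j = lem j
      where sol : ∀ w x y → w * (x + y) ≡ w * y + (w * x + + 0)
            sol = solve-∀
            sol₀ : ∀ w x → w * (x + + 0) ≡ + 0 + (w * x + + 0)
            sol₀ = solve-∀
            lem : ∀ i → W b * (r N j 0 0 + prev (λ j → r N j 1 0) i) ≡ prev (λ j → W b * r N j 1 0) i + (W b * r N j 0 0 + + 0)
            lem zero = sol₀ (W b) (r N j 0 0)
            lem (suc i) = sol (W b) (r N j 0 0) (r N i 1 0)
    ρ-pop N j b p (x ∷ w) with p x
    ... | false = trans (ρ-pascal (suc N) j e b a 0) (trans (cong₂ _+_ (ρ-pop N j b p w) (ρ-step N j e b a 0)) (lem j))
      where
      e = cnt p w
      a = cnt (not ∘ p) w
      S = sumS (λ x xs → ρ N j (cnt p xs) (one (p x) ℕ.+ b) (cnt (not ∘ p) xs) 0) w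
      sol : ∀ u v x y z → (u + (x + z)) + (y + v) ≡ (u + v) + (y + (x + z))
      sol = solve-∀
      lem : ∀ i → (prev (λ j → ρ N j e b (suc a) 0) i + (ρ N j e b a 0 + S)) + (ρ N j e b (suc a) 0 + prev (λ j → ρ N j e b (suc a) 1) i)
        ≡ prev (λ j → ρ N j e b (suc (suc a)) 0) i + (ρ N j e b (suc a) 0 + (ρ N j e b a 0 + S))
      lem zero = sol (+ 0) (+ 0) (ρ N j e b a 0) (ρ N j e b (suc a) 0) S
      lem (suc i) rewrite ρ-pascal N i e b (suc a) 0 = sol (ρ N i e b (suc a) 0) (ρ N i e b (suc a) 1) (ρ N j e b a 0) (ρ N j e b (suc a) 0) S
    ... | true = trans (cong₂ _+_ (ρ-pop N j b p w) (ρ-step N j e (suc b) a 0)) (lem j)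
      where
      e = cnt p w
      a = cnt (not ∘ p) w
      S = sumS (λ x xs → ρ N j (cnt p xs) (one (p x) ℕ.+ b) (cnt (not ∘ p) xs) 0) w
      sol : ∀ u v x y y' z → (u + (x + z)) + ((y + y') + v) ≡ (u + v) + ((x + y') + (y + z))
      sol = solve-∀
      lem : ∀ i → (prev (λ j → ρ N j e b (suc a) 0) i + (ρ N j e b a 0 + S)) + (ρ N j e (suc b) (suc a) 0 + prev (λ j → ρ N j e (suc b) (suc a) 1) i)
        ≡ prev (λ j → ρ N j e b (suc a) 0 + ρ N j e (suc b) (suc a) 1) i + ((ρ N j e b a 0 + ρ N j e (suc b) a 1) + (ρ N j e (suc b) a 0 + S))
      lem zero rewrite ρ-pascal N j e (suc b) a 0 = sol (+ 0) (+ 0) (ρ N j e b a 0) (ρ N j e (suc b) a 0) (ρ N j e (suc b) a 1) S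
      lem (suc i) rewrite ρ-pascal N j e (suc b) a 0 = sol (ρ N i e b (suc a) 0) (ρ N i e (suc b) (suc a) 1) (ρ N j e b a 0) (ρ N j e (suc b) a 0) (ρ N j e (suc b) a 1) S

    private
      genus-shift : ∀ k m {n} → k ℕ.+ m ℕ.+ 2 ≡ n → k ℕ.+ suc m ℕ.+ 2 ≡ suc n
      genus-shift k m h = trans (cong (ℕ._+ 2) (ℕₚ.+-suc k m)) (cong suc h)

    -- Another merge would lead to genus 2, so only pushes and cuts remain, and the finished cycles
    -- no longer matter. j is the number of pushes still to be made.
    genus-one : ∀ N j {n α k b x w cycles} → State n α k b (x ∷ w) cycles → k ℕ.+ length cycles ℕ.+ 2 ≡ n → k ℕ.+ j ≡ kf →
      total N n α ≡ ρ N j (cnt (bad α) w) b (cnt (not ∘ bad α) w) 0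
    genus-one zero j {n} {α} {k} {b} {w = w} {cycles} s g refl rewrite E-value s | genus-shift k (length cycles) g | ℕₚ.+-comm n 1 | is-refl n with j
    ... | zero rewrite ℕₚ.+-identityʳ k | is-refl k = sym (ρ-zero-zero (cnt (bad α) w) b _)
    ... | suc j rewrite is-≢ {k ℕ.+ suc j} {k} (ℕₚ.<⇒≢ (ℕₚ.m<m+n k (ℕ.s≤s ℕ.z≤n))) = sym (ρ-zero-suc j (cnt (bad α) w) b _)
    genus-one (suc N) j {n} {α} {k} {b} {x} {w} {cycles} s g h with Partition-< (State.part s) ℕₚ.≤-refl
    ... | n∉stack ∷ _ = trans (cong₂ _+_ (trans (sym (sums (State.part s) F)) (cong₂ _+_ stacked merged)) (pushed j h))
        (trans (lem (ρ N j (cnt p w) b (cnt (not ∘ p) w) 0 + sumS G w) (prev (λ j → ρ N j (cnt p w) b (suc (cnt (not ∘ p) w)) 0) j))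
          (sym (ρ-pop N j b p w)))
      where
      F = λ i → total N (suc n) (insert n i α)
      p = bad α
      G = λ x xs → ρ N j (cnt p xs) (one (p x) ℕ.+ b) (cnt (not ∘ p) xs) 0
      lem : ∀ a b → (a + + 0) + b ≡ b + a
      lem = solve-∀
      pushed : ∀ j → k ℕ.+ j ≡ kf → F n ≡ prev (λ j → ρ N j (cnt p w) b (suc (cnt (not ∘ p) w)) 0) j
      pushed zero refl = too-many-cycles N (push s) (ℕ.s≤s (ℕₚ.≤-reflexive (ℕₚ.+-identityʳ k)))
      pushed (suc j) h = trans (genus-one N j (push s) (cong suc g) (trans (sym (ℕₚ.+-suc k j)) h)) 
        (trans (cong₂ (λ c d → ρ N j c b d 0) (cnt-agree (λ z → z) α n∉stack n∉stack) (cnt-agree not α n∉stack n∉stack))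
          (cong (λ z → ρ N j (one z ℕ.+ cnt p w) b (one (not z) ℕ.+ cnt (not ∘ p) w) 0) (top-good s)))
      popped : ∀ post a pre {l} → l ≡ post ++ a ∷ pre → State n α k b l cycles → F a ≡ G a pre
      popped post a pre refl s with Partition-unique [] post a pre cycles (State.part s) | Partition-< (State.part s) ℕₚ.≤-refl
      ... | _ , _ , a∉pre , _ | n∉ ∷ _ with ∉-++ post n∉
      ...   | _ , _ ∷ n∉pre = trans (genus-one N j (split post a pre s) (genus-shift k (length cycles) g) h)
              (cong₂ (λ c d → ρ N j c (one (p a) ℕ.+ b) d 0) (cnt-agree (λ z → z) α n∉pre a∉pre) (cnt-agree not α n∉pre a∉pre))
      stacked : sumL F (x ∷ w) ≡ ρ N j (cnt p w) b (cnt (not ∘ p) w) 0 + sumS G w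
      stacked = trans (sumL-suffix F G (x ∷ w) (λ post a pre e → popped post a pre e s))
        (cong (λ z → ρ N j (cnt p w) (one z ℕ.+ b) (cnt (not ∘ p) w) 0 + sumS G w) (top-good s))
      atCycle : ∀ cs us y vs ds {l} → l ≡ cs ++ (us ++ y ∷ vs) ∷ ds → State n α k b (x ∷ w) l → k ℕ.+ length l ℕ.+ 2 ≡ n → F y ≡ + 0
      atCycle cs us y vs ds refl s g = genus≥2 N (merge cs us y vs ds s) (ℕₚ.≤-reflexive (trans (cong (λ m → m) lem′) (cong suc g)))
        where lem′ : k ℕ.+ length (cs ++ ds) ℕ.+ 4 ≡ suc (k ℕ.+ length (cs ++ (us ++ y ∷ vs) ∷ ds) ℕ.+ 2)
              lem′ rewrite length-remove cs {us ++ y ∷ vs} {ds} | ℕₚ.+-suc k (length (cs ++ ds)) = trans (ℕₚ.+-suc _ 3) (cong suc (ℕₚ.+-suc _ 2))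
      merged : sumLL F cycles ≡ + 0
      merged = sumLL-none F cycles (λ cs us y vs ds e → atCycle cs us y vs ds e s g)

    module _ (V : Array) (V-step : Step V (source W)) (V-zero : ∀ j l → V 0 j l ≡ + 0) where

      KS MS : List (List ℕ) → Array
      KS cs n j l = sumCycles (λ c → K W (pred (length c)) n j l) cs
      MS cs n j l = sumCycles (λ c → merging (pred (length c)) n j l) cs

      KS-step : ∀ cs → Step (KS cs) (MS cs)
      KS-step [] n j l = sym (cong₂ (λ x y → x + y + + 0) (prev-zero j (λ _ → refl)) (sumTo-zero l (λ _ → refl)))
      KS-step (c ∷ cs) = step-+ (K-step (pred (length c))) (KS-step cs)

      KS-zero : ∀ cs j l → KS cs 0 j l ≡ + 0
      KS-zero [] j l = refl
      KS-zero (c ∷ cs) j l = cong₂ _+_ (K-zero (pred (length c)) j l) (KS-zero cs j l)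

      private
        length-split : ∀ (p : ℕ → Bool) w → cnt p w ℕ.+ cnt (not ∘ p) w ≡ length w
        length-split p [] = refl
        length-split p (x ∷ w) with p x
        ... | true = cong suc (length-split p w)
        ... | false = trans (ℕₚ.+-suc _ _) (cong suc (length-split p w))

        sumL-two : ∀ (p : ℕ → Bool) A B c → sumL (λ x → if p x then B else A) c ≡ + cnt (not ∘ p) c * A + + cnt p c * B
        sumL-two p A B [] = lem A B
          where lem : ∀ A B → + 0 ≡ + 0 * A + + 0 * B
                lem = solve-∀
        sumL-two p A B (x ∷ c) with p x
        ... | true = trans (cong₂ _+_ (refl {x = B}) (sumL-two p A B c)) (lem (+ cnt (not ∘ p) c) (+ cnt p c) A B)
          where lem : ∀ u v A B → B + (u * A + v * B) ≡ u * A + (+ 1 + v) * B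
                lem = solve-∀
        ... | false = trans (cong₂ _+_ (refl {x = A}) (sumL-two p A B c)) (lem (+ cnt (not ∘ p) c) (+ cnt p c) A B)
          where lem : ∀ u v A B → A + (u * A + v * B) ≡ (+ 1 + u) * A + v * B
                lem = solve-∀

      -- Only one merge can follow, so each finished cycle contributes its own `K`, independently of
      -- the others. A cut adds the `K` of the cycle it creates, and over all cuts these add up to
      -- `source W`. Cuts happen at good entries, so b stays 0.
      genus-zero : ∀ N j {n α k x w cycles} → State n α k 0 (x ∷ w) cycles → cnt (bad α) (x ∷ w) ≡ 0 → All (λ c → cnt (bad α) c ≡ 1) cycles →
        k ℕ.+ length cycles ≡ n → k ℕ.+ j ≡ kf → total N n α ≡ V N j (length w) + KS cycles N j (length w)
      genus-zero zero j {n} {α} {k} {w = w} {cycles} s _ _ refl h =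
        trans (E-value s) (trans (if-false (cong (_∧ (k ≡ᵇ kf)) (is-≢ {y = k ℕ.+ suc (length cycles) ℕ.+ 2} λ e → ℕₚ.<⇒≢ (bound k (length cycles)) (sym e))))
          (sym (cong₂ _+_ (V-zero j (length w)) (KS-zero cycles j (length w)))))
        where bound : ∀ k m → k ℕ.+ m ℕ.+ 1 < k ℕ.+ suc m ℕ.+ 2
              bound k m rewrite ℕₚ.+-suc k m = ℕ.s≤s (ℕₚ.+-monoʳ-≤ (k ℕ.+ m) (ℕ.s≤s ℕ.z≤n))
      genus-zero (suc N) j {n} {α} {k} {x} {w} {cycles} s good ones g h with Partition-< (State.part s) ℕₚ.≤-refl
      ... | n∉stack ∷ n∉cycles = trans (cong₂ _+_ (trans (sym (sums (State.part s) F)) (cong₂ _+_ stacked merged)) (pushed j h))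
          (trans (lem (sumTo (λ l → V N j l + KS cycles N j l) (length w)) (source W N j (length w)) (MS cycles N j (length w)) (prev (λ j → V N j (suc (length w)) + KS cycles N j (suc (length w))) j))
            (sym (step-+ V-step (KS-step cycles) N j (length w))))
        where
        F = λ i → total N (suc n) (insert n i α)
        lem : ∀ a b c d → ((a + b) + c) + d ≡ d + a + (b + c)
        lem = solve-∀
        still-ones : ∀ {i cs} → All (n ∉_) cs → All (i ∉_) cs → All (λ c → cnt (bad α) c ≡ 1) cs → All (λ c → cnt (bad (insert n i α)) c ≡ 1) cs
        still-ones [] [] [] = []
        still-ones (p ∷ ps) (q ∷ qs) (e ∷ es) = trans (cnt-agree (λ z → z) α p q) e ∷ still-ones ps qs es
        pushed : ∀ j → k ℕ.+ j ≡ kf → F n ≡ prev (λ j → V N j (suc (length w)) + KS cycles N j (suc (length w))) j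
        pushed zero refl = too-many-cycles N (push s) (ℕ.s≤s (ℕₚ.≤-reflexive (ℕₚ.+-identityʳ k)))
        pushed (suc j) h = genus-zero N j (push s) (trans (cong₂ (λ z c → one z ℕ.+ c) (top-good (push s)) (cnt-agree (λ z → z) α n∉stack n∉stack)) good)
          (still-ones n∉cycles n∉cycles ones) (cong suc g) (trans (sym (ℕₚ.+-suc k j)) h)
        popped : ∀ post a pre {l} → l ≡ post ++ a ∷ pre → State n α k 0 l cycles → cnt (bad α) l ≡ 0 →
          F a ≡ (V N j (length pre) + KS cycles N j (length pre)) + K W (length post) N j (length pre)
        popped post a pre refl s good with Partition-unique [] post a pre cycles (State.part s) | Partition-< (State.part s) ℕₚ.≤-refl | trans (sym (cnt-++ (bad α) post (a ∷ pre))) good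
        ... | _ , a∉post , a∉pre , a∉cycles | n∉ ∷ n∉cycles | goods with ∉-++ post n∉ | ℕₚ.m+n≡0⇒m≡0 (cnt (bad α) post) goods | ℕₚ.m+n≡0⇒n≡0 (cnt (bad α) post) goods
        ...   | n∉post , _ ∷ n∉pre | goodpost | goodpre = trans (genus-zero N j split′
                  (trans (cong₂ (λ z c → one z ℕ.+ c) (top-good split′) (cnt-agree (λ z → z) α n∉pre a∉pre)) (ℕₚ.m+n≡0⇒n≡0 (one (bad α a)) goodpre))
                  (newbad ∷ still-ones n∉cycles a∉cycles ones)
                  (trans (ℕₚ.+-suc k (length cycles)) (cong suc g)) h)
                (trans (cong (λ c → V N j (length pre) + (K W (pred c) N j (length pre) + KS cycles N j (length pre))) (trans (length-++ post) (ℕₚ.+-comm (length post) 1)))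
                  (lem′ (V N j (length pre)) (K W (length post) N j (length pre)) (KS cycles N j (length pre))))
          where
          a-good : one (bad α a) ≡ 0
          a-good = ℕₚ.m+n≡0⇒m≡0 (one (bad α a)) goodpre
          split′ : State (suc n) (insert n a α) k 0 (n ∷ pre) ((post ++ a ∷ []) ∷ cycles)
          split′ = subst (λ b → State (suc n) (insert n a α) k b (n ∷ pre) ((post ++ a ∷ []) ∷ cycles)) (trans (ℕₚ.+-identityʳ _) a-good) (split post a pre s)
          -- The cut entry a, now sent to n, is the one bad entry of the new cycle.
          newbad : cnt (bad (insert n a α)) (post ++ a ∷ []) ≡ 1
          newbad = trans (cnt-++ (bad (insert n a α)) post (a ∷ [])) (cong₂ (λ u z → u ℕ.+ (one z ℕ.+ 0)) (trans (cnt-agree (λ z → z) α n∉post a∉post) goodpost)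
            (trans (cong (a <ᵇ_) (insert-at (State.permutes s) a)) (<ᵇ-true (Partition-below [] post a pre cycles (State.part s)))))
          lem′ : ∀ v u c → v + (u + c) ≡ (v + c) + u
          lem′ = solve-∀
        stacked : sumL F (x ∷ w) ≡ sumTo (λ l → V N j l + KS cycles N j l) (length w) + source W N j (length w)
        stacked = trans (sumL-lengths F (λ c i → (V N j i + KS cycles N j i) + K W c N j i) (x ∷ w) (length w) refl (λ post a pre e → popped post a pre e s good))
          (trans (sumAnti-+ (λ c i → V N j i + KS cycles N j i) (λ c i → K W c N j i) (length w)) (cong (_+ source W N j (length w)) (sumAnti-const _ (length w))))
        A B : ℕ → ℤ
        A c = ρ N j 2 0 (length w ℕ.+ c) 0
        B c = ρ N j 1 1 (suc (length w ℕ.+ c)) 0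
        atCycle : ∀ cs us y vs ds {l} → l ≡ cs ++ (us ++ y ∷ vs) ∷ ds → State n α k 0 (x ∷ w) l → k ℕ.+ length l ≡ n → cnt (bad α) (us ++ y ∷ vs) ≡ 1 →
          F y ≡ (if bad α y then B (pred (length (us ++ y ∷ vs))) else A (pred (length (us ++ y ∷ vs))))
        atCycle cs us y vs ds refl s g onebad with Partition-unique ((x ∷ w) ∷ cs) us y vs ds (State.part s) | Partition-< (State.part s) ℕₚ.≤-refl
        ... | (y∉stack ∷ _) , y∉us , y∉vs , _ | n∉stack ∷ n∉cycles with Allₚ.++⁻ʳ cs n∉cycles
        ...   | n∉c ∷ _ with ∉-++ us n∉c
        ...     | n∉us , _ ∷ n∉vs = trans (genus-one N j (merge cs us y vs ds s) genus h)
                  (trans (cong₂ (λ e a → ρ N j e (one (bad α y) ℕ.+ 0) a 0) (word (λ z → z)) (word not))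
                    (trans (cong₂ (λ e a → ρ N j e (one (bad α y) ℕ.+ 0) a 0)
                       (cong₂ (λ z u → cnt (bad α) (vs ++ us) ℕ.+ (one z ℕ.+ u)) y-bad good)
                       (cong₂ (λ z u → cnt (not ∘ bad α) (vs ++ us) ℕ.+ (one (not z) ℕ.+ u)) y-bad (trans (cong (ℕ._+ cnt (not ∘ bad α) (x ∷ w)) (sym good)) (length-split (bad α) (x ∷ w)))))
                    (final (bad α y) (cnt (bad α) (vs ++ us)) (cnt (not ∘ bad α) (vs ++ us)) (pred (length (us ++ y ∷ vs))) rest-bad rest-length)))
          where
          α′ : ℕ → ℕ
          α′ = insert n y α
          genus : k ℕ.+ length (cs ++ ds) ℕ.+ 2 ≡ suc n
          genus = trans (ℕₚ.+-suc (k ℕ.+ length (cs ++ ds)) 1) (cong suc (trans (ℕₚ.+-comm (k ℕ.+ length (cs ++ ds)) 1) (trans (sym (ℕₚ.+-suc k _)) (trans (cong (k ℕ.+_) (sym (length-remove cs))) g))))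
          y-bad : bad α′ y ≡ true
          y-bad = trans (cong (y <ᵇ_) (insert-at (State.permutes s) y)) (<ᵇ-true (Partition-below ((x ∷ w) ∷ cs) us y vs ds (State.part s)))
          word : ∀ f → cnt (f ∘ bad α′) ((vs ++ us) ++ y ∷ x ∷ w) ≡ cnt (f ∘ bad α) (vs ++ us) ℕ.+ (one (f (bad α′ y)) ℕ.+ cnt (f ∘ bad α) (x ∷ w))
          word f = trans (cnt-++ (f ∘ bad α′) (vs ++ us) (y ∷ x ∷ w)) (cong₂ (λ u v → u ℕ.+ (one (f (bad α′ y)) ℕ.+ v))
            (cnt-agree f α (Allₚ.++⁺ n∉vs n∉us) (Allₚ.++⁺ y∉vs y∉us)) (cnt-agree f α n∉stack y∉stack))
          comm : ∀ q → cnt q (us ++ y ∷ vs) ≡ one (q y) ℕ.+ cnt q (vs ++ us)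
          comm q = trans (cnt-++ q us (y ∷ vs)) (trans (ℕₚ.+-comm (cnt q us) _) (trans (ℕₚ.+-assoc (one (q y)) (cnt q vs) (cnt q us)) (cong (one (q y) ℕ.+_) (sym (cnt-++ q vs us)))))
          rest-bad : one (bad α y) ℕ.+ cnt (bad α) (vs ++ us) ≡ 1
          rest-bad = trans (sym (comm (bad α))) onebad
          rest-length : cnt (bad α) (vs ++ us) ℕ.+ cnt (not ∘ bad α) (vs ++ us) ≡ pred (length (us ++ y ∷ vs))
          rest-length = trans (length-split (bad α) (vs ++ us)) (trans (length-++ vs) (trans (ℕₚ.+-comm (length vs) (length us)) (sym (cong pred (trans (length-++ us) (ℕₚ.+-suc (length us) (length vs)))))))
          -- After a merge at the bad entry, that entry is the only bad one of the stack and b = 1.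
          -- After a merge at a good entry, it and the old bad entry of the cycle are the two bad
          -- ones, and b = 0.
          final : ∀ z e a c → one z ℕ.+ e ≡ 1 → e ℕ.+ a ≡ c → ρ N j (e ℕ.+ 1) (one z ℕ.+ 0) (a ℕ.+ suc (length w)) 0 ≡ (if z then B c else A c)
          final true .0 a c refl refl = cong (λ d → ρ N j 1 1 d 0) (trans (ℕₚ.+-suc a (length w)) (cong suc (ℕₚ.+-comm a (length w))))
          final false .1 a c refl refl = cong (λ d → ρ N j 2 0 d 0) (trans (ℕₚ.+-suc a (length w)) (trans (cong suc (ℕₚ.+-comm a (length w))) (sym (ℕₚ.+-suc (length w) a))))
        merged : sumLL F cycles ≡ MS cycles N j (length w)
        merged = sumLL-cycles F (λ c → merging (pred (length c)) N j (length w)) cycles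
          (λ cs c ds e → trans (sumL-all F (λ y → if bad α y then B (pred (length c)) else A (pred (length c))) c
              (λ us y vs e′ → in-cycle cs c ds e us y vs e′)) (trans (sumL-two (bad α) _ _ c) (weights c (one-at cs c ds e))))
          where
          one-at : ∀ cs c ds → cycles ≡ cs ++ c ∷ ds → cnt (bad α) c ≡ 1
          one-at cs c ds refl with Allₚ.++⁻ʳ cs ones
          ... | e ∷ _ = e
          in-cycle : ∀ cs c ds → cycles ≡ cs ++ c ∷ ds → ∀ us y vs → c ≡ us ++ y ∷ vs → F y ≡ (if bad α y then B (pred (length c)) else A (pred (length c)))
          in-cycle cs _ ds e us y vs refl = atCycle cs us y vs ds e s g (one-at cs _ ds e)
          weights : ∀ c → cnt (bad α) c ≡ 1 → + cnt (not ∘ bad α) c * A (pred (length c)) + + cnt (bad α) c * B (pred (length c)) ≡ merging (pred (length c)) N j (length w)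
          weights c e with length-split (bad α) c
          ... | q rewrite e | sym q = lem″ (+ cnt (not ∘ bad α) c * A (cnt (not ∘ bad α) c)) (B (cnt (not ∘ bad α) c))
            where lem″ : ∀ a b → a + + 1 * b ≡ a + b
                  lem″ = solve-∀

-- Cycles, back points and genus of the value tables, computed from the lists.

module Evaluation where
  open import Defs
  open import Data.Bool using (Bool; true; false; if_then_else_; not; _∧_; _∨_; T?)
  open import Data.Nat as ℕ using (ℕ; zero; suc; _≤_; _<_; _≡ᵇ_; _<ᵇ_; _⊓_; z≤n; s≤s)
  open import Data.Nat.DivMod using (_%_; m%n<n; m<n⇒m%n≡m; n%n≡0)
  open import Data.Nat.Properties as ℕₚ using ()
  open import Data.Integer as ℤ using (ℤ; +_)
  import Data.Integer.Properties as ℤₚ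
  open import Data.Fin as Fin using (Fin; toℕ; fromℕ<)
  open import Data.Fin.Properties using (toℕ<n; toℕ-fromℕ<; fromℕ<-toℕ; toℕ-injective; _≟_)
  open import Data.List using (List; []; _∷_; _++_; length; filter; allFin; tabulate; foldr; upTo; map; _ʳ++_)
  open import Data.List.Properties using (length-map; length-++)
  open import Data.List.Membership.Propositional using (_∈_)
  open import Data.List.Membership.Propositional.Properties using (∈-∃++; ∈-allFin; ∈-upTo⁺; ∈-++⁺ˡ; ∈-++⁺ʳ; ∈-++⁻)
  open import Data.List.Relation.Unary.Any using (here; there)
  open import Data.List.Relation.Unary.All as All using (All; []; _∷_)
  open import Data.Product using (_×_; _,_; proj₁; proj₂; ∃-syntax)
  open import Data.Sum using (inj₁; inj₂)
  open import Data.Vec as Vec using (Vec; lookup)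
  open import Data.Vec.Properties using (lookup∘tabulate)
  open import Data.Empty using (⊥-elim)
  open import Function using (_∘_; id)
  open import Relation.Binary using (tri<; tri≈; tri>)
  open import Relation.Nullary using (yes; no)
  open import Relation.Nullary.Decidable using (⌊_⌋)
  open import Relation.Binary.PropositionalEquality
  open Lists
  open Insertion

  ext : ∀ {n} {A : Set} → A → (Fin n → A) → ℕ → A
  ext {n} d p x with x ℕ.<? n
  ... | yes h = p (fromℕ< h)
  ... | no _ = d

  ext-toℕ : ∀ {n} {A : Set} (d : A) (p : Fin n → A) i → ext d p (toℕ i) ≡ p i
  ext-toℕ {n} d p i with toℕ i ℕ.<? n
  ... | yes h = cong p (fromℕ<-toℕ i h)
  ... | no h = ⊥-elim (h (toℕ<n i))

  cntN-front : ∀ p n → cntN p (suc n) ≡ one (p 0) ℕ.+ cntN (p ∘ suc) n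
  cntN-front p zero = ℕₚ.+-comm 0 (one (p 0))
  cntN-front p (suc n) = trans (cong (ℕ._+ one (p (suc n))) (cntN-front p n)) (ℕₚ.+-assoc (one (p 0)) _ _)

  count-tabulate : ∀ {n} m (p : Fin n → Bool) (q : ℕ → Bool) (f : Fin m → Fin n) → (∀ i → p (f i) ≡ q (toℕ i)) →
    length (filter (λ i → T? (p i)) (tabulate f)) ≡ cntN q m
  count-tabulate zero p q f h = refl
  count-tabulate (suc m) p q f h = trans (step (p (f Fin.zero)) refl)
      (trans (cong₂ ℕ._+_ (cong one (h Fin.zero)) (count-tabulate m p (q ∘ suc) (f ∘ Fin.suc) (λ i → h (Fin.suc i)))) (sym (cntN-front q m)))
    where
    rest = tabulate (f ∘ Fin.suc)
    step : ∀ b → p (f Fin.zero) ≡ b → length (filter (λ i → T? (p i)) (f Fin.zero ∷ rest)) ≡ one (p (f Fin.zero)) ℕ.+ length (filter (λ i → T? (p i)) rest)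
    step b e with p (f Fin.zero)
    ... | true = refl
    ... | false = refl

  count-cntN : ∀ {n} (p : Fin n → Bool) (q : ℕ → Bool) → (∀ i → p i ≡ q (toℕ i)) → count p ≡ cntN q n
  count-cntN {n} p q h = count-tabulate n p q id h

  iter-shift : ∀ {n} (f : Fin n → Fin n) t i → iter f t (f i) ≡ iter f (suc t) i
  iter-shift f zero i = refl
  iter-shift f (suc t) i = cong f (iter-shift f t i)

  cycleMin-lower : ∀ {n} (f : Fin n → Fin n) i b ms → b ≤ toℕ i → (∀ t → b ≤ toℕ (iter f t i)) → b ≤ foldr (λ m acc → toℕ (iter f m i) ⊓ acc) (toℕ i) ms
  cycleMin-lower f i b [] h h' = h
  cycleMin-lower f i b (m ∷ ms) h h' = ℕₚ.⊓-glb (h' m) (cycleMin-lower f i b ms h h')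

  cycleMin-upper₀ : ∀ {n} (f : Fin n → Fin n) i ms → foldr (λ m acc → toℕ (iter f m i) ⊓ acc) (toℕ i) ms ≤ toℕ i
  cycleMin-upper₀ f i [] = ℕₚ.≤-refl
  cycleMin-upper₀ f i (m ∷ ms) = ℕₚ.≤-trans (ℕₚ.m⊓n≤n (toℕ (iter f m i)) _) (cycleMin-upper₀ f i ms)

  cycleMin-upper : ∀ {n} (f : Fin n → Fin n) i {t ms} → t ∈ ms → foldr (λ m acc → toℕ (iter f m i) ⊓ acc) (toℕ i) ms ≤ toℕ (iter f t i)
  cycleMin-upper f i {ms = m ∷ ms} (here refl) = ℕₚ.m⊓n≤m (toℕ (iter f m i)) _
  cycleMin-upper f i {ms = m ∷ ms} (there h) = ℕₚ.≤-trans (ℕₚ.m⊓n≤n (toℕ (iter f m i)) _) (cycleMin-upper f i h)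

  isCycleMin-true : ∀ {n} (f : Fin n → Fin n) i → (∀ t → toℕ i ≤ toℕ (iter f t i)) → isCycleMin f i ≡ true
  isCycleMin-true {n} f i h = trans (cong (is (toℕ i)) (ℕₚ.≤-antisym (cycleMin-upper₀ f i (upTo n)) (cycleMin-lower f i (toℕ i) (upTo n) ℕₚ.≤-refl h))) (is-refl (toℕ i))

  isCycleMin-false : ∀ {n} (f : Fin n → Fin n) i t → t < n → toℕ (iter f t i) < toℕ i → isCycleMin f i ≡ false
  isCycleMin-false {n} f i t t< h = is-≢ (ℕₚ.<⇒≢ (ℕₚ.≤-<-trans (cycleMin-upper f i (∈-upTo⁺ t<)) h))

  minimum : ∀ x xs → ∃[ μ ] (μ ∈ x ∷ xs × All (μ ≤_) (x ∷ xs))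
  minimum x [] = x , here refl , ℕₚ.≤-refl ∷ []
  minimum x (y ∷ ys) with minimum y ys
  ... | μ , μ∈ , μ≤ with ℕₚ.≤-total x μ
  ...   | inj₁ h = x , here refl , ℕₚ.≤-refl ∷ All.map (ℕₚ.≤-trans h) μ≤
  ...   | inj₂ h = μ , there μ∈ , h ∷ μ≤

  ∈-cnt : ∀ {x xs} → x ∈ xs → 1 ≤ cnt (is x) xs
  ∈-cnt {x} (here refl) rewrite is-refl x = s≤s z≤n
  ∈-cnt (there h) = ℕₚ.≤-trans (∈-cnt h) (ℕₚ.m≤n+m _ _)

  cnt-cong : ∀ p q xs → (∀ {x} → x ∈ xs → p x ≡ q x) → cnt p xs ≡ cnt q xs
  cnt-cong p q [] h = refl
  cnt-cong p q (x ∷ xs) h = cong₂ (λ a b → one a ℕ.+ b) (h (here refl)) (cnt-cong p q xs (h ∘ there))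

  module Orbit {n} (f : Fin n → Fin n) (F : ℕ → ℕ) (F-f : ∀ i → toℕ (f i) ≡ F (toℕ i))
    (L : List (List ℕ)) (loops : All (Loop F id) L) (part : Partition n L) where

    F-iter : ∀ t i → toℕ (iter f (suc t) i) ≡ F (toℕ (iter f t i))
    F-iter t i = F-f (iter f t i)

    -- The bound on t matters because `cycleMin` inspects only the iterates with exponent below n.
    along : ∀ i x ys e → toℕ i ≡ x → Path F id (x ∷ ys) e → ∀ {μ} → μ ∈ x ∷ ys → ∃[ t ] (t < length (x ∷ ys) × toℕ (iter f t i) ≡ μ)
    along i x ys e eq p (here refl) = 0 , s≤s z≤n , eq
    along i x (y ∷ ys) e eq (a , p) (there h) with along (f i) y ys e (trans (F-f i) (trans (cong F eq) a)) p h
    ... | t , t< , q = suc t , s≤s t< , trans (cong toℕ (sym (iter-shift f t i))) q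

    rotate : ∀ {c x} → Loop F id c → x ∈ c → ∃[ ys ] (Path F id (x ∷ ys) x × length (x ∷ ys) ≡ length c × (∀ {y} → y ∈ c → y ∈ x ∷ ys) × (∀ {y} → y ∈ x ∷ ys → y ∈ c))
    rotate {c} {x} l x∈ with ∈-∃++ x∈
    ... | us , vs , refl = vs ++ us , Loop-rotate us x vs l , len , to , from
      where
      len : suc (length (vs ++ us)) ≡ length (us ++ x ∷ vs)
      len = trans (cong suc (trans (length-++ vs) (ℕₚ.+-comm (length vs) (length us)))) (sym (trans (length-++ us) (ℕₚ.+-suc (length us) (length vs))))
      to : ∀ {y} → y ∈ us ++ x ∷ vs → y ∈ x ∷ vs ++ us
      to h with ∈-++⁻ us h
      ... | inj₁ u = there (∈-++⁺ʳ vs u)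
      ... | inj₂ (here e) = here e
      ... | inj₂ (there v) = there (∈-++⁺ˡ v)
      from : ∀ {y} → y ∈ x ∷ vs ++ us → y ∈ us ++ x ∷ vs
      from (here e) = ∈-++⁺ʳ us (here e)
      from (there h) with ∈-++⁻ vs h
      ... | inj₁ v = ∈-++⁺ʳ us (there v)
      ... | inj₂ u = ∈-++⁺ˡ u

    closed : ∀ {c x} → Loop F id c → x ∈ c → F x ∈ c
    closed l x∈ with rotate l x∈
    ... | [] , (a , _) , _ , _ , from = from (here a)
    ... | y ∷ ys , (a , _) , _ , _ , from = from (there (here a))

    stays : ∀ {c i} → Loop F id c → toℕ i ∈ c → ∀ t → toℕ (iter f t i) ∈ c
    stays l h zero = h
    stays {c} {i} l h (suc t) = subst (_∈ c) (sym (F-iter t i)) (closed l (stays l h t))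

    private
      len-≤ : ∀ cs → cntL (λ _ → true) cs ≤ n → All (λ c → length c ≤ n) cs
      len-≤ [] h = []
      len-≤ (c ∷ cs) h = ℕₚ.≤-trans (ℕₚ.≤-trans (ℕₚ.≤-reflexive (sym (all c))) (ℕₚ.m≤m+n _ _)) h ∷ len-≤ cs (ℕₚ.≤-trans (ℕₚ.m≤n+m _ (cnt (λ _ → true) c)) h)
        where all : ∀ c → cnt (λ _ → true) c ≡ length c
              all [] = refl
              all (x ∷ c) = cong suc (all c)
      cntN-true : ∀ m → cntN (λ _ → true) m ≡ m
      cntN-true zero = refl
      cntN-true (suc m) = trans (ℕₚ.+-comm _ 1) (cong suc (cntN-true m))
      at-most-one : ∀ cs x → cntL (is x) cs ≤ 1 → All (λ c → cnt (is x) c ≤ 1) cs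
      at-most-one [] x h = []
      at-most-one (c ∷ cs) x h = ℕₚ.≤-trans (ℕₚ.m≤m+n _ _) h ∷ at-most-one cs x (ℕₚ.≤-trans (ℕₚ.m≤n+m _ (cnt (is x) c)) h)

    lengths : All (λ c → length c ≤ n) L
    lengths = len-≤ L (ℕₚ.≤-reflexive (trans (Partition-cnt part (λ _ → true)) (cntN-true n)))

    entry-< : ∀ {c x} → c ∈ L → x ∈ c → x < n
    entry-< {c} {x} c∈ x∈ with x ℕ.<? n
    ... | yes h = h
    ... | no h = ⊥-elim (All.lookup (All.lookup (Partition-< part (ℕₚ.≮⇒≥ h)) c∈) x∈ refl)

    -- Iterates never leave a loop, and from each of its entries the minimum is reached in fewer
    -- than n steps, as no loop is longer than n.
    minimal : ∀ {c} → c ∈ L → ∃[ μ ] (All (μ ≤_) c × cnt (is μ) c ≡ 1 × (∀ i → toℕ i ∈ c → isCycleMin f i ≡ is μ (toℕ i)))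
    minimal {[]} c∈ = ⊥-elim (All.lookup loops c∈)
    minimal {x ∷ xs} c∈ with minimum x xs
    ... | μ , μ∈ , μ≤ = μ , μ≤ , ℕₚ.≤-antisym (All.lookup (at-most-one L μ (subst (_≤ 1) (sym (Partition-cnt part (is μ))) (cntN-is-≤1 μ n))) c∈) (∈-cnt μ∈) , spec
      where
      loop = All.lookup loops c∈
      spec : ∀ i → toℕ i ∈ x ∷ xs → isCycleMin f i ≡ is μ (toℕ i)
      spec i i∈ with toℕ i ℕ.≟ μ
      ... | yes refl = trans (isCycleMin-true f i (λ t → All.lookup μ≤ (stays {i = i} loop i∈ t))) (sym (is-refl (toℕ i)))
      ... | no ne with rotate loop i∈
      ...   | ys , p , len , to , _ with along i (toℕ i) ys (toℕ i) refl p (to μ∈)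
      ...     | t , t< , q = trans (isCycleMin-false f i t (ℕₚ.<-≤-trans t< (ℕₚ.≤-trans (ℕₚ.≤-reflexive len) (All.lookup lengths c∈)))
                  (subst (_< toℕ i) (sym q) (ℕₚ.≤∧≢⇒< (All.lookup μ≤ i∈) (λ e → ne (sym e))))) (sym (is-≢ ne))

    minimal-ext : ∀ {c} → c ∈ L → cnt (ext false (isCycleMin f)) c ≡ 1
    minimal-ext {c} c∈ with minimal c∈
    ... | μ , _ , once , spec = trans (cnt-cong _ (is μ) c (λ {x} x∈ → helper x x∈ (entry-< c∈ x∈))) once
      where helper : ∀ x → x ∈ c → x < n → ext false (isCycleMin f) x ≡ is μ x
            helper x x∈ h rewrite sym (toℕ-fromℕ< h) = trans (ext-toℕ false (isCycleMin f) (fromℕ< h)) (spec (fromℕ< h) x∈)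

    z-length : z f ≡ length L
    z-length = trans (count-cntN (isCycleMin f) (ext false (isCycleMin f)) (λ i → sym (ext-toℕ false (isCycleMin f) i)))
      (trans (sym (Partition-cnt part (ext false (isCycleMin f)))) (go L (λ h → h)))
      where go : ∀ cs → (∀ {c} → c ∈ cs → c ∈ L) → cntL (ext false (isCycleMin f)) cs ≡ length cs
            go [] h = refl
            go (c ∷ cs) h = cong₂ ℕ._+_ (minimal-ext (h (here refl))) (go cs (h ∘ there))

    -- The values of F along a path are its entries moved on by one: the first entry is lost and the
    -- end point gained. On a loop the two coincide.
    cnt-path : ∀ p x xs e → Path F id (x ∷ xs) e → cnt (p ∘ F) (x ∷ xs) ℕ.+ one (p x) ≡ cnt p (x ∷ xs) ℕ.+ one (p e)
    cnt-path p x [] e (a , _) rewrite a = trans (cong (ℕ._+ one (p x)) (ℕₚ.+-identityʳ (one (p e)))) (trans (ℕₚ.+-comm (one (p e)) (one (p x))) (cong (ℕ._+ one (p e)) (sym (ℕₚ.+-identityʳ (one (p x))))))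
    cnt-path p x (y ∷ xs) e (a , q) rewrite a = lem (one (p y)) (cnt (p ∘ F) (y ∷ xs)) (one (p x)) (cnt p (y ∷ xs)) (one (p e)) (cnt-path p y xs e q)
      where lem : ∀ y u x v e → u ℕ.+ y ≡ v ℕ.+ e → (y ℕ.+ u) ℕ.+ x ≡ (x ℕ.+ v) ℕ.+ e
            lem y u x v e h = trans (ℕₚ.+-comm (y ℕ.+ u) x) (trans (cong (x ℕ.+_) (trans (ℕₚ.+-comm y u) h)) (sym (ℕₚ.+-assoc x v e)))

    cnt-image : ∀ p → cntN (p ∘ F) n ≡ cntN p n
    cnt-image p = trans (sym (Partition-cnt part (p ∘ F))) (trans (go L loops) (Partition-cnt part p))
      where go : ∀ cs → All (Loop F id) cs → cntL (p ∘ F) cs ≡ cntL p cs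
            go [] [] = refl
            go ((x ∷ xs) ∷ cs) (l ∷ ls) = cong₂ ℕ._+_ (ℕₚ.+-cancelʳ-≡ (one (p x)) _ _ (cnt-path p x xs x l)) (go cs ls)

    orbit-of : ∀ i → ∃[ c ] (c ∈ L × toℕ i ∈ c)
    orbit-of i = go (Partition-at part (toℕ<n i))
      where go : ∀ {cs x} → AtL x cs → ∃[ c ] (c ∈ cs × x ∈ c)
            go {x = x} (atL cs xs ys ds) = xs ++ x ∷ ys , ∈-++⁺ʳ cs (here refl) , ∈-++⁺ʳ xs (here refl)

    private
      cntN-+ : ∀ p q r m → (∀ x → x < m → one (p x) ≡ one (q x) ℕ.+ one (r x)) → cntN p m ≡ cntN q m ℕ.+ cntN r m
      cntN-+ p q r zero h = refl
      cntN-+ p q r (suc m) h = trans (cong₂ ℕ._+_ (cntN-+ p q r m (λ x l → h x (ℕₚ.m<n⇒m<1+n l))) (h m ℕₚ.≤-refl)) (lem (cntN q m) (cntN r m) (one (q m)) (one (r m)))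
        where lem : ∀ a b c d → (a ℕ.+ b) ℕ.+ (c ℕ.+ d) ≡ (a ℕ.+ c) ℕ.+ (b ℕ.+ d)
              lem a b c d = trans (ℕₚ.+-assoc a b (c ℕ.+ d)) (trans (cong (a ℕ.+_) (trans (sym (ℕₚ.+-assoc b c d)) (trans (cong (ℕ._+ d) (ℕₚ.+-comm b c)) (ℕₚ.+-assoc c b d)))) (sym (ℕₚ.+-assoc a c (b ℕ.+ d))))

    -- Every weak anti-excedance is a back point or the predecessor of the smallest entry of its orbit.
    weak-split : cntN (weak F) n ≡ backPoints f ℕ.+ z f
    weak-split = trans (cntN-+ (weak F) (ext false (isBackPoint f)) (ext false (isCycleMin f) ∘ F) n pointwise)
      (cong₂ ℕ._+_ (sym (count-cntN (isBackPoint f) _ (λ i → sym (ext-toℕ false (isBackPoint f) i))))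
        (trans (cnt-image (ext false (isCycleMin f))) (sym (count-cntN (isCycleMin f) _ (λ i → sym (ext-toℕ false (isCycleMin f) i))))))
      where
      at-fin : ∀ i → one (weak F (toℕ i)) ≡ one (isBackPoint f i) ℕ.+ one (isCycleMin f (f i))
      at-fin i rewrite sym (F-f i) with orbit-of i
      ... | c , c∈ , i∈ with minimal c∈
      ...   | μ , μ≤ , _ , spec with spec (f i) (stays {i = i} (All.lookup loops c∈) i∈ 1) | spec i i∈
      ...     | min-fi | min-i with toℕ (f i) ℕ.≟ μ
      ...       | yes e rewrite min-fi | e | is-refl μ | <ᵇ-false (All.lookup μ≤ i∈) = lem (μ <ᵇ toℕ i)
        where lem : ∀ b → 1 ≡ one (b ∧ false) ℕ.+ 1
              lem true = refl
              lem false = refl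
      ...       | no ne rewrite min-fi | is-≢ ne with ℕₚ.<-cmp (toℕ (f i)) (toℕ i)
      ...         | tri< h _ _ rewrite <ᵇ-true h | <ᵇ-false (ℕₚ.<⇒≤ h) = refl
      -- A fixed point is the smallest entry of its own cycle, which this case excludes.
      ...         | tri≈ _ h _ = ⊥-elim (absurd (trans (sym (isCycleMin-true f (f i) (λ t → ℕₚ.≤-reflexive (cong toℕ (sym (trans (iter-shift f t i) (trans (fixed (suc t)) (sym fi≡i)))))))) min-fi))
        where fi≡i = toℕ-injective h
              fixed : ∀ t → iter f t i ≡ i
              fixed zero = refl
              fixed (suc t) = trans (cong f (fixed t)) fi≡i
              absurd : true ≢ false
              absurd ()
      ...         | tri> _ _ h rewrite <ᵇ-true h | <ᵇ-false (ℕₚ.<⇒≤ h) = refl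
      pointwise : ∀ x → x < n → one (weak F x) ≡ one (ext false (isBackPoint f) x) ℕ.+ one (ext false (isCycleMin f) (F x))
      pointwise x h rewrite sym (toℕ-fromℕ< h) = trans (at-fin (fromℕ< h)) (cong₂ (λ a b → one a ℕ.+ one b) (sym (ext-toℕ false (isBackPoint f) (fromℕ< h)))
        (sym (trans (cong (ext false (isCycleMin f)) (sym (F-f (fromℕ< h)))) (ext-toℕ false (isCycleMin f) (f (fromℕ< h))))))

  clamp : ∀ m → ℕ → Fin (suc m)
  clamp m x = fromℕ< (m%n<n x (suc m))

  toℕ-clamp : ∀ m {x} → x < suc m → toℕ (clamp m x) ≡ x
  toℕ-clamp m {x} h = trans (toℕ-fromℕ< (m%n<n x (suc m))) (m<n⇒m%n≡m h)

  -- The clamping is void for a permutation of {0, …, n-1}.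
  toVec : ∀ n → (ℕ → ℕ) → Vec (Fin n) n
  toVec zero α = Vec.[]
  toVec (suc m) α = Vec.tabulate (λ i → clamp m (α (toℕ i)))

  toℕ-toVec : ∀ {n α} → Permutes n α → ∀ i → toℕ (lookup (toVec n α) i) ≡ α (toℕ i)
  toℕ-toVec {suc m} {α} p i = trans (cong toℕ (lookup∘tabulate (λ i → clamp m (α (toℕ i))) i)) (toℕ-clamp m (Permutes.below p (toℕ<n i)))

  zeta-suc : ∀ {n} (i : Fin n) → suc (toℕ i) < n → toℕ (zeta i) ≡ suc (toℕ i)
  zeta-suc {suc m} i h = toℕ-clamp m h

  zeta-last : ∀ {n} (i : Fin n) → suc (toℕ i) ≡ n → toℕ (zeta i) ≡ 0
  zeta-last {suc m} i h = trans (toℕ-fromℕ< (m%n<n (suc (toℕ i)) (suc m))) (trans (cong (_% suc m) h) (n%n≡0 (suc m)))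

  private
    -- Stated for any g that satisfies the two defining equations of the loop inside `inv`.
    search : ∀ {n} {g : List (Fin n) → Fin n} (v : Vec (Fin n) n) (y : Fin n) → g [] ≡ y →
      (∀ i is → g (i ∷ is) ≡ (if ⌊ lookup v i ≟ y ⌋ then i else g is)) → ∀ xs {j} → j ∈ xs → lookup v j ≡ y → lookup v (g xs) ≡ y
    search v y h h' (i ∷ xs) j∈ e with lookup v i ≟ y | h' i xs
    ... | yes q | r rewrite r = q
    search v y h h' (i ∷ xs) (here refl) e | no q | r = ⊥-elim (q e)
    search v y h h' (i ∷ xs) (there j∈) e | no q | r rewrite r = search v y h h' xs j∈ e

  mutual
    private
      search-loop : ∀ {n} → Vec (Fin n) n → Fin n → List (Fin n) → Fin n
      -- The loop local to inv cannot be named; it is recovered by unification in lookup-inv.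
      search-loop v y = _

    lookup-inv : ∀ {n} (v : Vec (Fin n) n) y j → lookup v j ≡ y → lookup v (inv v y) ≡ y
    lookup-inv {n} v y j e with allFin n | ∈-allFin j
    ... | xs | j∈ = search {g = search-loop v y} v y refl (λ _ _ → refl) xs j∈ e

  allB-true : ∀ {A : Set} (p : A → Bool) xs → (∀ x → p x ≡ true) → allB p xs ≡ true
  allB-true p [] h = refl
  allB-true p (x ∷ xs) h rewrite h x = allB-true p xs h

  isPerm-true : ∀ {n} (v : Vec (Fin n) n) → (∀ i j → lookup v i ≡ lookup v j → i ≡ j) → isPerm v ≡ true
  isPerm-true {n} v inj = allB-true _ (allFin n) (λ i → allB-true _ (allFin n) (λ j → lem i j))
    where lem : ∀ i j → not ⌊ lookup v i ≟ lookup v j ⌋ ∨ ⌊ i ≟ j ⌋ ≡ true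
          lem i j with lookup v i ≟ lookup v j | i ≟ j
          ... | no _ | _ = refl
          ... | yes _ | yes _ = refl
          ... | yes e | no ne = ⊥-elim (ne (inj i j e))

  sumL-ʳ++ : ∀ g xs ys → sumL g (xs ʳ++ ys) ≡ sumL g xs ℤ.+ sumL g ys
  sumL-ʳ++ g [] ys = sym (ℤₚ.+-identityˡ _)
  sumL-ʳ++ g (x ∷ xs) ys = trans (sumL-ʳ++ g xs (x ∷ ys)) (trans (sym (ℤₚ.+-assoc (sumL g xs) (g x) (sumL g ys))) (cong (ℤ._+ sumL g ys) (ℤₚ.+-comm (sumL g xs) (g x))))

  rev : List ℕ → List ℕ
  rev xs = xs ʳ++ []

  sumL-rev : ∀ g xs → sumL g (rev xs) ≡ sumL g xs
  sumL-rev g xs = trans (sumL-ʳ++ g xs []) (ℤₚ.+-identityʳ _)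

  -- `Loop` is defined by the shape of its list, so the head of the reversed list must first be
  -- exposed by recursion. The list is never empty, and the default 0 is not reached.
  loop-intro : ∀ F xs z acc → Path F id (xs ʳ++ (z ∷ acc)) (hd id (xs ʳ++ (z ∷ acc)) 0) → Loop F id (xs ʳ++ (z ∷ acc))
  loop-intro F [] z acc p = p
  loop-intro F (y ∷ xs) z acc p = loop-intro F xs y (z ∷ acc) p

  module _ {n α k b x xs cycles} (s : State n α k b (x ∷ xs) cycles) where

    private
      p = State.permutes s
      v = toVec n α
      f : Fin n → Fin n
      f i = inv v (zeta i)
      F : ℕ → ℕ
      F = ext 0 (toℕ ∘ f)

    lookup-f : ∀ i → α (toℕ (f i)) ≡ toℕ (zeta i)
    lookup-f i = trans (sym (toℕ-toVec p (f i))) (cong toℕ (lookup-inv v (zeta i) j (toℕ-injective (trans (toℕ-toVec p j) (trans (cong α (toℕ-fromℕ< j<)) (Permutes.right p _))))))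
      where j< = Permutes.inverse-below p (toℕ<n (zeta i))
            j = fromℕ< j<

    F-of : ∀ {y w} → (h : y < n) → α w ≡ toℕ (zeta (fromℕ< h)) → F y ≡ w
    F-of {y} {w} h e = trans (cong F (sym (toℕ-fromℕ< h))) (trans (ext-toℕ 0 (toℕ ∘ f) (fromℕ< h)) (Permutes.injective p (trans (lookup-f (fromℕ< h)) (sym e))))

    F-suc : ∀ {w y} → w < n → α w ≡ suc y → F y ≡ w
    F-suc {w} {y} w< e = F-of (ℕₚ.<⇒≤ y<) (trans e (sym (trans (zeta-suc (fromℕ< (ℕₚ.<⇒≤ y<)) (subst (λ y → suc y < n) (sym (toℕ-fromℕ< (ℕₚ.<⇒≤ y<))) y<)) (cong suc (toℕ-fromℕ< (ℕₚ.<⇒≤ y<))))))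
      where y< : suc y < n
            y< = subst (_< n) e (Permutes.below p w<)

    -- ζ sends n - 1 to 0. This closes the stack, whose top is n - 1 and whose last entry has image
    -- 0.
    F-last : ∀ {w y} → suc y ≡ n → α w ≡ 0 → F y ≡ w
    F-last {w} {y} h e = F-of (ℕₚ.≤-reflexive h) (trans e (sym (zeta-last (fromℕ< (ℕₚ.≤-reflexive h)) (trans (cong suc (toℕ-fromℕ< (ℕₚ.≤-reflexive h))) h))))

    -- If y follows w in the list, then α(w) = ζ(y), so α⁻¹ζ runs through the list from its end to
    -- its beginning.
    reversed : ∀ y ys acc {d e} → Path α suc (y ∷ ys) e → All (_< n) (y ∷ ys) → Path F id (y ∷ acc) d →
      Path F id (ys ʳ++ (y ∷ acc)) d × α (hd id (ys ʳ++ (y ∷ acc)) 0) ≡ e × hd id (ys ʳ++ (y ∷ acc)) 0 < n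
    reversed y [] acc (a , _) (h ∷ _) q = q , a , h
    reversed y (w ∷ ys) acc (a , r) (h ∷ hs) q = reversed w ys (y ∷ acc) r hs (F-suc h a , q)

    rev-loop : ∀ y ys {e} → Path α suc (y ∷ ys) e → All (_< n) (y ∷ ys) → (∀ {w} → w < n → α w ≡ e → F y ≡ w) → Loop F id (rev (y ∷ ys))
    rev-loop y ys r hs close with reversed y ys [] {F y} r hs (refl , _)
    ... | q , e , h = loop-intro F ys y [] (subst (Path F id (ys ʳ++ (y ∷ []))) (close h e) q)

    entries-< : All (All (_< n)) ((x ∷ xs) ∷ cycles)
    entries-< = All.tabulate (λ {c} c∈ → All.tabulate (λ {y} y∈ → bound c∈ y∈))
      where bound : ∀ {c y} → c ∈ (x ∷ xs) ∷ cycles → y ∈ c → y < n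
            bound {c} {y} c∈ y∈ with y ℕ.<? n
            ... | yes h = h
            ... | no h = ⊥-elim (All.lookup (All.lookup (Partition-< (State.part s) (ℕₚ.≮⇒≥ h)) c∈) y∈ refl)

    rev-loops : All (Loop F id) (map rev ((x ∷ xs) ∷ cycles))
    rev-loops with entries-<
    ... | h ∷ hs = rev-loop x xs (State.path s) h (λ _ → F-last (State.top s)) ∷ go cycles hs (State.loops s)
      where go : ∀ cs → All (All (_< n)) cs → All (Loop α suc) cs → All (Loop F id) (map rev cs)
            go [] _ _ = []
            go ((y ∷ ys) ∷ cs) (h ∷ hs) (l ∷ ls) = rev-loop y ys l h F-suc ∷ go cs hs ls

    rev-part : Partition n (map rev ((x ∷ xs) ∷ cycles))
    rev-part = partition λ g → trans (go g ((x ∷ xs) ∷ cycles)) (sums (State.part s) g)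
      where go : ∀ g cs → sumLL g (map rev cs) ≡ sumLL g cs
            go g [] = refl
            go g (c ∷ cs) = cong₂ ℤ._+_ (sumL-rev g c) (go g cs)

    z-inverse : z (λ i → inv v (zeta i)) ≡ suc (length cycles)
    z-inverse = trans (Orbit.z-length f F (λ i → sym (ext-toℕ 0 (toℕ ∘ f) i)) (map rev ((x ∷ xs) ∷ cycles)) rev-loops rev-part) (cong suc (length-map rev cycles))

    z-perm : z (app v) ≡ k
    z-perm = trans (Orbit.z-length (app v) α (toℕ-toVec p) (State.orbits s) (State.orbit-loops s) (State.orbit-part s)) (State.orbit-count s)

    backPoints-perm : backPoints (app v) ≡ b
    backPoints-perm = ℕₚ.+-cancelʳ-≡ k _ _ (trans (trans (cong (backPoints (app v) ℕ.+_) (sym z-perm))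
      (sym (Orbit.weak-split (app v) α (toℕ-toVec p) (State.orbits s) (State.orbit-loops s) (State.orbit-part s)))) (trans (State.weak-count s) (ℕₚ.+-comm k b)))

    genusOne-perm : genusOne v ≡ (k ℕ.+ suc (length cycles) ℕ.+ 2 ≡ᵇ n ℕ.+ 1)
    genusOne-perm rewrite z-perm | z-inverse = refl

  isPerm-toVec : ∀ {n α} → Permutes n α → isPerm (toVec n α) ≡ true
  isPerm-toVec {n} {α} p = isPerm-true (toVec n α) (λ i j e → toℕ-injective (Permutes.injective p (trans (sym (toℕ-toVec p i)) (trans (cong toℕ e) (toℕ-toVec p j)))))

-- Permutations as sequences of insertions, and the number of tables with a given property.

module Codes where
  open import Defs
  open import Data.Bool using (Bool; true; false; if_then_else_; T)
  open import Data.Bool.Properties using (T-irrelevant)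
  open import Data.Nat as ℕ using (ℕ; zero; suc; _<_)
  open import Data.Nat.Properties as ℕₚ using ()
  open import Data.Integer as ℤ using (ℤ; +_)
  import Data.Integer.Properties as ℤₚ
  open import Data.Fin as Fin using (Fin; toℕ; fromℕ<)
  open import Data.Fin.Properties using (toℕ<n; toℕ-fromℕ<; toℕ-injective; +↔⊎; any?; injective⇒≤; 0↔⊥; 1↔⊤) renaming (_≟_ to _≟ᶠ_)
  open import Data.List using (List; _∷_; allFin)
  open import Data.List.Membership.Propositional using (_∈_)
  open import Data.List.Membership.Propositional.Properties using (∈-allFin)
  open import Data.List.Relation.Unary.Any using (here; there)
  open import Data.Product using (Σ; _×_; _,_; proj₁; proj₂; ∃-syntax)
  open import Data.Product.Function.Dependent.Propositional using (Σ-↔)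
  open import Data.Sum using (_⊎_; inj₁; inj₂)
  open import Data.Sum.Function.Propositional using (_⊎-↔_)
  open import Data.Unit using (⊤; tt)
  open import Data.Empty using (⊥-elim)
  open import Data.Vec using (Vec; lookup)
  open import Data.Vec.Properties using (tabulate∘lookup; tabulate-cong)
  open import Function using (_∘_; id; _↔_; mk↔ₛ′)
  open import Function.Properties.Inverse using (↔-refl; ↔-trans)
  open import Relation.Nullary using (yes; no)
  open import Relation.Binary.PropositionalEquality
  open Lists
  open Insertion
  open Evaluation
  open Completions using (completions)

  Code : ℕ → Set
  Code zero = ⊤
  Code (suc n) = Code n × Fin (suc n)

  perm : ∀ {n} → Code n → ℕ → ℕ
  perm {zero} _ = id
  perm {suc n} (c , i) = insert n (toℕ i) (perm c)

  perm-permutes : ∀ {n} (c : Code n) → Permutes n (perm c)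
  perm-permutes {zero} c = permutes-id
  perm-permutes {suc n} (c , i) = permutes-insert (ℕₚ.≤-pred (toℕ<n i)) (perm-permutes c)

  -- By the pigeonhole principle: otherwise α would map n + 1 entries injectively to n values.
  preimage : ∀ n (α : ℕ → ℕ) → (∀ {x} → x < suc n → α x < suc n) → (∀ {x y} → x < suc n → y < suc n → α x ≡ α y → x ≡ y) →
    ∃[ i ] (i < suc n × α i ≡ n)
  preimage n α below inj with any? {n = suc n} (λ i → α (toℕ i) ℕ.≟ n)
  ... | yes (i , e) = toℕ i , toℕ<n i , e
  ... | no none = ⊥-elim (ℕₚ.<-irrefl refl (injective⇒≤ {f = g} g-injective))
    where
    bound : ∀ i → α (toℕ i) < n
    bound i = ℕₚ.≤∧≢⇒< (ℕₚ.≤-pred (below (toℕ<n i))) (λ e → none (i , e))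
    g : Fin (suc n) → Fin n
    g i = fromℕ< (bound i)
    g-injective : ∀ {i j} → g i ≡ g j → i ≡ j
    g-injective {i} {j} e = toℕ-injective (inj (toℕ<n i) (toℕ<n j) (trans (sym (toℕ-fromℕ< (bound i))) (trans (cong toℕ e) (toℕ-fromℕ< (bound j)))))

  -- With i the preimage of n, the composite of α with `swap n i` fixes n and restricts to the
  -- smaller entries.
  encode : ∀ n (α : ℕ → ℕ) → (∀ {x} → x < n → α x < n) → (∀ {x y} → x < n → y < n → α x ≡ α y → x ≡ y) →
    Σ (Code n) λ c → ∀ {x} → x < n → perm c x ≡ α x
  encode zero α below inj = tt , λ ()
  encode (suc n) α below inj with preimage n α below inj
  ... | i , i< , αi≡n with encode n (α ∘ swap n i)
          (λ {x} h → ℕₚ.≤∧≢⇒< (ℕₚ.≤-pred (below (swap-< (ℕₚ.≤-pred i<) (ℕₚ.m<n⇒m<1+n h))))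
            (λ e → ℕₚ.<⇒≢ h (trans (sym (swap-swap n i x)) (trans (cong (swap n i) (inj (swap-< (ℕₚ.≤-pred i<) (ℕₚ.m<n⇒m<1+n h)) i< (trans e (sym αi≡n)))) (swap-snd n i)))))
          (λ {x} {y} h h' e → trans (sym (swap-swap n i x)) (trans (cong (swap n i) (inj (swap-< (ℕₚ.≤-pred i<) (ℕₚ.m<n⇒m<1+n h)) (swap-< (ℕₚ.≤-pred i<) (ℕₚ.m<n⇒m<1+n h')) e)) (swap-swap n i y)))
  ...   | c , agrees = (c , fromℕ< i<) , spec
    where
    spec : ∀ {x} → x < suc n → perm c (swap n (toℕ (fromℕ< i<)) x) ≡ α x
    spec {x} h rewrite toℕ-fromℕ< i< with swap n i x ℕ.≟ n
    ... | no ne = trans (agrees (ℕₚ.≤∧≢⇒< (ℕₚ.≤-pred (swap-< (ℕₚ.≤-pred i<) h)) ne)) (cong α (swap-swap n i x))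
    ... | yes e = trans (cong (perm c) e) (trans (Permutes.fixed (perm-permutes c) ℕₚ.≤-refl)
          (trans (sym αi≡n) (cong α (trans (sym (swap-fst n i)) (trans (cong (swap n i) (sym e)) (swap-swap n i x))))))

  -- The last insertion is recovered from the permutation, as i is the preimage of n.
  perm-injective : ∀ {n} (c c′ : Code n) → (∀ {x} → x < n → perm c x ≡ perm c′ x) → c ≡ c′
  perm-injective {zero} c c′ h = refl
  perm-injective {suc n} (c , i) (c′ , i′) h with toℕ-injective {i = i} {j = i′} same
    where
    p′ = perm-permutes c′
    same : toℕ i ≡ toℕ i′
    same = trans (sym (swap-swap n (toℕ i′) (toℕ i))) (trans (cong (swap n (toℕ i′)) (Permutes.injective p′
        (trans (sym (h (toℕ<n i))) (trans (insert-at (perm-permutes c) (toℕ i)) (sym (Permutes.fixed p′ ℕₚ.≤-refl)))))) (swap-fst n (toℕ i′)))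
  ... | refl = cong (_, i) (perm-injective c c′ (λ {x} l →
    trans (cong (perm c) (sym (swap-swap n (toℕ i) x))) (trans (h (swap-< (ℕₚ.≤-pred (toℕ<n i)) (ℕₚ.m<n⇒m<1+n l))) (cong (perm c′) (swap-swap n (toℕ i) x)))))

  vec : ∀ {n} → Code n → Vec (Fin n) n
  vec {n} c = toVec n (perm c)

  vec-injective : ∀ {n} (c c′ : Code n) → vec c ≡ vec c′ → c ≡ c′
  vec-injective {n} c c′ e = perm-injective c c′ (λ {x} h → subst (λ x → perm c x ≡ perm c′ x) (toℕ-fromℕ< h)
    (trans (sym (toℕ-toVec (perm-permutes c) (fromℕ< h))) (trans (cong (λ v → toℕ (lookup v (fromℕ< h))) e) (toℕ-toVec (perm-permutes c′) (fromℕ< h)))))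

  lookup-injective : ∀ {A : Set} {n} (v w : Vec A n) → (∀ i → lookup v i ≡ lookup w i) → v ≡ w
  lookup-injective v w h = trans (sym (tabulate∘lookup v)) (trans (tabulate-cong h) (tabulate∘lookup w))

  isPerm-injective : ∀ {n} (v : Vec (Fin n) n) → T (isPerm v) → ∀ i j → lookup v i ≡ lookup v j → i ≡ j
  isPerm-injective {n} v t i j e with lookup v i ≟ᶠ lookup v j | i ≟ᶠ j | allB⁻ _ (allFin n) (allB⁻ _ (allFin n) t (∈-allFin i)) (∈-allFin j)
    where allB⁻ : ∀ {A : Set} (p : A → Bool) xs → T (allB p xs) → ∀ {x} → x ∈ xs → T (p x)
          allB⁻ p (x ∷ xs) t (here refl) with p x
          ... | true = tt
          allB⁻ p (y ∷ xs) t (there h) with p y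
          ... | true = allB⁻ p xs t h
  ... | _ | yes q | _ = q
  ... | no ne | no _ | _ = ⊥-elim (ne e)
  ... | yes _ | no _ | ()

  encode-vec : ∀ {n} (v : Vec (Fin n) n) → T (isPerm v) → Σ (Code n) λ c → vec c ≡ v
  encode-vec {n} v t with encode n α (λ h → subst (_< n) (sym (α-fin h)) (toℕ<n _))
      (λ {x} {y} h h′ e → trans (sym (toℕ-fromℕ< h)) (trans (cong toℕ (isPerm-injective v t _ _ (toℕ-injective (trans (sym (α-fin h)) (trans e (α-fin h′)))))) (toℕ-fromℕ< h′)))
    where
    α : ℕ → ℕ
    α = ext 0 (toℕ ∘ lookup v)
    α-fin : ∀ {x} (h : x < n) → α x ≡ toℕ (lookup v (fromℕ< h))
    α-fin h = trans (cong α (sym (toℕ-fromℕ< h))) (ext-toℕ 0 (toℕ ∘ lookup v) (fromℕ< h))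
  ... | c , agrees = c , lookup-injective (vec c) v (λ i → toℕ-injective (trans (toℕ-toVec (perm-permutes c) i) (trans (agrees (toℕ<n i)) (ext-toℕ 0 (toℕ ∘ lookup v) i))))

  sumFin : ∀ {m} → (Fin m → ℕ) → ℕ
  sumFin {zero} F = 0
  sumFin {suc m} F = F Fin.zero ℕ.+ sumFin (F ∘ Fin.suc)

  sumCode : ∀ n → (Code n → ℕ) → ℕ
  sumCode zero F = F tt
  sumCode (suc n) F = sumCode n (λ c → sumFin (λ i → F (c , i)))

  Fin-sumFin : ∀ {m} (F : Fin m → ℕ) → Fin (sumFin F) ↔ Σ (Fin m) (Fin ∘ F)
  Fin-sumFin {zero} F = mk↔ₛ′ (λ ()) (λ ()) (λ ()) (λ ())
  Fin-sumFin {suc m} F = ↔-trans +↔⊎ (↔-trans (↔-refl ⊎-↔ Fin-sumFin (F ∘ Fin.suc)) (mk↔ₛ′ to from to-from from-to))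
    where
    to : Fin (F Fin.zero) ⊎ Σ (Fin m) (Fin ∘ F ∘ Fin.suc) → Σ (Fin (suc m)) (Fin ∘ F)
    to (inj₁ x) = Fin.zero , x
    to (inj₂ (i , x)) = Fin.suc i , x
    from : Σ (Fin (suc m)) (Fin ∘ F) → Fin (F Fin.zero) ⊎ Σ (Fin m) (Fin ∘ F ∘ Fin.suc)
    from (Fin.zero , x) = inj₁ x
    from (Fin.suc i , x) = inj₂ (i , x)
    to-from : ∀ y → to (from y) ≡ y
    to-from (Fin.zero , x) = refl
    to-from (Fin.suc i , x) = refl
    from-to : ∀ y → from (to y) ≡ y
    from-to (inj₁ x) = refl
    from-to (inj₂ y) = refl

  Fin-sumCode : ∀ n (F : Code n → ℕ) → Fin (sumCode n F) ↔ Σ (Code n) (Fin ∘ F)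
  Fin-sumCode zero F = mk↔ₛ′ (tt ,_) proj₂ (λ _ → refl) (λ _ → refl)
  Fin-sumCode (suc n) F = ↔-trans (Fin-sumCode n (λ c → sumFin (λ i → F (c , i))))
    (↔-trans (Σ-↔ ↔-refl (λ {c} → Fin-sumFin (λ i → F (c , i)))) (mk↔ₛ′ (λ { (c , i , x) → (c , i) , x }) (λ { ((c , i) , x) → c , i , x }) (λ _ → refl) (λ _ → refl)))

  Fin-one : ∀ b → Fin (one b) ↔ T b
  Fin-one true = 1↔⊤
  Fin-one false = 0↔⊥

  module _ {n} (P : Vec (Fin n) n → Bool) (P-perm : ∀ v → T (P v) → T (isPerm v)) where

    coded : Σ (Code n) (T ∘ P ∘ vec) ↔ Σ (Vec (Fin n) n) (T ∘ P)
    coded = mk↔ₛ′ to from to-from from-to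
      where
      to : Σ (Code n) (T ∘ P ∘ vec) → Σ (Vec (Fin n) n) (T ∘ P)
      to (c , t) = vec c , t
      code : ∀ v → T (P v) → Σ (Code n) λ c → vec c ≡ v
      code v t = encode-vec v (P-perm v t)
      from : Σ (Vec (Fin n) n) (T ∘ P) → Σ (Code n) (T ∘ P ∘ vec)
      from (v , t) = proj₁ (code v t) , subst (T ∘ P) (sym (proj₂ (code v t))) t
      same : ∀ {A : Set} (Q : A → Bool) {x y} {t : T (Q x)} {u : T (Q y)} → x ≡ y → _≡_ {A = Σ A (T ∘ Q)} (x , t) (y , u)
      same Q {x} refl = cong (x ,_) (T-irrelevant _ _)
      to-from : ∀ y → to (from y) ≡ y
      to-from (v , t) = same P (proj₂ (code v t))
      from-to : ∀ y → from (to y) ≡ y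
      from-to (c , t) = same (P ∘ vec) (vec-injective _ c (proj₂ (code (vec c) t)))

    number : ℕ
    number = sumCode n (λ c → one (P (vec c)))

    number-↔ : Fin number ↔ Σ (Vec (Fin n) n) (T ∘ P)
    number-↔ = ↔-trans (Fin-sumCode n _) (↔-trans (Σ-↔ ↔-refl (λ {c} → Fin-one (P (vec c)))) coded)

  weigh : (∀ n → Vec (Fin n) n → Bool) → ℕ → (ℕ → ℕ) → ℤ
  weigh P n α = if P n (toVec n α) then + 24 else + 0

  sumN-front : ∀ g m → sumN g (suc m) ≡ g 0 ℤ.+ sumN (g ∘ suc) m
  sumN-front g zero = ℤₚ.+-comm (+ 0) (g 0)
  sumN-front g (suc m) = trans (cong (ℤ._+ g (suc m)) (sumN-front g m)) (ℤₚ.+-assoc (g 0) _ _)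

  sumFin-sumN : ∀ m (F : Fin m → ℕ) (g : ℕ → ℤ) → (∀ i → + 24 ℤ.* + F i ≡ g (toℕ i)) → + 24 ℤ.* + sumFin F ≡ sumN g m
  sumFin-sumN zero F g h = refl
  sumFin-sumN (suc m) F g h = trans (ℤₚ.*-distribˡ-+ (+ 24) (+ F Fin.zero) (+ sumFin (F ∘ Fin.suc)))
    (trans (cong₂ ℤ._+_ (h Fin.zero) (sumFin-sumN m (F ∘ Fin.suc) (g ∘ suc) (h ∘ Fin.suc))) (sym (sumN-front g m)))

  -- Each step of the induction moves the last insertion of the code over into `completions`, where
  -- N counts those already moved.
  sumCode-completions : ∀ E n N (F : Code n → ℕ) → (∀ c → + 24 ℤ.* + F c ≡ completions E N n (perm c)) → + 24 ℤ.* + sumCode n F ≡ completions E (n ℕ.+ N) 0 id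
  sumCode-completions E zero N F h = h tt
  sumCode-completions E (suc n) N F h = subst (λ M → + 24 ℤ.* + sumCode (suc n) F ≡ completions E M 0 id) (ℕₚ.+-suc n N)
    (sumCode-completions E n (suc N) (λ c → sumFin (λ i → F (c , i))) (λ c → sumFin-sumN (suc n) (λ i → F (c , i)) (λ i → completions E N (suc n) (insert n i (perm c))) (λ i → h (c , i))))

  number-weigh : ∀ (P : ∀ n → Vec (Fin n) n → Bool) (P-perm : ∀ n v → T (P n v) → T (isPerm v)) n →
    + 24 ℤ.* + number (P n) (P-perm n) ≡ completions (weigh P) n 0 id
  number-weigh P P-perm n = subst (λ M → + 24 ℤ.* + number (P n) (P-perm n) ≡ completions (weigh P) M 0 id) (ℕₚ.+-identityʳ n)
    (sumCode-completions (weigh P) n 0 (λ c → one (P n (vec c))) (λ c → indicator (P n (vec c))))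
    where indicator : ∀ b → + 24 ℤ.* + one b ≡ (if b then + 24 else + 0)
          indicator true = refl
          indicator false = refl

-- Specialisation to the four counts, and division by the constants.

module Conclusion where
  open import Defs
  open import Data.Bool using (Bool; true; false; if_then_else_; _∧_; T)
  open import Data.Nat as ℕ using (ℕ; zero; suc; _≡ᵇ_; s≤s)
  open import Data.Nat.Properties as ℕₚ using ()
  open import Data.Nat.Combinatorics using (_C_; nCk+nC[k+1]≡[n+1]C[k+1]; k>n⇒nCk≡0)
  open import Data.Integer using (ℤ; +_; _+_; _*_; _-_; -_)
  open import Data.Integer.Properties as ℤₚ using (+-injective; pos-*; *-cancelˡ-≡)
  open import Data.Integer.Tactic.RingSolver using (solve-∀)
  open import Data.Fin using (Fin)
  open import Data.List using ([]; _∷_; length)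
  open import Data.List.Relation.Unary.All using ([])
  open import Data.Vec using (Vec)
  open import Relation.Binary.PropositionalEquality
  open Recurrences
  open Lists
  open Insertion
  open Evaluation
  open Completions
  open Codes

  genus1 : ℕ → ∀ n → Vec (Fin n) n → Bool
  genus1 k n v = isPerm v ∧ genusOne v ∧ (z (app v) ≡ᵇ k)

  genus1BP : ℕ → ℕ → ∀ n → Vec (Fin n) n → Bool
  genus1BP k j n v = isPerm v ∧ genusOne v ∧ (z (app v) ≡ᵇ k) ∧ (backPoints (app v) ≡ᵇ j)

  T-∧ˡ : ∀ a {b} → T (a ∧ b) → T a
  T-∧ˡ true t = _

  genus1-value : ∀ kf {n α k b x xs cycles} → State n α k b (x ∷ xs) cycles →
    weigh (genus1 kf) n α ≡ (if (k ℕ.+ suc (length cycles) ℕ.+ 2 ≡ᵇ n ℕ.+ 1) ∧ (k ≡ᵇ kf) then every b else + 0)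
  genus1-value kf s rewrite isPerm-toVec (State.permutes s) | genusOne-perm s | z-perm s = refl

  genus1BP-value : ∀ kf j {n α k b x xs cycles} → State n α k b (x ∷ xs) cycles →
    weigh (genus1BP kf j) n α ≡ (if (k ℕ.+ suc (length cycles) ℕ.+ 2 ≡ᵇ n ℕ.+ 1) ∧ (k ≡ᵇ kf) then only j b else + 0)
  genus1BP-value kf j {n} {k = k} {b} {cycles = cycles} s rewrite isPerm-toVec (State.permutes s) | genusOne-perm s | z-perm s | backPoints-perm s =
    lem (k ℕ.+ suc (length cycles) ℕ.+ 2 ≡ᵇ n ℕ.+ 1) (k ≡ᵇ kf)
    where lem : ∀ g c → (if g ∧ c ∧ (b ≡ᵇ j) then + 24 else + 0) ≡ (if g ∧ c then only j b else + 0)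
          lem true true = refl
          lem true false = refl
          lem false c = refl

  module _ (W : ℕ → ℤ) (V : Array) (V-step : Step V (source W)) (V-zero : ∀ j l → V 0 j l ≡ + 0)
    (P : ∀ n → Vec (Fin n) n → Bool) (P-perm : ∀ n v → T (P n v) → T (isPerm v)) (j : ℕ)
    (P-value : ∀ {n α k b x xs cycles} → State n α k b (x ∷ xs) cycles →
      weigh P n α ≡ (if (k ℕ.+ suc (length cycles) ℕ.+ 2 ≡ᵇ n ℕ.+ 1) ∧ (k ≡ᵇ suc j) then W b else + 0)) where

    -- The recurrences start at the only permutation of one entry, a first push with stack height
    -- one. So N of the N + 1 steps and j of the j + 1 pushes remain.
    number-value : ∀ N → + 24 * + number (P (suc N)) (P-perm (suc N)) ≡ V N j 0
    number-value N = trans (number-weigh P P-perm (suc N)) (trans (cong (λ y → + 0 + y)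
        (Counting.genus-zero W (suc j) (weigh P) P-value V V-step V-zero N j (push State-id) refl [] refl refl))
      (lem (V N j 0)))
      where lem : ∀ x → + 0 + (x + + 0) ≡ x
            lem = solve-∀

  bin-C : ∀ n k → bin n k ≡ + (n C k)
  bin-C zero zero = refl
  bin-C (suc n) zero = refl
  bin-C zero (suc k) = cong +_ (sym (k>n⇒nCk≡0 {0} {suc k} (s≤s ℕ.z≤n)))
  bin-C (suc n) (suc k) = trans (cong₂ _+_ (bin-C n k) (bin-C n (suc k))) (cong +_ (nCk+nC[k+1]≡[n+1]C[k+1] n k))

  twice-C2 : ∀ m → + 2 * + ((2 ℕ.+ m) C 2) ≡ (+ 1 + + m) * (+ 2 + + m)
  twice-C2 m = trans (cong (λ y → + 2 * y) (sym (bin-C (2 ℕ.+ m) 2))) (trans (absorb (2 ℕ.+ m) 1) (lem (+ m) (bin (2 ℕ.+ m) 1) (absorb (2 ℕ.+ m) 0)))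
    where lem : ∀ m b → (+ 1 + + 0) * b ≡ (+ 2 + m - + 0) * + 1 → (+ 2 + m - + 1) * b ≡ (+ 1 + m) * (+ 2 + m)
          lem m b h = trans (lem₁ m b) (trans (cong (λ y → (+ 1 + m) * y) h) (lem₂ m))
            where lem₁ : ∀ m b → (+ 2 + m - + 1) * b ≡ (+ 1 + m) * ((+ 1 + + 0) * b)
                  lem₁ = solve-∀
                  lem₂ : ∀ m → (+ 1 + m) * ((+ 2 + m - + 0) * + 1) ≡ (+ 1 + m) * (+ 2 + m)
                  lem₂ = solve-∀

  private
    quotient : ∀ c y m b a → + 2 * + c ≡ (+ 1 + + m) * (+ 2 + + m) → + 4 * + y ≡ + 2 * (+ 1 + + m) * (+ 2 + + m) * + b * + a → y ≡ c ℕ.* b ℕ.* a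
    quotient c y m b a h₂ h = +-injective (*-cancelˡ-≡ (+ 4) (+ y) (+ (c ℕ.* b ℕ.* a)) (trans h (trans (lem₁ (+ 1 + + m) (+ 2 + + m) (+ b) (+ a)) (trans (cong (λ c → + 2 * c * + b * + a) (sym h₂))
        (trans (lem₂ (+ c) (+ b) (+ a)) (cong (λ c → + 4 * c) (trans (cong (_* + a) (sym (pos-* c b))) (sym (pos-* (c ℕ.* b) a)))))))))
      where lem₁ : ∀ x y b a → + 2 * x * y * b * a ≡ + 2 * (x * y) * b * a
            lem₁ = solve-∀
            lem₂ : ∀ c b a → + 2 * (+ 2 * c) * b * a ≡ + 4 * (c * b * a)
            lem₂ = solve-∀

    quotient-six : ∀ c x m b a → + 2 * + c ≡ (+ 1 + + m) * (+ 2 + + m) → + 24 * + x ≡ + 2 * (+ 1 + + m) * (+ 2 + + m) * + b * + a → 6 ℕ.* x ≡ c ℕ.* b ℕ.* a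
    quotient-six c x m b a h₂ h = quotient c (6 ℕ.* x) m b a h₂ (trans (cong (λ y → + 4 * y) (pos-* 6 x)) (trans (lem (+ x)) h))
      where lem : ∀ x → + 4 * (+ 6 * x) ≡ + 24 * x
            lem = solve-∀

    quotient-three : ∀ c x m b a → + 2 * + c ≡ (+ 1 + + m) * (+ 2 + + m) → + 24 * + x ≡ + 4 * (+ 1 + + m) * (+ 2 + + m) * + b * + a → 3 ℕ.* x ≡ c ℕ.* b ℕ.* a
    quotient-three c x m b a h₂ h = quotient c (3 ℕ.* x) m b a h₂ (*-cancelˡ-≡ (+ 2) (+ 4 * + (3 ℕ.* x)) (+ 2 * (+ 1 + + m) * (+ 2 + + m) * + b * + a)
        (trans (cong (λ y → + 2 * (+ 4 * y)) (pos-* 3 x)) (trans (lem (+ x)) (trans h (lem₂ (+ 1 + + m) (+ 2 + + m) (+ b) (+ a))))))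
      where lem : ∀ x → + 2 * (+ 4 * (+ 3 * x)) ≡ + 24 * x
            lem = solve-∀
            lem₂ : ∀ u v b a → + 4 * u * v * b * a ≡ + 2 * (+ 2 * u * v * b * a)
            lem₂ = solve-∀

  six : ∀ x m p q → + 24 * + x ≡ + 2 * (+ 1 + + m) * (+ 2 + + m) * bin m p * bin m q → 6 ℕ.* x ≡ ((2 ℕ.+ m) C 2) ℕ.* (m C p) ℕ.* (m C q)
  six x m p q h = quotient-six ((2 ℕ.+ m) C 2) x m (m C p) (m C q) (twice-C2 m) (trans h (cong₂ (λ b a → + 2 * (+ 1 + + m) * (+ 2 + + m) * b * a) (bin-C m p) (bin-C m q)))

  three : ∀ x m p q → + 24 * + x ≡ + 4 * (+ 1 + + m) * (+ 2 + + m) * bin m p * bin m q → 3 ℕ.* x ≡ ((2 ℕ.+ m) C 2) ℕ.* (m C p) ℕ.* (m C q)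
  three x m p q h = quotient-three ((2 ℕ.+ m) C 2) x m (m C p) (m C q) (twice-C2 m) (trans h (cong₂ (λ b a → + 4 * (+ 1 + + m) * (+ 2 + + m) * b * a) (bin-C m p) (bin-C m q)))

  none : ∀ c x → + 24 * + x ≡ + 0 → c ℕ.* x ≡ 0
  none c x h = trans (cong (c ℕ.*_) (+-injective {x} {0} (*-cancelˡ-≡ (+ 24) (+ x) (+ 0) h))) (ℕₚ.*-zeroʳ c)

  -- P, sP and tP have no common factor series from which P - sP - tP could be read off as a
  -- product; it becomes one modulo two absorption identities, whose multiples `certificate`
  -- displays.
  V₁-suc : ∀ M j → V₁ (suc M) j 0 ≡ + 4 * (+ 1 + + M) * (+ 2 + + M) * bin M (suc j) * bin M j
  V₁-suc M j = trans (cong₂ (λ p q → + 2 * (+ 2 + + M) * (+ 3 + + M) * (b₁ + b₂) * p + - + 1 * ((q + + 0) + (V M j 0 - + 0))) (prev-bin M j) (prev-V₀ j))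
      (certificate (+ M) (+ j) (prev (bin M) j) (bin M j) b₁ b₂ (absorb-prev M j) (absorb M (suc j)))
    where
    b₁ = bin M (suc j)
    b₂ = bin M (2 ℕ.+ j)
    prev-V₀ : ∀ j → prev (λ j → V M j 0) j ≡ + 2 * (+ 1 + + M) * (+ 2 + + M) * bin M (suc j) * prev (bin M) j
    prev-V₀ zero = sym (ℤₚ.*-zeroʳ (+ 2 * (+ 1 + + M) * (+ 2 + + M) * bin M 1))
    prev-V₀ (suc j) = refl
    certificate : ∀ m j a b c d → j * b ≡ (m - j + + 1) * a → (+ 1 + (+ 1 + j)) * d ≡ (m - (+ 1 + j)) * c →
      + 2 * (+ 2 + m) * (+ 3 + m) * (c + d) * (b + a) + - + 1 * ((+ 2 * (+ 1 + m) * (+ 2 + m) * c * a + + 0) + (+ 2 * (+ 1 + m) * (+ 2 + m) * d * b - + 0)) ≡ + 4 * (+ 1 + m) * (+ 2 + m) * c * b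
    certificate m j a b c d h₁ h₂ = trans (lem m j a b c d) (trans (cong₂ (λ u v → + 4 * (+ 1 + m) * (+ 2 + m) * c * b + + 2 * (+ 2 + m) * ((a + b) * (u - (m - (+ 1 + j)) * c) - (c + d) * (v - (m - j + + 1) * a))) h₂ h₁) (lem₂ m j a b c d))
      where
      lem : ∀ m j a b c d → + 2 * (+ 2 + m) * (+ 3 + m) * (c + d) * (b + a) + - + 1 * ((+ 2 * (+ 1 + m) * (+ 2 + m) * c * a + + 0) + (+ 2 * (+ 1 + m) * (+ 2 + m) * d * b - + 0)) ≡
        + 4 * (+ 1 + m) * (+ 2 + m) * c * b + + 2 * (+ 2 + m) * ((a + b) * ((+ 1 + (+ 1 + j)) * d - (m - (+ 1 + j)) * c) - (c + d) * (j * b - (m - j + + 1) * a))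
      lem = solve-∀
      lem₂ : ∀ m j a b c d → + 4 * (+ 1 + m) * (+ 2 + m) * c * b + + 2 * (+ 2 + m) * ((a + b) * ((m - (+ 1 + j)) * c - (m - (+ 1 + j)) * c) - (c + d) * ((m - j + + 1) * a - (m - j + + 1) * a)) ≡ + 4 * (+ 1 + m) * (+ 2 + m) * c * b
      lem₂ = solve-∀

  count₀ : ∀ x N j → + 24 * + x ≡ V₀ N j 0 → 6 ℕ.* x ≡ binom (+ suc N) (+ 2) ℕ.* binom (+ suc N - + 2) (+ suc j) ℕ.* binom (+ suc N - + 2) (+ suc j - + 2)
  count₀ x zero j h = none 6 x h
  -- Here k = 1: the lower index k - 2 is negative, and `prev` is 0 accordingly.
  count₀ x (suc M) zero h = trans (none 6 x h) (sym (ℕₚ.*-zeroʳ (((2 ℕ.+ M) C 2) ℕ.* (M C 1))))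
  count₀ x (suc M) (suc j) h = six x M (2 ℕ.+ j) j (trans h (ℤₚ.+-identityʳ (V M j 0)))

  count₁ : ∀ x N j → + 24 * + x ≡ V₁ N j 0 → 3 ℕ.* x ≡ binom (+ suc N) (+ 2) ℕ.* binom (+ suc N - + 2) (+ suc j) ℕ.* binom (+ suc N - + 2) (+ suc j - + 1)
  count₁ x zero j h = none 3 x (trans h (V₁-zero j 0))
  count₁ x (suc M) j h = three x M (suc j) j (trans h (V₁-suc M j))

  count₂ : ∀ x N j → + 24 * + x ≡ V₂ N j 0 → 6 ℕ.* x ≡ binom (+ suc N) (+ 2) ℕ.* binom (+ suc N - + 2) (+ suc j + + 1) ℕ.* binom (+ suc N - + 2) (+ suc j - + 1)
  count₂ x zero j h = none 6 x h
  count₂ x (suc M) j h = trans (six x M (2 ℕ.+ j) j (trans h (ℤₚ.+-identityʳ (V M j 0)))) (cong (λ b → ((2 ℕ.+ M) C 2) ℕ.* (M C suc b) ℕ.* (M C j)) (ℕₚ.+-comm 1 j))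

  count-all : ∀ x N j → + 24 * + x ≡ V N j 0 → 6 ℕ.* x ≡ binom (+ suc N + + 1) (+ 2) ℕ.* binom (+ suc N - + 1) (+ suc j + + 1) ℕ.* binom (+ suc N - + 1) (+ suc j - + 1)
  count-all x N j h = trans (six x N (2 ℕ.+ j) j h) (cong₂ (λ a b → (suc a C 2) ℕ.* (N C suc b) ℕ.* (N C j)) (ℕₚ.+-comm 1 N) (ℕₚ.+-comm 1 j))

  genus1-perm : ∀ k n v → T (genus1 k n v) → T (isPerm v)
  genus1-perm k n v = T-∧ˡ (isPerm v)

  genus1BP-perm : ∀ k j n v → T (genus1BP k j n v) → T (isPerm v)
  genus1BP-perm k j n v = T-∧ˡ (isPerm v)

  Number : ℕ → ℕ → ℕ
  Number k n = number (genus1 k n) (genus1-perm k n)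

  NumberBP : ℕ → ℕ → ℕ → ℕ
  NumberBP k n j = number (genus1BP k j n) (genus1BP-perm k j n)

  Number-value : ∀ N j → + 24 * + Number (suc j) (suc N) ≡ V N j 0
  Number-value N j = number-value every V V-step V-zero (genus1 (suc j)) (genus1-perm (suc j)) j (genus1-value (suc j)) N

  NumberBP-value : ∀ i {V} → Step V (source (only i)) → (∀ j l → V 0 j l ≡ + 0) → ∀ N j → + 24 * + NumberBP (suc j) (suc N) i ≡ V N j 0
  NumberBP-value i {V} step zero′ N j = number-value (only i) V step zero′ (genus1BP (suc j) i) (genus1BP-perm (suc j) i) j (genus1BP-value (suc j) i) N

open import Defs
open import Data.Nat using (ℕ; _≤_; _*_)
open import Data.Integer using (+_; _-_)
open import Data.Fin using (Fin)
open import Data.Product using (Σ; _×_)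
open import Function.Bundles using (_↔_)
open import Relation.Binary.PropositionalEquality using (_≡_)
open import Data.Nat using (suc)
open import Data.Product using (_,_)
open import Relation.Binary.PropositionalEquality using (refl)
open Recurrences using (V₀-step; V₁-step; V₁-zero; V₂-step)
open Codes using (number-↔)
open Conclusion

theorem7p2 : (n k : ℕ) → 1 ≤ n → 1 ≤ k →
    Σ ℕ (λ N → (Fin N ↔ Genus1 n k)
    × 6 * N ≡ binom (+ n Data.Integer.+ + 1) (+ 2) * binom (+ n - + 1) (+ k Data.Integer.+ + 1) * binom (+ n - + 1) (+ k - + 1))
    × Σ ℕ (λ N → (Fin N ↔ Genus1BP n k 0)
    × 6 * N ≡ binom (+ n) (+ 2) * binom (+ n - + 2) (+ k) * binom (+ n - + 2) (+ k - + 2))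
    × Σ ℕ (λ N → (Fin N ↔ Genus1BP n k 1)
    × 3 * N ≡ binom (+ n) (+ 2) * binom (+ n - + 2) (+ k) * binom (+ n - + 2) (+ k - + 1))
    × Σ ℕ (λ N → (Fin N ↔ Genus1BP n k 2)
    × 6 * N ≡ binom (+ n) (+ 2) * binom (+ n - + 2) (+ k Data.Integer.+ + 1) * binom (+ n - + 2) (+ k - + 1))
theorem7p2 (suc N) (suc j) _ _ =
    (Number (suc j) (suc N) , number-↔ (genus1 (suc j) (suc N)) (genus1-perm (suc j) (suc N)) , count-all (Number (suc j) (suc N)) N j (Number-value N j))
  , (NumberBP (suc j) (suc N) 0 , number-↔ (genus1BP (suc j) 0 (suc N)) (genus1BP-perm (suc j) 0 (suc N)) , count₀ (NumberBP (suc j) (suc N) 0) N j (NumberBP-value 0 V₀-step (λ _ _ → refl) N j))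
  , (NumberBP (suc j) (suc N) 1 , number-↔ (genus1BP (suc j) 1 (suc N)) (genus1BP-perm (suc j) 1 (suc N)) , count₁ (NumberBP (suc j) (suc N) 1) N j (NumberBP-value 1 V₁-step V₁-zero N j))
  , (NumberBP (suc j) (suc N) 2 , number-↔ (genus1BP (suc j) 2 (suc N)) (genus1BP-perm (suc j) 2 (suc N)) , count₂ (NumberBP (suc j) (suc N) 2) N j (NumberBP-value 2 V₂-step (λ _ _ → refl) N j))
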